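{- For all integers $n \geq 0$, $$\mathrm{RD}^{(4,9)}(24n+23) \equiv 0 \pmod{24},\quad \mathrm{RD}^{(4,9)}(48n+29) \equiv 0 \pmod{24},\quad \mathrm{RD}^{(4,9)}(96n+89) \equiv 0 \pmod{24}.$$
   Context: For a nonnegative integer $n$, $\mathrm{RD}^{(4,9)}(n)$ denotes the number of partitions of $n$ into parts that are simultaneously 4-regular and 9-distinct, i.e., partitions of $n$ in which no part is divisible by $4$ and each distinct part appears at least once and at most $8$ times. Equivalently, writing $f_k = \prod_{m\ge1}(1-q^{km})$, $\sum_{n\ge0}\mathrm{RD}^{(4,9)}(n)q^n = \frac{f_9 f_4}{f_1 f_{36}}$. -}

module Defs where

open import Data.Nat using (ℕ; zero; suc; _+_; _*_; _∸_; _≤_; _/_)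
open import Data.Nat.Properties using (_≟_; _≤?_)
open import Data.Nat.Divisibility using (_∣_; _∣?_)
open import Data.List using (List; []; _∷_; _++_; map; concatMap; replicate; upTo; length; filter)
open import Data.List.Relation.Unary.All using (All; all?)
open import Data.Product using (_×_)
open import Relation.Nullary using (¬_)
open import Relation.Nullary.Decidable using (¬?; _×-dec_)

-- partitionsUpTo k n : all partitions of n into parts from {1,…,k},
-- each listed exactly once as a non-increasing list of parts.
-- (Part size j = k appears with multiplicity m, then recurse on parts ≤ k-1.)
partitionsUpTo : ℕ → ℕ → List (List ℕ)
partitionsUpTo zero zero = [] ∷ []
partitionsUpTo zero (suc n) = []
partitionsUpTo (suc k) n =
  concatMap (λ m → map (replicate m (suc k) ++_) (partitionsUpTo k (n ∸ m * suc k)))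
            (upTo (suc (n / suc k)))

partitions : ℕ → List (List ℕ)
partitions n = partitionsUpTo n n

-- 4-regular: no part divisible by 4;
-- 9-distinct: every part occurs at most 8 times.
IsRD49 : List ℕ → Set
IsRD49 p = All (λ x → ¬ (4 ∣ x)) p × All (λ x → length (filter (x ≟_) p) ≤ 8) p

isRD49? : (p : List ℕ) → Relation.Nullary.Dec (IsRD49 p)
isRD49? p = all? (λ x → ¬? (4 ∣? x)) p ×-dec all? (λ x → length (filter (x ≟_) p) ≤? 8) p

RD49 : ℕ → ℕ
RD49 n = length (filter isRD49? (partitions n))

{-# OPTIONS --safe #-}
-- Write φ(q) = Σ q^(k²), ψ(q) = Σ q^(2k²+k), Ω(q) = Σ q^(3k²+2k), sums over k ∈ ℤ, and R(q) = Σ RD49(n) qⁿ.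
-- Gauss's product formulas, obtained from a finite Jacobi triple product, turn the Euler product of R into
-- R(−q) φ(q) ψ(q⁹) = ψ(q) φ(q⁹).  Dissecting φ and ψ modulo 3 and eliminating two of the three sections of
-- R(−q), the remaining one, F(q) = Σ (−1)ⁿ RD49(3n+2) qⁿ, satisfies
--   F ψ(q³) (φ(q³)³ + 8 q Ω³) = 2 Ω φ(q³) (4 ψ(q) ψ(q²) − 3 φ(q³) ψ(q³)).
-- Modulo 8 this collapses to F ≡ 2 Ω φ(q³), because φ² ≡ 1 mod 4; the n-th coefficient vanishes when 3n + 1 is
-- not a sum of two squares, which holds for n ≡ 7 mod 8, 9 mod 16 and 29 mod 32.  Modulo 3, cubing is q ↦ q³ and
-- φ(q) ψ(q²) = ψ(q)², so F ≡ 2 Ω φ; its odd coefficients count lattice points that ℤ/3 permutes freely.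
module Submission where

open import Defs
open import Data.Nat using (ℕ; _+_; _*_)
open import Data.Nat.Divisibility using (_∣_)
open import Data.Product using (_×_)

import Algebra.Solver.Ring
open import Algebra.Bundles using (CommutativeRing)
open import Algebra.Solver.Ring.AlmostCommutativeRing
  using (fromCommutativeRing; _-Raw-AlmostCommutative⟶_)
open import Algebra.Structures using (IsAbelianGroup)
open import Data.Empty using (⊥-elim)
open import Data.Integer as ℤ using (ℤ; +_; -[1+_]; 0ℤ; 1ℤ)
open import Data.Integer.DivMod using (_%ℕ_; _/ℕ_; a≡a%ℕn+[a/ℕn]*n; n%ℕd<d)
import Data.Integer.Properties as ℤ
open import Data.Integer.Tactic.RingSolver using (solve-∀)
open import Data.List
  using (List; []; _∷_; _++_; map; concatMap; filter; length; upTo; replicate; applyUpTo; cartesianProduct)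
open import Data.List.Membership.Propositional using (_∈_; find)
open import Data.List.Membership.Propositional.Properties
open import Data.List.Membership.Propositional.Properties.WithK using (unique∧set⇒bag)
open import Data.List.Properties
  using (length-map; length-++; length-replicate; filter-++; filter-accept; filter-reject; filter-all; filter-none;
         map-cong; map-applyUpTo; map-upTo)
open import Data.List.Relation.Binary.BagAndSetEquality using (∼bag⇒↭)
open import Data.List.Relation.Binary.Disjoint.Propositional using (Disjoint)
open import Data.List.Relation.Binary.Permutation.Propositional.Properties using (↭-length)
open import Data.List.Relation.Unary.All as All using (All; []; _∷_)
import Data.List.Relation.Unary.All.Properties as All
open import Data.List.Relation.Unary.AllPairs using ([]; _∷_)
open import Data.List.Relation.Unary.Any using (here; there)
open import Data.List.Relation.Unary.Unique.Propositional using (Unique)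
import Data.List.Relation.Unary.Unique.Propositional.Properties as Unique
open import Data.Maybe using (just; nothing)
open import Data.Nat as ℕ using (zero; suc; z≤n; s≤s)
open import Data.Nat.DivMod using (m/n≡1+[m∸n]/n; m<n⇒m/n≡0)
open import Data.Nat.Divisibility as ℕ using (_∣?_; ∣m+n∣m⇒∣n; n∣m*n; ∣-refl; ∣m∣n⇒∣m+n)
open import Data.Nat.ListAction using (sum)
import Data.Nat.Properties as ℕ
import Data.Nat.Tactic.RingSolver as ℕSolver
open import Data.Product using (_,_; ∃; ∃₂; proj₁; proj₂)
open import Data.Product.Function.NonDependent.Propositional using (_×-↔_)
open import Data.Sum using (_⊎_; inj₁; inj₂; [_,_]; swap)
open import Data.Sum.Function.Propositional using (_⊎-↔_)
import Data.Sum.Properties as Sum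
open import Data.Unit using (⊤; tt)
open import Function
  using (_∘_; flip; _⇔_; _↔_; mk⇔; mk↔ₛ′; mk⤖; Equivalence; Inverse; Injective; StrictlySurjective)
open import Function.Consequences.Propositional using (strictlySurjective⇒surjective)
open import Function.Properties.Bijection using (⤖⇒↔)
open import Function.Properties.Inverse using (↔-sym; ↔-trans; ↔-refl)
open import Function.Related.TypeIsomorphisms using (×-distribʳ-⊎)
open import Level using (0ℓ)
open import Relation.Binary.Definitions using (WeaklyDecidable)
open import Relation.Binary.PropositionalEquality
  using (_≡_; _≢_; _≗_; refl; sym; trans; cong; cong₂; subst; module ≡-Reasoning)
import Relation.Binary.Reasoning.Setoid
open import Relation.Nullary using (¬_; Dec; yes; no)
open import Relation.Nullary.Decidable using (from-no; from-yes; ¬?)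
open import Relation.Unary using (Decidable)

-- The sign change q ↦ -q is made because 1 - (-q)^d is 1 + q^d for odd d and 1 - q^d for even d:
-- the product over all d prime to the condition 4 ∣ d is then exactly φ(q)/ψ(q), a quotient of
-- theta series with nonnegative coefficients. Such series count integer points, so each theta
-- identity becomes a size-preserving bijection between lattices, checked by polynomial identities
-- in the coordinates. Neither division nor an infinite product occurs. Quotients are
-- cross-multiplied, factors with constant term 1 are cancelled modulo 8 or 3, and infinite products
-- are replaced by finite ones that agree with them below an arbitrary order. The factor φ(q³)³ + 8
-- q Ω³ is the determinant of the linear system for the three sections; it is the product of φ over
-- the three cube roots of q. The number 3n + 1 enters because Ω φ(q³) counts the solutions of (3k +
-- 1)² + (3l)² = 3n + 1. In the three progressions 3n + 1 is 2, 4 or 8 times a number that is 3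
-- modulo 4, and n is odd, which is what the argument modulo 3 asks for.

private variable X Y : Set

-- Power series with integer coefficients

Series : Set
Series = ℕ → ℤ

infixl 6 _⊕_
infixl 7 _⊗_
infix 8 ⊝_

tail : ∀ {A : Set} → (ℕ → A) → (ℕ → A)
tail a n = a (suc n)

-- Opacity keeps sums from unfolding under η, which would defeat unification.
opaque
  _⊕_ : Series → Series → Series
  (a ⊕ b) n = a n ℤ.+ b n

  ⊝_ : Series → Series
  (⊝ a) n = ℤ.- a n

  ⊕-at : ∀ a b n → (a ⊕ b) n ≡ a n ℤ.+ b n
  ⊕-at a b n = refl

-- The Cauchy product, by recursion on the constant term of the left factor. `convolve` on lists
-- follows the same recursion, so a product of classes yields this product without reindexing.
_⊗_ : Series → Series → Series
(a ⊗ b) zero = a 0 ℤ.* b 0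
(a ⊗ b) (suc n) = a 0 ℤ.* b (suc n) ℤ.+ (tail a ⊗ b) n

κ : ℤ → Series
κ z zero = z
κ z (suc n) = 0ℤ

shift : Series → Series
shift a zero = 0ℤ
shift a (suc n) = a n

module _ where
  open ≡-Reasoning

  ⊗-cong≗ : ∀ {a a′ b b′} → a ≗ a′ → b ≗ b′ → a ⊗ b ≗ a′ ⊗ b′
  ⊗-cong≗ p q zero = cong₂ ℤ._*_ (p 0) (q 0)
  ⊗-cong≗ p q (suc n) = cong₂ ℤ._+_ (cong₂ ℤ._*_ (p 0) (q (suc n))) (⊗-cong≗ (p ∘ suc) q n)

  ⊗-zeroˡ : ∀ a → κ 0ℤ ⊗ a ≗ κ 0ℤ
  0⊗ : ∀ a → (λ _ → 0ℤ) ⊗ a ≗ λ _ → 0ℤ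
  0⊗ a zero = refl
  0⊗ a (suc n) = trans (ℤ.+-identityˡ _) (0⊗ a n)
  κ0 : κ 0ℤ ≗ λ _ → 0ℤ
  κ0 zero = refl
  κ0 (suc n) = refl
  ⊗-zeroˡ a n = trans (⊗-cong≗ κ0 (λ _ → refl) n) (trans (0⊗ a n) (sym (κ0 n)))

  κ-⊗ : ∀ z a n → (κ z ⊗ a) n ≡ z ℤ.* a n
  κ-⊗ z a zero = refl
  κ-⊗ z a (suc n) = begin
    z ℤ.* a (suc n) ℤ.+ ((λ _ → 0ℤ) ⊗ a) n ≡⟨ cong (ℤ._+_ (z ℤ.* a (suc n))) (0⊗ a n) ⟩
    z ℤ.* a (suc n) ℤ.+ 0ℤ                 ≡⟨ ℤ.+-identityʳ _ ⟩
    z ℤ.* a (suc n)                        ∎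

  -- The mirror image of the defining recursion, peeling the right factor instead of the left one.
  -- Commutativity plays the two recursions against each other.
  ⊗-suc : ∀ a b n → (a ⊗ b) (suc n) ≡ (a ⊗ tail b) n ℤ.+ a (suc n) ℤ.* b 0
  ⊗-suc a b zero = refl
  ⊗-suc a b (suc n) = begin
    a 0 ℤ.* b (suc (suc n)) ℤ.+ (tail a ⊗ b) (suc n)
      ≡⟨ cong (ℤ._+_ (a 0 ℤ.* b (suc (suc n)))) (⊗-suc (tail a) b n) ⟩
    a 0 ℤ.* b (suc (suc n)) ℤ.+ ((tail a ⊗ tail b) n ℤ.+ a (suc (suc n)) ℤ.* b 0)
      ≡⟨ sym (ℤ.+-assoc (a 0 ℤ.* b (suc (suc n))) _ _) ⟩
    (a ⊗ tail b) (suc n) ℤ.+ a (suc (suc n)) ℤ.* b 0 ∎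

  ⊗-comm : ∀ a b → a ⊗ b ≗ b ⊗ a
  ⊗-comm a b zero = ℤ.*-comm (a 0) (b 0)
  ⊗-comm a b (suc n) = begin
    a 0 ℤ.* b (suc n) ℤ.+ (tail a ⊗ b) n
      ≡⟨ cong₂ ℤ._+_ (ℤ.*-comm (a 0) (b (suc n))) (⊗-comm (tail a) b n) ⟩
    b (suc n) ℤ.* a 0 ℤ.+ (b ⊗ tail a) n
      ≡⟨ ℤ.+-comm (b (suc n) ℤ.* a 0) _ ⟩
    (b ⊗ tail a) n ℤ.+ b (suc n) ℤ.* a 0
      ≡⟨ sym (⊗-suc b a n) ⟩
    (b ⊗ a) (suc n) ∎

  opaque
    unfolding _⊕_

    ⊗-distribʳ : ∀ a b c → (b ⊕ c) ⊗ a ≗ b ⊗ a ⊕ c ⊗ a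
    ⊗-distribʳ a b c zero = ℤ.*-distribʳ-+ (a 0) (b 0) (c 0)
    ⊗-distribʳ a b c (suc n) = begin
      (b 0 ℤ.+ c 0) ℤ.* a (suc n) ℤ.+ ((tail b ⊕ tail c) ⊗ a) n
        ≡⟨ cong (ℤ._+_ ((b 0 ℤ.+ c 0) ℤ.* a (suc n))) (⊗-distribʳ a (tail b) (tail c) n) ⟩
      (b 0 ℤ.+ c 0) ℤ.* a (suc n) ℤ.+ ((tail b ⊗ a) n ℤ.+ (tail c ⊗ a) n)
        ≡⟨ lemma (b 0) (c 0) (a (suc n)) _ _ ⟩
      (b ⊗ a ⊕ c ⊗ a) (suc n) ∎
      where
      lemma : ∀ x y z u v → (x ℤ.+ y) ℤ.* z ℤ.+ (u ℤ.+ v) ≡ x ℤ.* z ℤ.+ u ℤ.+ (y ℤ.* z ℤ.+ v)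
      lemma = solve-∀

  scale-⊗ : ∀ z a b n → ((λ i → z ℤ.* a i) ⊗ b) n ≡ z ℤ.* (a ⊗ b) n
  scale-⊗ z a b zero = ℤ.*-assoc z (a 0) (b 0)
  scale-⊗ z a b (suc n) = begin
    z ℤ.* a 0 ℤ.* b (suc n) ℤ.+ ((λ i → z ℤ.* tail a i) ⊗ b) n
      ≡⟨ cong (ℤ._+_ (z ℤ.* a 0 ℤ.* b (suc n))) (scale-⊗ z (tail a) b n) ⟩
    z ℤ.* a 0 ℤ.* b (suc n) ℤ.+ z ℤ.* (tail a ⊗ b) n
      ≡⟨ lemma z (a 0) (b (suc n)) _ ⟩
    z ℤ.* (a ⊗ b) (suc n) ∎
    where
    lemma : ∀ z x y u → z ℤ.* x ℤ.* y ℤ.+ z ℤ.* u ≡ z ℤ.* (x ℤ.* y ℤ.+ u)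
    lemma = solve-∀

  opaque
    unfolding _⊕_

    ⊗-assoc : ∀ a b c → (a ⊗ b) ⊗ c ≗ a ⊗ (b ⊗ c)
    ⊗-assoc a b c zero = ℤ.*-assoc (a 0) (b 0) (c 0)
    ⊗-assoc a b c (suc n) = begin
      a 0 ℤ.* b 0 ℤ.* c (suc n) ℤ.+ (((λ i → a 0 ℤ.* tail b i) ⊕ tail a ⊗ b) ⊗ c) n
        ≡⟨ cong (ℤ._+_ (a 0 ℤ.* b 0 ℤ.* c (suc n)))
             (trans (⊗-distribʳ c (λ i → a 0 ℤ.* tail b i) (tail a ⊗ b) n)
                    (cong₂ ℤ._+_ (scale-⊗ (a 0) (tail b) c n) (⊗-assoc (tail a) b c n))) ⟩
      a 0 ℤ.* b 0 ℤ.* c (suc n) ℤ.+ (a 0 ℤ.* (tail b ⊗ c) n ℤ.+ (tail a ⊗ (b ⊗ c)) n)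
        ≡⟨ lemma (a 0) (b 0) (c (suc n)) _ _ ⟩
      (a ⊗ (b ⊗ c)) (suc n) ∎
      where
      lemma : ∀ x y z u v → x ℤ.* y ℤ.* z ℤ.+ (x ℤ.* u ℤ.+ v) ≡ x ℤ.* (y ℤ.* z ℤ.+ u) ℤ.+ v
      lemma = solve-∀

  shift-⊗ : ∀ a b → shift a ⊗ b ≗ shift (a ⊗ b)
  shift-⊗ a b zero = refl
  shift-⊗ a b (suc n) = ℤ.+-identityˡ _

⊗-identityˡ : ∀ a → κ 1ℤ ⊗ a ≗ a
⊗-identityˡ a n = trans (κ-⊗ 1ℤ a n) (ℤ.*-identityˡ (a n))

κ-* : ∀ x y → κ (x ℤ.* y) ≗ κ x ⊗ κ y
κ-* x y zero = refl
κ-* x y (suc n) = sym (trans (κ-⊗ x (κ y) (suc n)) (ℤ.*-zeroʳ x))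

-- Congruences and the ring of power series modulo m

infix 4 _≡_[mod_]
-- The quotient is kept as data, so that every closure property is a polynomial identity for the
-- ring solver.
record _≡_[mod_] (x y : ℤ) (m : ℕ) : Set where
  constructor _,_
  field
    quotient : ℤ
    equality : x ≡ y ℤ.+ quotient ℤ.* + m

module _ {m : ℕ} where
  mod-reflexive : ∀ {x y} → x ≡ y → x ≡ y [mod m ]
  mod-reflexive {x} refl = 0ℤ , sym (ℤ.+-identityʳ x)

  mod-sym : ∀ {x y} → x ≡ y [mod m ] → y ≡ x [mod m ]
  mod-sym {_} {y} (k , refl) = ℤ.- k , lemma y k (+ m)
    where
    lemma : ∀ y k m → y ≡ y ℤ.+ k ℤ.* m ℤ.+ (ℤ.- k) ℤ.* m
    lemma = solve-∀

  mod-trans : ∀ {x y z} → x ≡ y [mod m ] → y ≡ z [mod m ] → x ≡ z [mod m ]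
  mod-trans {z = z} (k , refl) (l , refl) = l ℤ.+ k , lemma z k l (+ m)
    where
    lemma : ∀ z k l m → z ℤ.+ l ℤ.* m ℤ.+ k ℤ.* m ≡ z ℤ.+ (l ℤ.+ k) ℤ.* m
    lemma = solve-∀

  mod-+ : ∀ {x y u v} → x ≡ y [mod m ] → u ≡ v [mod m ] → x ℤ.+ u ≡ y ℤ.+ v [mod m ]
  mod-+ {y = y} {v = v} (k , refl) (l , refl) = k ℤ.+ l , lemma y v k l (+ m)
    where
    lemma : ∀ y v k l m → y ℤ.+ k ℤ.* m ℤ.+ (v ℤ.+ l ℤ.* m) ≡ y ℤ.+ v ℤ.+ (k ℤ.+ l) ℤ.* m
    lemma = solve-∀

  mod-* : ∀ {x y u v} → x ≡ y [mod m ] → u ≡ v [mod m ] → x ℤ.* u ≡ y ℤ.* v [mod m ]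
  mod-* {y = y} {v = v} (k , refl) (l , refl) =
    k ℤ.* v ℤ.+ y ℤ.* l ℤ.+ k ℤ.* l ℤ.* + m , lemma y v k l (+ m)
    where
    lemma : ∀ y v k l m → (y ℤ.+ k ℤ.* m) ℤ.* (v ℤ.+ l ℤ.* m)
                        ≡ y ℤ.* v ℤ.+ (k ℤ.* v ℤ.+ y ℤ.* l ℤ.+ k ℤ.* l ℤ.* m) ℤ.* m
    lemma = solve-∀

  mod-neg : ∀ {x y} → x ≡ y [mod m ] → ℤ.- x ≡ ℤ.- y [mod m ]
  mod-neg {y = y} (k , refl) = ℤ.- k , lemma y k (+ m)
    where
    lemma : ∀ y k m → ℤ.- (y ℤ.+ k ℤ.* m) ≡ ℤ.- y ℤ.+ (ℤ.- k) ℤ.* m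
    lemma = solve-∀

module SeriesMod (m : ℕ) where

  infix 4 _≈_ _≈[_]_
  record _≈_ (a b : Series) : Set where
    constructor coeffwise
    field _at_ : ∀ n → a n ≡ b n [mod m ]
  open _≈_ public

  -- The substitute for convergence: an infinite product is represented by finite products that
  -- agree with it in this sense for every `N`.
  record _≈[_]_ (a : Series) (N : ℕ) (b : Series) : Set where
    constructor coeffwise[]
    field _at[]_ : ∀ n → n ℕ.< N → a n ≡ b n [mod m ]
  open _≈[_]_ public

  ≗⇒≈ : ∀ {a b} → a ≗ b → a ≈ b
  ≗⇒≈ p = coeffwise λ n → mod-reflexive (p n)

  ≈⇒≈[] : ∀ {a b N} → a ≈ b → a ≈[ N ] b
  ≈⇒≈[] p = coeffwise[] λ n _ → p at n

  -- The coefficient of a product at `n` involves only coefficients up to `n`. Both the full and the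
  -- truncated congruence for products come from this.
  ⊗-cong≤ : ∀ {a a′ b b′} n → (∀ i → i ℕ.≤ n → a i ≡ a′ i [mod m ]) →
            (∀ i → i ℕ.≤ n → b i ≡ b′ i [mod m ]) → (a ⊗ b) n ≡ (a′ ⊗ b′) n [mod m ]
  ⊗-cong≤ zero p q = mod-* (p 0 z≤n) (q 0 z≤n)
  ⊗-cong≤ (suc n) p q =
    mod-+ (mod-* (p 0 z≤n) (q (suc n) ℕ.≤-refl))
          (⊗-cong≤ n (λ i i≤n → p (suc i) (s≤s i≤n)) (λ i i≤n → q i (ℕ.m≤n⇒m≤1+n i≤n)))

  ⊗-cong[] : ∀ {a a′ b b′ N} → a ≈[ N ] a′ → b ≈[ N ] b′ → a ⊗ b ≈[ N ] a′ ⊗ b′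
  ⊗-cong[] p q = coeffwise[] λ n n<N →
    ⊗-cong≤ n (λ i i≤n → (p at[] i) (ℕ.≤-<-trans i≤n n<N))
              (λ i i≤n → (q at[] i) (ℕ.≤-<-trans i≤n n<N))

  opaque
    unfolding _⊕_

    ⊕-cong[] : ∀ {a a′ b b′ N} → a ≈[ N ] a′ → b ≈[ N ] b′ → a ⊕ b ≈[ N ] a′ ⊕ b′
    ⊕-cong[] p q = coeffwise[] λ n n<N → mod-+ ((p at[] n) n<N) ((q at[] n) n<N)

    ⊝-cong[] : ∀ {a b N} → a ≈[ N ] b → ⊝ a ≈[ N ] ⊝ b
    ⊝-cong[] p = coeffwise[] λ n n<N → mod-neg ((p at[] n) n<N)

    private
      ⊕-isAbelianGroup : IsAbelianGroup _≈_ _⊕_ (κ 0ℤ) ⊝_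
      ⊕-isAbelianGroup = record
        { isGroup = record
          { isMonoid = record
            { isSemigroup = record
              { isMagma = record
                { isEquivalence = record
                  { refl = ≗⇒≈ λ _ → refl
                  ; sym = λ p → coeffwise λ n → mod-sym (p at n)
                  ; trans = λ p q → coeffwise λ n → mod-trans (p at n) (q at n)
                  }
                ; ∙-cong = λ p q → coeffwise λ n → mod-+ (p at n) (q at n)
                }
              ; assoc = λ a b c → ≗⇒≈ λ n → ℤ.+-assoc (a n) (b n) (c n)
              }
            ; identity = (λ a → ≗⇒≈ λ n → trans (cong (ℤ._+ a n) (κ0 n)) (ℤ.+-identityˡ (a n)))
                       , (λ a → ≗⇒≈ λ n → trans (cong (λ z → a n ℤ.+ z) (κ0 n)) (ℤ.+-identityʳ (a n)))
            }
          ; inverse = (λ a → ≗⇒≈ λ n → trans (ℤ.+-inverseˡ (a n)) (sym (κ0 n)))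
                    , (λ a → ≗⇒≈ λ n → trans (ℤ.+-inverseʳ (a n)) (sym (κ0 n)))
          ; ⁻¹-cong = λ p → coeffwise λ n → mod-neg (p at n)
          }
        ; comm = λ a b → ≗⇒≈ λ n → ℤ.+-comm (a n) (b n)
        }

      ⊗-distribˡ : ∀ a b c → a ⊗ (b ⊕ c) ≈ a ⊗ b ⊕ a ⊗ c
      ⊗-distribˡ a b c = ≗⇒≈ λ n →
        trans (⊗-comm a (b ⊕ c) n)
        (trans (⊗-distribʳ a b c n)
               (cong₂ ℤ._+_ (⊗-comm b a n) (⊗-comm c a n)))

      κ-+ : ∀ x y → κ (x ℤ.+ y) ≗ κ x ⊕ κ y
      κ-+ x y zero = refl
      κ-+ x y (suc n) = refl

      κ-neg : ∀ x → κ (ℤ.- x) ≗ ⊝ κ x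
      κ-neg x zero = refl
      κ-neg x (suc n) = refl

  ⊗-cong : ∀ {a a′ b b′} → a ≈ a′ → b ≈ b′ → a ⊗ b ≈ a′ ⊗ b′
  ⊗-cong p q = coeffwise λ n → ⊗-cong≤ n (λ i _ → p at i) (λ i _ → q at i)

  seriesRing : CommutativeRing 0ℓ 0ℓ
  seriesRing = record
    { Carrier = Series ; _≈_ = _≈_ ; _+_ = _⊕_ ; _*_ = _⊗_ ; -_ = ⊝_ ; 0# = κ 0ℤ ; 1# = κ 1ℤ
    ; isCommutativeRing = record
      { isRing = record
        { +-isAbelianGroup = ⊕-isAbelianGroup
        ; *-cong = ⊗-cong
        ; *-assoc = λ a b c → ≗⇒≈ (⊗-assoc a b c)
        ; *-identity = (λ a → ≗⇒≈ (⊗-identityˡ a))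
                     , (λ a → ≗⇒≈ λ n → trans (⊗-comm a (κ 1ℤ) n) (⊗-identityˡ a n))
        ; distrib = ⊗-distribˡ , (λ a b c → ≗⇒≈ (⊗-distribʳ a b c))
        }
      ; *-comm = λ a b → ≗⇒≈ (⊗-comm a b)
      }
    }

  private
    coefficients : ℤ.+-*-rawRing -Raw-AlmostCommutative⟶ fromCommutativeRing seriesRing
    coefficients = record
      { ⟦_⟧ = κ
      ; +-homo = λ x y → ≗⇒≈ (κ-+ x y)
      ; *-homo = λ x y → ≗⇒≈ (κ-* x y)
      ; -‿homo = λ x → ≗⇒≈ (κ-neg x)
      ; 0-homo = ≗⇒≈ (λ _ → refl)
      ; 1-homo = ≗⇒≈ (λ _ → refl)
      }

    coeff≟ : WeaklyDecidable (λ x y → κ x ≈ κ y)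
    coeff≟ x y with x ℤ.≟ y
    ... | yes refl = just (≗⇒≈ (λ _ → refl))
    ... | no _ = nothing

  -- Constants `con z` stand for `κ z` and are compared as integers, not modulo `m`. Hence multiples
  -- of `m` must be collected in an explicit term and removed with `modulus`.
  module Solver = Algebra.Solver.Ring
    ℤ.+-*-rawRing (fromCommutativeRing seriesRing) coefficients coeff≟


  open Solver using (solve; _:+_; _:*_; :-_; _:=_; con) public
  open CommutativeRing seriesRing using (setoid) renaming (refl to ≈-refl; sym to ≈-sym; trans to ≈-trans; +-cong to ⊕-cong; -‿cong to ⊝-cong) public

-- Monomials and sums over antidiagonals

mono : ℕ → Series
mono zero = κ 1ℤ
mono (suc d) = shift (mono d)

shift-cong : ∀ {a b} → a ≗ b → shift a ≗ shift b
shift-cong p zero = refl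
shift-cong p (suc n) = p n

mono-+ : ∀ d e → mono (d ℕ.+ e) ≗ mono d ⊗ mono e
mono-+ zero e n = sym (⊗-identityˡ (mono e) n)
mono-+ (suc d) e n = trans (shift-cong (mono-+ d e) n) (sym (shift-⊗ (mono d) (mono e) n))

mono-⊗-suc : ∀ d a → mono (suc d) ⊗ a ≗ shift (mono d ⊗ a)
mono-⊗-suc d a = shift-⊗ (mono d) a

mono-⊗-< : ∀ d a n → n ℕ.< d → (mono d ⊗ a) n ≡ 0ℤ
mono-⊗-< (suc d) a zero _ = refl
mono-⊗-< (suc d) a (suc n) (s≤s n<d) = trans (mono-⊗-suc d a (suc n)) (mono-⊗-< d a n n<d)

mono-⊗-≥ : ∀ d a n → (mono d ⊗ a) (d ℕ.+ n) ≡ a n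
mono-⊗-≥ zero a n = ⊗-identityˡ a n
mono-⊗-≥ (suc d) a n = trans (mono-⊗-suc d a (suc (d ℕ.+ n))) (mono-⊗-≥ d a n)

-- Both indices of a term with h + j = M are passed on, which keeps truncated subtraction out of the
-- binomial sums and makes the symmetry between h and j visible.
antidiagonal : (ℕ → ℕ → Series) → ℕ → Series
antidiagonal f zero = f 0 0
antidiagonal f (suc M) = f 0 (suc M) ⊕ antidiagonal (λ h j → f (suc h) j) M

∏ : (ℕ → Series) → ℕ → Series
∏ f zero = κ 1ℤ
∏ f (suc n) = ∏ f n ⊗ f n

module Sums (m : ℕ) where
  open SeriesMod m
  open Relation.Binary.Reasoning.Setoid setoid

  ≈[]-refl : ∀ {a N} → a ≈[ N ] a
  ≈[]-refl = ≈⇒≈[] ≈-refl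

  ≈[]-sym : ∀ {a b N} → a ≈[ N ] b → b ≈[ N ] a
  ≈[]-sym p = coeffwise[] λ n n<N → mod-sym ((p at[] n) n<N)

  ≈[]-trans : ∀ {a b c N} → a ≈[ N ] b → b ≈[ N ] c → a ≈[ N ] c
  ≈[]-trans p q = coeffwise[] λ n n<N → mod-trans ((p at[] n) n<N) ((q at[] n) n<N)

  weaken[] : ∀ {a b M N} → M ℕ.≤ N → a ≈[ N ] b → a ≈[ M ] b
  weaken[] M≤N p = coeffwise[] λ n n<M → (p at[] n) (ℕ.≤-trans n<M M≤N)

  -- A factor q^d raises the precision by d. This gain compensates for the Gaussian binomials near
  -- the ends of the sum in `limit-term`.
  mono-⊗[] : ∀ {a b N} d → a ≈[ N ] b → mono d ⊗ a ≈[ d ℕ.+ N ] mono d ⊗ b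
  mono-⊗[] {a} {b} {N} d p = coeffwise[] go
    where
    go : ∀ n → n ℕ.< d ℕ.+ N → (mono d ⊗ a) n ≡ (mono d ⊗ b) n [mod m ]
    go n n<d+N with ℕ.<-≤-connex n d
    ... | inj₁ n<d = mod-reflexive (trans (mono-⊗-< d a n n<d) (sym (mono-⊗-< d b n n<d)))
    ... | inj₂ d≤n with ℕ.m≤n⇒∃[o]m+o≡n d≤n
    ... | k , refl = mod-trans (mod-reflexive (mono-⊗-≥ d a k))
                    (mod-trans ((p at[] k) (ℕ.+-cancelˡ-< d k N n<d+N))
                               (mod-reflexive (sym (mono-⊗-≥ d b k))))

  mono-⊗≈0[] : ∀ d a → mono d ⊗ a ≈[ d ] κ 0ℤ
  mono-⊗≈0[] d a = coeffwise[] λ n n<d → mod-reflexive (trans (mono-⊗-< d a n n<d) (sym (κ0 n)))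

  mono-≡ : ∀ {d e} → d ≡ e → mono d ≈ mono e
  mono-≡ refl = ≈-refl

  mono-⊗-mono : ∀ {a b c d} → a ℕ.+ b ≡ c ℕ.+ d → mono a ⊗ mono b ≈ mono c ⊗ mono d
  mono-⊗-mono {a} {b} {c} {d} eq = begin
    mono a ⊗ mono b ≈⟨ ≗⇒≈ (λ n → sym (mono-+ a b n)) ⟩
    mono (a ℕ.+ b)  ≈⟨ mono-≡ eq ⟩
    mono (c ℕ.+ d)  ≈⟨ ≗⇒≈ (mono-+ c d) ⟩
    mono c ⊗ mono d ∎

  antidiagonal-cong : ∀ M {f g} → (∀ h j → h ℕ.+ j ≡ M → f h j ≈ g h j) →
                      antidiagonal f M ≈ antidiagonal g M
  antidiagonal-cong zero p = p 0 0 refl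
  antidiagonal-cong (suc M) p =
    ⊕-cong (p 0 (suc M) refl) (antidiagonal-cong M λ h j eq → p (suc h) j (cong suc eq))

  antidiagonal-cong[] : ∀ M {N f g} → (∀ h j → h ℕ.+ j ≡ M → f h j ≈[ N ] g h j) →
                        antidiagonal f M ≈[ N ] antidiagonal g M
  antidiagonal-cong[] zero p = p 0 0 refl
  antidiagonal-cong[] (suc M) p =
    ⊕-cong[] (p 0 (suc M) refl) (antidiagonal-cong[] M λ h j eq → p (suc h) j (cong suc eq))

  antidiagonal-⊕ : ∀ M f g → antidiagonal (λ h j → f h j ⊕ g h j) M ≈ antidiagonal f M ⊕ antidiagonal g M
  antidiagonal-⊕ zero f g = ≈-refl
  antidiagonal-⊕ (suc M) f g = begin
    f 0 (suc M) ⊕ g 0 (suc M) ⊕ antidiagonal (λ h j → f (suc h) j ⊕ g (suc h) j) M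
      ≈⟨ ⊕-cong ≈-refl (antidiagonal-⊕ M (f ∘ suc) (g ∘ suc)) ⟩
    f 0 (suc M) ⊕ g 0 (suc M) ⊕ (antidiagonal (f ∘ suc) M ⊕ antidiagonal (g ∘ suc) M)
      ≈⟨ solve 4 (λ x y z t → x :+ y :+ (z :+ t) := x :+ z :+ (y :+ t)) ≈-refl _ _ _ _ ⟩
    antidiagonal f (suc M) ⊕ antidiagonal g (suc M) ∎

  ⊗-antidiagonal : ∀ M c f → c ⊗ antidiagonal f M ≈ antidiagonal (λ h j → c ⊗ f h j) M
  ⊗-antidiagonal zero c f = ≈-refl
  ⊗-antidiagonal (suc M) c f = begin
    c ⊗ (f 0 (suc M) ⊕ antidiagonal (f ∘ suc) M)
      ≈⟨ solve 3 (λ c x y → c :* (x :+ y) := c :* x :+ c :* y) ≈-refl _ _ _ ⟩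
    c ⊗ f 0 (suc M) ⊕ c ⊗ antidiagonal (f ∘ suc) M
      ≈⟨ ⊕-cong ≈-refl (⊗-antidiagonal M c (f ∘ suc)) ⟩
    antidiagonal (λ h j → c ⊗ f h j) (suc M) ∎

  antidiagonal-last : ∀ M f → antidiagonal f (suc M) ≈ antidiagonal (λ h j → f h (suc j)) M ⊕ f (suc M) 0
  antidiagonal-last zero f = ≈-refl
  antidiagonal-last (suc M) f = begin
    f 0 (suc (suc M)) ⊕ antidiagonal (f ∘ suc) (suc M)
      ≈⟨ ⊕-cong ≈-refl (antidiagonal-last M (f ∘ suc)) ⟩
    f 0 (suc (suc M)) ⊕ (antidiagonal (λ h j → f (suc h) (suc j)) M ⊕ f (suc (suc M)) 0)
      ≈⟨ solve 3 (λ x y z → x :+ (y :+ z) := x :+ y :+ z) ≈-refl _ _ _ ⟩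
    antidiagonal (λ h j → f h (suc j)) (suc M) ⊕ f (suc (suc M)) 0 ∎

  antidiagonal-flip : ∀ M f → antidiagonal f M ≈ antidiagonal (flip f) M
  antidiagonal-flip zero f = ≈-refl
  antidiagonal-flip (suc M) f = begin
    f 0 (suc M) ⊕ antidiagonal (f ∘ suc) M
      ≈⟨ ⊕-cong ≈-refl (antidiagonal-flip M (f ∘ suc)) ⟩
    f 0 (suc M) ⊕ antidiagonal (λ h j → f (suc j) h) M
      ≈⟨ solve 2 (λ x y → x :+ y := y :+ x) ≈-refl _ _ ⟩
    antidiagonal (λ h j → f (suc j) h) M ⊕ f 0 (suc M)
      ≈⟨ antidiagonal-last M (flip f) ⟨
    antidiagonal (flip f) (suc M) ∎

-- Gaussian binomial coefficients

-- Q = q^(1+v)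
module Gaussian (m v : ℕ) where
  open SeriesMod m
  open Sums m
  open Relation.Binary.Reasoning.Setoid setoid

  w : ℕ
  w = suc v

  Q^ : ℕ → Series
  Q^ h = mono (w ℕ.* h)

  -- the Gaussian binomial coefficient of h + j over h
  gauss : ℕ → ℕ → Series
  gauss zero j = κ 1ℤ
  gauss (suc h) zero = κ 1ℤ
  gauss (suc h) (suc j) = gauss h (suc j) ⊕ Q^ (suc h) ⊗ gauss (suc h) j

  Q^-exchange : ∀ {a b c d} → a ℕ.+ b ≡ c ℕ.+ d → Q^ a ⊗ Q^ b ≈ Q^ c ⊗ Q^ d
  Q^-exchange {a} {b} {c} {d} eq = mono-⊗-mono {w ℕ.* a} {w ℕ.* b} {w ℕ.* c} {w ℕ.* d}
    (trans (sym (ℕ.*-distribˡ-+ w a b)) (trans (cong (w ℕ.*_) eq) (ℕ.*-distribˡ-+ w c d)))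

  -- The second q-Pascal rule. Expanding both terms by the induction hypothesis, the two rules agree
  -- because Q^(h+2) Q^(j+1) = Q^(j+2) Q^(h+1). The symmetry of the Gaussian binomials rests on
  -- having both rules.
  gauss-pascal : ∀ h j → gauss (suc h) (suc j) ≈ gauss (suc h) j ⊕ Q^ (suc j) ⊗ gauss h (suc j)
  gauss-pascal zero zero = ≈-refl
  gauss-pascal zero (suc j) = begin
    κ 1ℤ ⊕ Q^ 1 ⊗ gauss 1 (suc j)
      ≈⟨ ⊕-cong ≈-refl (⊗-cong (≈-refl {Q^ 1}) (gauss-pascal 0 j)) ⟩
    κ 1ℤ ⊕ Q^ 1 ⊗ (gauss 1 j ⊕ Q^ (suc j) ⊗ κ 1ℤ)
      ≈⟨ solve 3 (λ q g r → con 1ℤ :+ q :* (g :+ r :* con 1ℤ) := con 1ℤ :+ q :* g :+ q :* r)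
           ≈-refl (Q^ 1) (gauss 1 j) (Q^ (suc j)) ⟩
    gauss 1 (suc j) ⊕ Q^ 1 ⊗ Q^ (suc j)
      ≈⟨ ⊕-cong ≈-refl (Q^-exchange {1} {suc j} {suc (suc j)} {0} (sym (ℕ.+-identityʳ _))) ⟩
    gauss 1 (suc j) ⊕ Q^ (suc (suc j)) ⊗ Q^ 0
      ≈⟨ ⊕-cong ≈-refl (⊗-cong (≈-refl {Q^ (suc (suc j))}) (mono-≡ (ℕ.*-zeroʳ w))) ⟩
    gauss 1 (suc j) ⊕ Q^ (suc (suc j)) ⊗ κ 1ℤ ∎
  gauss-pascal (suc h) zero = begin
    gauss (suc h) 1 ⊕ Q^ (suc (suc h)) ⊗ κ 1ℤ
      ≈⟨ ⊕-cong (gauss-pascal h 0) (⊗-cong (≈-refl {Q^ (suc (suc h))}) (mono-≡ (sym (ℕ.*-zeroʳ w)))) ⟩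
    gauss (suc h) 0 ⊕ Q^ 1 ⊗ gauss h 1 ⊕ Q^ (suc (suc h)) ⊗ Q^ 0
      ≈⟨ ⊕-cong ≈-refl (Q^-exchange {suc (suc h)} {0} {1} {suc h} (ℕ.+-identityʳ _)) ⟩
    κ 1ℤ ⊕ Q^ 1 ⊗ gauss h 1 ⊕ Q^ 1 ⊗ Q^ (suc h)
      ≈⟨ solve 3 (λ q g r → con 1ℤ :+ q :* g :+ q :* r := con 1ℤ :+ q :* (g :+ r :* con 1ℤ))
           ≈-refl (Q^ 1) (gauss h 1) (Q^ (suc h)) ⟩
    κ 1ℤ ⊕ Q^ 1 ⊗ gauss (suc h) 1 ∎
  gauss-pascal (suc h) (suc j) = begin
    gauss H (suc J) ⊕ Q^ (suc H) ⊗ gauss (suc H) J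
      ≈⟨ ⊕-cong (gauss-pascal h (suc j)) (⊗-cong (≈-refl {Q^ (suc H)}) (gauss-pascal (suc h) j)) ⟩
    gauss H J ⊕ Q^ (suc J) ⊗ gauss h (suc J) ⊕ Q^ (suc H) ⊗ (gauss (suc H) j ⊕ Q^ J ⊗ gauss H J)
      ≈⟨ solve 6 (λ g x y p q r → g :+ p :* x :+ q :* (y :+ r :* g) := g :+ p :* x :+ q :* y :+ q :* r :* g)
           ≈-refl (gauss H J) (gauss h (suc J)) (gauss (suc H) j) (Q^ (suc J)) (Q^ (suc H)) (Q^ J) ⟩
    gauss H J ⊕ Q^ (suc J) ⊗ gauss h (suc J) ⊕ Q^ (suc H) ⊗ gauss (suc H) j ⊕ Q^ (suc H) ⊗ Q^ J ⊗ gauss H J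
      ≈⟨ ⊕-cong ≈-refl (⊗-cong (Q^-exchange {suc H} {J} {suc J} {H} (cong suc (ℕ.+-comm H J))) ≈-refl) ⟩
    gauss H J ⊕ Q^ (suc J) ⊗ gauss h (suc J) ⊕ Q^ (suc H) ⊗ gauss (suc H) j ⊕ Q^ (suc J) ⊗ Q^ H ⊗ gauss H J
      ≈⟨ solve 6 (λ g x y p q r → g :+ p :* x :+ q :* y :+ p :* r :* g := g :+ q :* y :+ p :* (x :+ r :* g))
           ≈-refl (gauss H J) (gauss h (suc J)) (gauss (suc H) j) (Q^ (suc J)) (Q^ (suc H)) (Q^ H) ⟩
    gauss (suc H) J ⊕ Q^ (suc J) ⊗ gauss H (suc J) ∎
    where
    H J : ℕ
    H = suc h
    J = suc j

  gauss-zero : ∀ h → gauss h 0 ≈ κ 1ℤ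
  gauss-zero zero = ≈-refl
  gauss-zero (suc h) = ≈-refl

  gauss-sym : ∀ h j → gauss h j ≈ gauss j h
  gauss-sym zero j = ≈-sym (gauss-zero j)
  gauss-sym (suc h) zero = ≈-refl
  gauss-sym (suc h) (suc j) = begin
    gauss h (suc j) ⊕ Q^ (suc h) ⊗ gauss (suc h) j
      ≈⟨ ⊕-cong (gauss-sym h (suc j)) (⊗-cong (≈-refl {Q^ (suc h)}) (gauss-sym (suc h) j)) ⟩
    gauss (suc j) h ⊕ Q^ (suc h) ⊗ gauss j (suc h)
      ≈⟨ gauss-pascal j h ⟨
    gauss (suc j) (suc h) ∎

  gaussSum : (ℕ → ℕ → Series) → ℕ → Series
  gaussSum W = antidiagonal (λ h j → gauss h j ⊗ W h j)

  private
    -- The two terms of `gauss-pascal`, extended by zero to the boundary, so that one decomposition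
    -- is valid on the whole antidiagonal.
    lowerʳ lowerˡ : ℕ → ℕ → Series
    lowerʳ h zero = κ 0ℤ
    lowerʳ h (suc j) = gauss h j
    lowerˡ zero j = κ 0ℤ
    lowerˡ (suc h) j = Q^ j ⊗ gauss h j

    split : ∀ M h j → h ℕ.+ j ≡ suc M → gauss h j ≈ lowerʳ h j ⊕ lowerˡ h j
    split M zero (suc j) _ = solve 0 (con 1ℤ := con 1ℤ :+ con 0ℤ) ≈-refl
    split M (suc h) zero _ = begin
      κ 1ℤ                    ≈⟨ solve 0 (con 1ℤ := con 0ℤ :+ con 1ℤ :* con 1ℤ) ≈-refl ⟩
      κ 0ℤ ⊕ κ 1ℤ ⊗ κ 1ℤ      ≈⟨ ⊕-cong ≈-refl (⊗-cong (mono-≡ (sym (ℕ.*-zeroʳ w))) (≈-sym (gauss-zero h))) ⟩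
      κ 0ℤ ⊕ Q^ 0 ⊗ gauss h 0 ∎
    split M (suc h) (suc j) _ = gauss-pascal h j

  -- One induction step of the finite q-binomial theorem with abstract weights. The Pascal rule
  -- splits the larger sum in two: `same` identifies one part with the old sum, and `multiply`
  -- identifies the other with c times the old sum.
  gaussSum-stepˡ : ∀ M c {W W′} →
    (∀ h j → h ℕ.+ j ≡ M → W′ h (suc j) ≈ W h j) →
    (∀ h j → h ℕ.+ j ≡ M → W h j ⊗ c ≈ W′ (suc h) j ⊗ Q^ j) →
    gaussSum W M ⊗ (κ 1ℤ ⊕ c) ≈ gaussSum W′ (suc M)
  gaussSum-stepˡ M c {W} {W′} same multiply = ≈-sym (begin
    gaussSum W′ (suc M)
      ≈⟨ antidiagonal-cong (suc M) (λ h j eq → ≈-trans (⊗-cong (split M h j eq) ≈-refl)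
           (solve 3 (λ x y z → (x :+ y) :* z := x :* z :+ y :* z) ≈-refl (lowerʳ h j) (lowerˡ h j) (W′ h j))) ⟩
    antidiagonal (λ h j → lowerʳ h j ⊗ W′ h j ⊕ lowerˡ h j ⊗ W′ h j) (suc M)
      ≈⟨ antidiagonal-⊕ (suc M) (λ h j → lowerʳ h j ⊗ W′ h j) (λ h j → lowerˡ h j ⊗ W′ h j) ⟩
    antidiagonal (λ h j → lowerʳ h j ⊗ W′ h j) (suc M) ⊕ antidiagonal (λ h j → lowerˡ h j ⊗ W′ h j) (suc M)
      ≈⟨ ⊕-cong (antidiagonal-last M (λ h j → lowerʳ h j ⊗ W′ h j)) ≈-refl ⟩
    antidiagonal (λ h j → gauss h j ⊗ W′ h (suc j)) M ⊕ κ 0ℤ ⊗ W′ (suc M) 0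
      ⊕ (κ 0ℤ ⊗ W′ 0 (suc M) ⊕ antidiagonal (λ h j → Q^ j ⊗ gauss h j ⊗ W′ (suc h) j) M)
      ≈⟨ solve 4 (λ x y z t → x :+ con 0ℤ :* y :+ (con 0ℤ :* z :+ t) := x :+ t) ≈-refl
           (antidiagonal (λ h j → gauss h j ⊗ W′ h (suc j)) M) (W′ (suc M) 0) (W′ 0 (suc M))
           (antidiagonal (λ h j → Q^ j ⊗ gauss h j ⊗ W′ (suc h) j) M) ⟩
    antidiagonal (λ h j → gauss h j ⊗ W′ h (suc j)) M ⊕ antidiagonal (λ h j → Q^ j ⊗ gauss h j ⊗ W′ (suc h) j) M
      ≈⟨ ⊕-cong (antidiagonal-cong M (λ h j eq → ⊗-cong (≈-refl {gauss h j}) (same h j eq)))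
                (antidiagonal-cong M (λ h j eq → begin
                  Q^ j ⊗ gauss h j ⊗ W′ (suc h) j
                    ≈⟨ solve 3 (λ x y z → x :* y :* z := y :* (z :* x)) ≈-refl (Q^ j) (gauss h j) (W′ (suc h) j) ⟩
                  gauss h j ⊗ (W′ (suc h) j ⊗ Q^ j)
                    ≈⟨ ⊗-cong (≈-refl {gauss h j}) (≈-sym (multiply h j eq)) ⟩
                  gauss h j ⊗ (W h j ⊗ c)
                    ≈⟨ solve 3 (λ x y z → x :* (y :* z) := z :* (x :* y)) ≈-refl (gauss h j) (W h j) c ⟩
                  c ⊗ (gauss h j ⊗ W h j) ∎)) ⟩
    gaussSum W M ⊕ antidiagonal (λ h j → c ⊗ (gauss h j ⊗ W h j)) M
      ≈⟨ ⊕-cong ≈-refl (≈-sym (⊗-antidiagonal M c (λ h j → gauss h j ⊗ W h j))) ⟩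
    gaussSum W M ⊕ c ⊗ gaussSum W M
      ≈⟨ solve 2 (λ s c → s :+ c :* s := s :* (con 1ℤ :+ c)) ≈-refl (gaussSum W M) c ⟩
    gaussSum W M ⊗ (κ 1ℤ ⊕ c) ∎)

  gaussSum-flip : ∀ M W → gaussSum W M ≈ gaussSum (flip W) M
  gaussSum-flip M W = begin
    gaussSum W M ≈⟨ antidiagonal-flip M _ ⟩
    antidiagonal (λ h j → gauss j h ⊗ W j h) M
      ≈⟨ antidiagonal-cong M (λ h j _ → ⊗-cong (gauss-sym j h) (≈-refl {W j h})) ⟩
    gaussSum (flip W) M ∎

  gaussSum-stepʳ : ∀ M c {W W′} →
    (∀ h j → h ℕ.+ j ≡ M → W′ (suc h) j ≈ W h j) →
    (∀ h j → h ℕ.+ j ≡ M → W h j ⊗ c ≈ W′ h (suc j) ⊗ Q^ h) →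
    gaussSum W M ⊗ (κ 1ℤ ⊕ c) ≈ gaussSum W′ (suc M)
  gaussSum-stepʳ M c {W} {W′} same multiply = begin
    gaussSum W M ⊗ (κ 1ℤ ⊕ c)
      ≈⟨ ⊗-cong (gaussSum-flip M W) ≈-refl ⟩
    gaussSum (flip W) M ⊗ (κ 1ℤ ⊕ c)
      ≈⟨ gaussSum-stepˡ M c {flip W} {flip W′} (λ h j eq → same j h (trans (ℕ.+-comm j h) eq))
                            (λ h j eq → multiply j h (trans (ℕ.+-comm j h) eq)) ⟩
    gaussSum (flip W′) (suc M)
      ≈⟨ gaussSum-flip (suc M) W′ ⟨
    gaussSum W′ (suc M) ∎

  eulerFactor : ℕ → Series
  eulerFactor i = κ 1ℤ ⊕ ⊝ Q^ (suc i)

  n≤Q : ∀ n → n ℕ.≤ w ℕ.* n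
  n≤Q n = ℕ.m≤m+n n (v ℕ.* n)

  Q^⊗≈0[] : ∀ n a → Q^ n ⊗ a ≈[ n ] κ 0ℤ
  Q^⊗≈0[] n a = weaken[] (n≤Q n) (mono-⊗≈0[] (w ℕ.* n) a)

  drop[] : ∀ {N a z} → z ≈[ N ] κ 0ℤ → a ⊕ z ≈[ N ] a
  drop[] {a = a} z≈0 = ≈[]-trans (⊕-cong[] ≈[]-refl z≈0)
    (≈⇒≈[] (solve 1 (λ a → a :+ con 0ℤ := a) ≈-refl a))

  -- Consecutive Gaussian binomials differ by a multiple of Q^(j+1). In the recursion the second
  -- Pascal term has one order of precision less, which its factor Q^(h+1) restores.
  gauss-stableʳ : ∀ h j → gauss h (suc j) ≈[ suc j ] gauss h j
  gauss-stableʳ zero j = ≈[]-refl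
  gauss-stableʳ (suc h) zero =
    ≈[]-trans (drop[] (weaken[] (s≤s z≤n) (Q^⊗≈0[] (suc h) (κ 1ℤ))))
    (≈[]-trans (gauss-stableʳ h 0) (≈⇒≈[] (gauss-zero h)))
  gauss-stableʳ (suc h) (suc j) =
    ⊕-cong[] (gauss-stableʳ h (suc j))
             (weaken[] (ℕ.+-monoˡ-≤ (suc j) {1} (s≤s z≤n)) (mono-⊗[] (w ℕ.* suc h) (gauss-stableʳ (suc h) j)))

  -- Exactly, the product is that of 1 - Q^i over j < i ≤ j + h. The induction avoids this formula:
  -- once `gauss (suc h) (suc j)` is replaced by `gauss (suc h) j` behind Q^(h+1), the new Euler
  -- factor cancels one Pascal term.
  euler-gauss : ∀ h j → ∏ eulerFactor h ⊗ gauss h j ≈[ j ] κ 1ℤ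
  euler-gauss zero j = ≈⇒≈[] (solve 0 (con 1ℤ :* con 1ℤ := con 1ℤ) ≈-refl)
  euler-gauss (suc h) zero = coeffwise[] λ n ()
  euler-gauss (suc h) (suc j) =
    ≈[]-trans (≈⇒≈[] (solve 3 (λ e q g → e :* (con 1ℤ :+ :- q) :* g := e :* (g :+ :- (q :* g))) ≈-refl
                 (∏ eulerFactor h) (Q^ (suc h)) (gauss (suc h) (suc j))))
    (≈[]-trans (⊗-cong[] ≈[]-refl
       (≈[]-trans (⊕-cong[] ≈[]-refl (⊝-cong[] (⊗-cong[] ≈[]-refl (gauss-stableʳ (suc h) j))))
         (≈⇒≈[] (solve 3 (λ e q g → e :+ q :* g :+ :- (q :* g) := e) ≈-refl
            (gauss h (suc j)) (Q^ (suc h)) (gauss (suc h) j)))))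
      (euler-gauss h (suc j)))

  gauss-stableˡ : ∀ L d j → gauss (d ℕ.+ L) j ≈[ L ] gauss L j
  gauss-stableˡ L zero j = ≈[]-refl
  gauss-stableˡ L (suc d) zero = ≈⇒≈[] (≈-sym (gauss-zero L))
  gauss-stableˡ L (suc d) (suc j) =
    ≈[]-trans (drop[] (weaken[] (ℕ.m≤n+m L (suc d)) (Q^⊗≈0[] (suc d ℕ.+ L) _))) (gauss-stableˡ L d (suc j))

  euler-stable : ∀ L d → ∏ eulerFactor (d ℕ.+ L) ≈[ L ] ∏ eulerFactor L
  euler-stable L zero = ≈[]-refl
  euler-stable L (suc d) =
    ≈[]-trans (≈⇒≈[] (solve 2 (λ e q → e :* (con 1ℤ :+ :- q) := e :+ q :* (:- e)) ≈-refl
                 (∏ eulerFactor (d ℕ.+ L)) (Q^ (suc d ℕ.+ L))))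
    (≈[]-trans (drop[] (weaken[] (ℕ.m≤n+m L (suc d)) (Q^⊗≈0[] (suc d ℕ.+ L) _))) (euler-stable L d))

  euler-gauss-≤ : ∀ {L K h j} → L ℕ.≤ K → L ℕ.≤ h → L ℕ.≤ j → ∏ eulerFactor K ⊗ gauss h j ≈[ L ] κ 1ℤ
  euler-gauss-≤ {L} {K} {h} {j} L≤K L≤h L≤j =
    ≈[]-trans (⊗-cong[] (subst (λ K → ∏ eulerFactor K ≈[ L ] ∏ eulerFactor L) (ℕ.m∸n+n≡m L≤K) (euler-stable L (K ℕ.∸ L)))
                        (subst (λ h → gauss h j ≈[ L ] gauss L j) (ℕ.m∸n+n≡m L≤h) (gauss-stableˡ L (h ℕ.∸ L) j)))
    (weaken[] L≤j (euler-gauss L j))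

-- Combinatorial classes and their generating functions

unique-length : ∀ {xs ys : List X} → Unique xs → Unique ys →
                (∀ {z} → z ∈ xs → z ∈ ys) → (∀ {z} → z ∈ ys → z ∈ xs) → length xs ≡ length ys
unique-length xs! ys! ⊆ ⊇ = ↭-length (∼bag⇒↭ (unique∧set⇒bag xs! ys! (mk⇔ ⊆ ⊇)))

-- Sizes are integers, although never negative, so that identities between quadratic sizes can be left to
-- the ring solver.
record Class (X : Set) : Set where
  field
    size : X → ℤ
    nonneg : ∀ x → ∃ λ n → size x ≡ + n
    fibre : ℕ → List X
    unique : ∀ n → Unique (fibre n)
    sound : ∀ {n x} → x ∈ fibre n → size x ≡ + n
    complete : ∀ {n x} → size x ≡ + n → x ∈ fibre n

open Class public

gf : Class X → Series
gf C n = + length (fibre C n)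

gf-↔ : (C : Class X) (D : Class Y) (f : X ↔ Y) → (∀ x → size D (Inverse.to f x) ≡ size C x) → gf C ≗ gf D
gf-↔ C D f same n = cong +_ (trans (sym (length-map to (fibre C n)))
  (unique-length (Unique.map⁺ injective (unique C n)) (unique D n)
    (λ z∈ → case-map (∈-map⁻ to z∈))
    (λ {z} z∈ → subst (_∈ map to (fibre C n)) (strictlyInverseˡ z)
      (∈-map⁺ to (complete C (trans (sym (same (from z))) (trans (cong (size D) (strictlyInverseˡ z)) (sound D z∈))))))))
  where
  open Inverse f
  injective : ∀ {x y} → to x ≡ to y → x ≡ y
  injective {x} {y} eq = trans (sym (strictlyInverseʳ x)) (trans (cong from eq) (strictlyInverseʳ y))
  case-map : ∀ {z} → (∃ λ x → x ∈ fibre C n × z ≡ to x) → z ∈ fibre D n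
  case-map (x , x∈ , refl) = complete D (trans (same x) (sound C x∈))

-- For identities whose two sides parametrise the same lattice: the size is stated once on the
-- lattice, and the inverse of the composite need not be written out. `span` is the dual form, with
-- one set parametrising both sides.
cospan : {Z : Set} (C : Class X) (D : Class Y) (f : X ↔ Z) (g : Y ↔ Z) (s : Z → ℤ) →
         (∀ x → s (Inverse.to f x) ≡ size C x) → (∀ y → s (Inverse.to g y) ≡ size D y) → gf C ≗ gf D
cospan C D f g s f-size g-size = gf-↔ C D (↔-trans f (↔-sym g)) λ x →
  trans (sym (g-size (from (Inverse.to f x)))) (trans (cong s (strictlyInverseˡ (Inverse.to f x))) (f-size x))
  where open Inverse g

span : {Z : Set} (C : Class X) (D : Class Y) (f : Z ↔ X) (g : Z ↔ Y) →
       (∀ z → size D (Inverse.to g z) ≡ size C (Inverse.to f z)) → gf C ≗ gf D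
span C D f g same = gf-↔ C D (↔-trans (↔-sym f) g) λ x →
  trans (same (from x)) (cong (size C) (strictlyInverseˡ x))
  where open Inverse f

infixr 5 _⊎ᶜ_
infixr 6 _×ᶜ_

_⊎ᶜ_ : Class X → Class Y → Class (X ⊎ Y)
(C ⊎ᶜ D) .size = [ size C , size D ]
(C ⊎ᶜ D) .nonneg (inj₁ x) = nonneg C x
(C ⊎ᶜ D) .nonneg (inj₂ y) = nonneg D y
(C ⊎ᶜ D) .fibre n = map inj₁ (fibre C n) ++ map inj₂ (fibre D n)
(C ⊎ᶜ D) .unique n = Unique.++⁺ (Unique.map⁺ Sum.inj₁-injective (unique C n))
                                (Unique.map⁺ Sum.inj₂-injective (unique D n)) disjoint
  where
  disjoint : Disjoint (map inj₁ (fibre C n)) (map inj₂ (fibre D n))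
  disjoint (p , q) with ∈-map⁻ inj₁ p | ∈-map⁻ inj₂ q
  ... | _ , _ , refl | _ , _ , ()
(C ⊎ᶜ D) .sound {n} p with ∈-++⁻ (map inj₁ (fibre C n)) p
... | inj₁ q with _ , x∈ , refl ← ∈-map⁻ inj₁ q = sound C x∈
... | inj₂ q with _ , y∈ , refl ← ∈-map⁻ inj₂ q = sound D y∈
(C ⊎ᶜ D) .complete {n} {inj₁ x} eq = ∈-++⁺ˡ (∈-map⁺ inj₁ (complete C eq))
(C ⊎ᶜ D) .complete {n} {inj₂ y} eq = ∈-++⁺ʳ (map inj₁ (fibre C n)) (∈-map⁺ inj₂ (complete D eq))

gf-⊎ : (C : Class X) (D : Class Y) → ∀ n → gf (C ⊎ᶜ D) n ≡ gf C n ℤ.+ gf D n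
gf-⊎ C D n = cong +_ (trans (length-++ (map inj₁ (fibre C n)))
  (cong₂ ℕ._+_ (length-map inj₁ (fibre C n)) (length-map inj₂ (fibre D n))))

convolve : (ℕ → List X) → (ℕ → List Y) → ℕ → List (X × Y)
convolve A B zero = cartesianProduct (A 0) (B 0)
convolve A B (suc n) = cartesianProduct (A 0) (B (suc n)) ++ convolve (tail A) B n

∈-convolve⁻ : ∀ (A : ℕ → List X) (B : ℕ → List Y) n {x y} → (x , y) ∈ convolve A B n →
              ∃₂ λ i j → i ℕ.+ j ≡ n × x ∈ A i × y ∈ B j
∈-convolve⁻ A B zero p = 0 , 0 , refl , ∈-cartesianProduct⁻ (A 0) (B 0) p
∈-convolve⁻ A B (suc n) p with ∈-++⁻ (cartesianProduct (A 0) (B (suc n))) p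
... | inj₁ q = 0 , suc n , refl , ∈-cartesianProduct⁻ (A 0) (B (suc n)) q
... | inj₂ q with i , j , refl , r ← ∈-convolve⁻ (tail A) B n q = suc i , j , refl , r

∈-convolve⁺ : ∀ (A : ℕ → List X) (B : ℕ → List Y) i j {x y} → x ∈ A i → y ∈ B j →
              (x , y) ∈ convolve A B (i ℕ.+ j)
∈-convolve⁺ A B zero zero p q = ∈-cartesianProduct⁺ p q
∈-convolve⁺ A B zero (suc j) p q = ∈-++⁺ˡ (∈-cartesianProduct⁺ p q)
∈-convolve⁺ A B (suc i) j p q =
  ∈-++⁺ʳ (cartesianProduct (A 0) (B (suc (i ℕ.+ j)))) (∈-convolve⁺ (tail A) B i j p q)

convolve-unique : ∀ (A : ℕ → List X) (B : ℕ → List Y) n → (∀ i → Unique (A i)) → (∀ j → Unique (B j)) →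
                  (∀ {x} i j → x ∈ A i → x ∈ A j → i ≡ j) → Unique (convolve A B n)
convolve-unique A B zero A! B! disjoint = Unique.cartesianProduct⁺ (A! 0) (B! 0)
convolve-unique A B (suc n) A! B! disjoint =
  Unique.++⁺ (Unique.cartesianProduct⁺ (A! 0) (B! (suc n)))
    (convolve-unique (tail A) B n (A! ∘ suc) B!
      (λ i j p q → ℕ.suc-injective (disjoint (suc i) (suc j) p q)))
    apart
  where
  apart : Disjoint (cartesianProduct (A 0) (B (suc n))) (convolve (tail A) B n)
  apart (p , q) with ∈-convolve⁻ (tail A) B n q
  ... | i , _ , _ , x∈ , _ with disjoint 0 (suc i) (proj₁ (∈-cartesianProduct⁻ (A 0) (B (suc n)) p)) x∈
  ... | ()

length-cartesianProduct : ∀ (xs : List X) (ys : List Y) → length (cartesianProduct xs ys) ≡ length xs ℕ.* length ys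
length-cartesianProduct [] ys = refl
length-cartesianProduct (x ∷ xs) ys = trans (length-++ (map (x ,_) ys))
  (cong₂ ℕ._+_ (length-map (x ,_) ys) (length-cartesianProduct xs ys))

length-convolve : ∀ (A : ℕ → List X) (B : ℕ → List Y) n →
                  + length (convolve A B n) ≡ ((λ i → + length (A i)) ⊗ (λ j → + length (B j))) n
length-convolve A B zero = trans (cong +_ (length-cartesianProduct (A 0) (B 0))) (ℤ.pos-* (length (A 0)) (length (B 0)))
length-convolve A B (suc n) = trans (cong +_ (length-++ (cartesianProduct (A 0) (B (suc n)))))
  (cong₂ ℤ._+_ (trans (cong +_ (length-cartesianProduct (A 0) (B (suc n)))) (ℤ.pos-* (length (A 0)) (length (B (suc n)))))
               (length-convolve (tail A) B n))

_×ᶜ_ : Class X → Class Y → Class (X × Y)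
(C ×ᶜ D) .size (x , y) = size C x ℤ.+ size D y
(C ×ᶜ D) .nonneg (x , y) with i , p ← nonneg C x | j , q ← nonneg D y = i ℕ.+ j , cong₂ ℤ._+_ p q
(C ×ᶜ D) .fibre = convolve (fibre C) (fibre D)
(C ×ᶜ D) .unique n = convolve-unique (fibre C) (fibre D) n (unique C) (unique D)
  (λ i j p q → ℤ.+-injective (trans (sym (sound C p)) (sound C q)))
(C ×ᶜ D) .sound {n} p with i , j , refl , x∈ , y∈ ← ∈-convolve⁻ (fibre C) (fibre D) n p =
  cong₂ ℤ._+_ (sound C x∈) (sound D y∈)
(C ×ᶜ D) .complete {n} {x , y} eq with i , p ← nonneg C x | j , q ← nonneg D y
  with refl ← ℤ.+-injective (trans (sym (cong₂ ℤ._+_ p q)) eq) =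
  ∈-convolve⁺ (fibre C) (fibre D) i j (complete C p) (complete D q)

gf-× : (C : Class X) (D : Class Y) → gf (C ×ᶜ D) ≗ gf C ⊗ gf D
gf-× C D = length-convolve (fibre C) (fibre D)

shiftᶜ : Class X → Class X
shiftᶜ C .size x = 1ℤ ℤ.+ size C x
shiftᶜ C .nonneg x with n , eq ← nonneg C x = suc n , cong (ℤ._+_ 1ℤ) eq
shiftᶜ C .fibre zero = []
shiftᶜ C .fibre (suc n) = fibre C n
shiftᶜ C .unique zero = []
shiftᶜ C .unique (suc n) = unique C n
shiftᶜ C .sound {zero} ()
shiftᶜ C .sound {suc n} p = cong (ℤ._+_ 1ℤ) (sound C p)
shiftᶜ C .complete {n} {x} eq with k , p ← nonneg C x
  with refl ← ℤ.+-injective (trans (cong (ℤ._+_ 1ℤ) (sym p)) eq) = complete C p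

gf-shift : (C : Class X) → gf (shiftᶜ C) ≗ shift (gf C)
gf-shift C zero = refl
gf-shift C (suc n) = refl

-- Generic in the values, so that the same spreading over multiples of 3 serves series, with 0 in
-- the gaps, and fibres, with the empty list.
triple : ∀ {A : Set} → A → (ℕ → A) → ℕ → A
triple z a zero = a 0
triple z a (suc zero) = z
triple z a (suc (suc zero)) = z
triple z a (suc (suc (suc n))) = triple z (tail a) n

triple-3* : ∀ {A : Set} (z : A) a n → triple z a (3 ℕ.* n) ≡ a n
triple-3* z a zero = refl
triple-3* z a (suc n) = trans (cong (triple z a) (ℕ.*-suc 3 n)) (triple-3* z (tail a) n)

-- a(q³)
cubed : Series → Series
cubed = triple 0ℤ

∈-triple : ∀ (A : ℕ → List X) n {x} → x ∈ triple [] A n → ∃ λ k → n ≡ 3 ℕ.* k × x ∈ A k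
∈-triple A zero p = 0 , refl , p
∈-triple A (suc zero) ()
∈-triple A (suc (suc zero)) ()
∈-triple A (suc (suc (suc n))) p with k , refl , q ← ∈-triple (tail A) n p = suc k , sym (ℕ.*-suc 3 k) , q

triple-unique : ∀ (A : ℕ → List X) n → (∀ k → Unique (A k)) → Unique (triple [] A n)
triple-unique A zero A! = A! 0
triple-unique A (suc zero) A! = []
triple-unique A (suc (suc zero)) A! = []
triple-unique A (suc (suc (suc n))) A! = triple-unique (tail A) n (A! ∘ suc)

cubedᶜ : Class X → Class X
cubedᶜ C .size x = + 3 ℤ.* size C x
cubedᶜ C .nonneg x with n , eq ← nonneg C x = 3 ℕ.* n , trans (cong (ℤ._*_ (+ 3)) eq) (sym (ℤ.pos-* 3 n))
cubedᶜ C .fibre = triple [] (fibre C)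
cubedᶜ C .unique n = triple-unique (fibre C) n (unique C)
cubedᶜ C .sound {n} p with k , refl , q ← ∈-triple (fibre C) n p =
  trans (cong (ℤ._*_ (+ 3)) (sound C q)) (sym (ℤ.pos-* 3 k))
cubedᶜ C .complete {n} {x} eq with k , p ← nonneg C x
  with refl ← ℤ.+-injective (trans (ℤ.pos-* 3 k) (trans (cong (ℤ._*_ (+ 3)) (sym p)) eq)) =
  subst (x ∈_) (sym (triple-3* [] (fibre C) k)) (complete C p)

triple-length : ∀ (A : ℕ → List X) → (λ n → + length (triple [] A n)) ≗ cubed (λ n → + length (A n))
triple-length A zero = refl
triple-length A (suc zero) = refl
triple-length A (suc (suc zero)) = refl
triple-length A (suc (suc (suc n))) = triple-length (tail A) n

gf-cubed : (C : Class X) → gf (cubedᶜ C) ≗ cubed (gf C)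
gf-cubed C = triple-length (fibre C)

pullback : Class Y → X ↔ Y → Class X
pullback C f .size = size C ∘ Inverse.to f
pullback C f .nonneg = nonneg C ∘ Inverse.to f
pullback C f .fibre = map (Inverse.from f) ∘ fibre C
pullback C f .unique n = Unique.map⁺
  (λ {x} {y} eq → trans (sym (Inverse.strictlyInverseˡ f x))
    (trans (cong (Inverse.to f) eq) (Inverse.strictlyInverseˡ f y))) (unique C n)
pullback C f .sound {n} p with y , y∈ , refl ← ∈-map⁻ (Inverse.from f) p =
  trans (cong (size C) (Inverse.strictlyInverseˡ f y)) (sound C y∈)
pullback C f .complete {n} {x} eq =
  subst (_∈ map (Inverse.from f) (fibre C n)) (Inverse.strictlyInverseʳ f x) (∈-map⁺ (Inverse.from f) (complete C eq))

gf-pullback : (C : Class Y) (f : X ↔ Y) → gf C ≗ gf (pullback C f)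
gf-pullback C f n = cong +_ (sym (length-map (Inverse.from f) (fibre C n)))

lefts : List (X ⊎ Y) → List X
lefts [] = []
lefts (inj₁ x ∷ zs) = x ∷ lefts zs
lefts (inj₂ y ∷ zs) = lefts zs

∈-lefts⁻ : ∀ (zs : List (X ⊎ Y)) {x} → x ∈ lefts zs → inj₁ x ∈ zs
∈-lefts⁻ (inj₁ x ∷ zs) (here refl) = here refl
∈-lefts⁻ (inj₁ x ∷ zs) (there p) = there (∈-lefts⁻ zs p)
∈-lefts⁻ (inj₂ y ∷ zs) p = there (∈-lefts⁻ zs p)

∈-lefts⁺ : ∀ {zs : List (X ⊎ Y)} {x} → inj₁ x ∈ zs → x ∈ lefts zs
∈-lefts⁺ {zs = inj₁ x ∷ zs} (here refl) = here refl
∈-lefts⁺ {zs = inj₁ x ∷ zs} (there p) = there (∈-lefts⁺ p)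
∈-lefts⁺ {zs = inj₂ y ∷ zs} (there p) = ∈-lefts⁺ p

lefts-unique : ∀ {zs : List (X ⊎ Y)} → Unique zs → Unique (lefts zs)
lefts-unique [] = []
lefts-unique {zs = inj₁ x ∷ zs} (x∉ ∷ zs!) =
  All.tabulate (λ {y} y∈ eq → All.lookup x∉ (∈-lefts⁻ zs y∈) (cong inj₁ eq)) ∷ lefts-unique zs!
lefts-unique {zs = inj₂ y ∷ zs} (_ ∷ zs!) = lefts-unique zs!

-- Together with `pullback` this cuts a class along a partition of its index set: pull back along a
-- bijection from a disjoint union, then restrict to the summands.
leftᶜ : Class (X ⊎ Y) → Class X
leftᶜ C .size = size C ∘ inj₁
leftᶜ C .nonneg = nonneg C ∘ inj₁
leftᶜ C .fibre = lefts ∘ fibre C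
leftᶜ C .unique n = lefts-unique (unique C n)
leftᶜ C .sound {n} p = sound C (∈-lefts⁻ (fibre C n) p)
leftᶜ C .complete eq = ∈-lefts⁺ (complete C eq)

swap-↔ : (X ⊎ Y) ↔ (Y ⊎ X)
swap-↔ = mk↔ₛ′ swap swap Sum.swap-involutive Sum.swap-involutive

rightᶜ : Class (X ⊎ Y) → Class Y
rightᶜ C = leftᶜ (pullback C swap-↔)

gf-left-right : (C : Class (X ⊎ Y)) → ∀ n → gf C n ≡ gf (leftᶜ C) n ℤ.+ gf (rightᶜ C) n
gf-left-right C n = trans (gf-↔ C (leftᶜ C ⊎ᶜ rightᶜ C) ↔-refl (λ { (inj₁ _) → refl ; (inj₂ _) → refl }) n)
                          (gf-⊎ (leftᶜ C) (rightᶜ C) n)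

empty-fibre : (C : Class X) → ∀ n → (∀ x → size C x ≢ + n) → gf C n ≡ 0ℤ
empty-fibre C n none with fibre C n | sound C {n}
... | [] | _ = refl
... | x ∷ _ | snd = ⊥-elim (none x (snd (here refl)))

private
  range : ℕ → List ℤ
  range n = map +_ (upTo (suc n)) ++ map -[1+_] (upTo n)

  ∈-range : ∀ n k → ℤ.∣ k ∣ ℕ.≤ n → k ∈ range n
  ∈-range n (+ i) i≤n = ∈-++⁺ˡ (∈-map⁺ +_ (∈-upTo⁺ (s≤s i≤n)))
  ∈-range n -[1+ i ] i<n = ∈-++⁺ʳ (map +_ (upTo (suc n))) (∈-map⁺ -[1+_] (∈-upTo⁺ i<n))

  range-unique : ∀ n → Unique (range n)
  range-unique n = Unique.++⁺ (Unique.map⁺ ℤ.+-injective (Unique.upTo⁺ (suc n)))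
    (Unique.map⁺ ℤ.-[1+-injective (Unique.upTo⁺ n)) disjoint
    where
    disjoint : Disjoint (map +_ (upTo (suc n))) (map -[1+_] (upTo n))
    disjoint (p , q) with ∈-map⁻ +_ p | ∈-map⁻ -[1+_] q
    ... | _ , _ , refl | _ , _ , ()

-- The bound does double duty: it makes sizes nonnegative, and it confines the solutions of s k = n
-- to the interval from -n to n, where they are found by search.
integers : (s : ℤ → ℤ) → (∀ k → + ℤ.∣ k ∣ ℤ.≤ s k) → Class ℤ
integers s bound .size = s
integers s bound .nonneg k with s k | bound k
... | + n | _ = n , refl
integers s bound .fibre n = filter (λ k → s k ℤ.≟ + n) (range n)
integers s bound .unique n = Unique.filter⁺ (λ k → s k ℤ.≟ + n) (range-unique n)
integers s bound .sound {n} p = proj₂ (∈-filter⁻ (λ k → s k ℤ.≟ + n) {xs = range n} p)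
integers s bound .complete {n} {k} eq =
  ∈-filter⁺ (λ k → s k ℤ.≟ + n) (∈-range n k (ℤ.drop‿+≤+ (subst (ℤ._≤_ (+ ℤ.∣ k ∣)) eq (bound k)))) eq

-- The generating function of RD49

count : ∀ {P : X → Set} → Decidable P → List X → ℕ
count P? xs = length (filter P? xs)

count-++ : ∀ {P : X → Set} (P? : Decidable P) xs ys → count P? (xs ++ ys) ≡ count P? xs ℕ.+ count P? ys
count-++ P? xs ys = trans (cong length (filter-++ P? xs ys)) (length-++ (filter P? xs))

count-concatMap : ∀ {P : Y → Set} (P? : Decidable P) (f : X → List Y) xs →
                  count P? (concatMap f xs) ≡ sum (map (count P? ∘ f) xs)
count-concatMap P? f [] = refl
count-concatMap P? f (x ∷ xs) =
  trans (count-++ P? (f x) (concatMap f xs)) (cong (ℕ._+_ (count P? (f x))) (count-concatMap P? f xs))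

count-map : ∀ {P : Y → Set} {Q : X → Set} (P? : Decidable P) (Q? : Decidable Q) (f : X → Y) xs →
            (∀ {x} → x ∈ xs → P (f x) ⇔ Q x) → count P? (map f xs) ≡ count Q? xs
count-map P? Q? f [] P⇔Q = refl
count-map P? Q? f (x ∷ xs) P⇔Q with P? (f x) | Q? x
... | yes p | yes q = cong suc (count-map P? Q? f xs (P⇔Q ∘ there))
... | yes p | no ¬q = ⊥-elim (¬q (Equivalence.to (P⇔Q (here refl)) p))
... | no ¬p | yes q = ⊥-elim (¬p (Equivalence.from (P⇔Q (here refl)) q))
... | no ¬p | no ¬q = count-map P? Q? f xs (P⇔Q ∘ there)

count-none : ∀ {P : X → Set} (P? : Decidable P) xs → (∀ {x} → x ∈ xs → ¬ P x) → count P? xs ≡ 0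
count-none P? xs none = cong length (filter-none P? (All.tabulate none))

partitionsUpTo-bounded : ∀ k n {p} → p ∈ partitionsUpTo k n → All (ℕ._≤ k) p
partitionsUpTo-bounded zero zero (here refl) = []
partitionsUpTo-bounded (suc k) n p∈
  with m , _ , q ← find (∈-concatMap⁻ (λ m → map (replicate m (suc k) ++_) (partitionsUpTo k (n ℕ.∸ m ℕ.* suc k)))
                          {xs = upTo (suc (n ℕ./ suc k))} p∈)
  with p′ , p′∈ , refl ← ∈-map⁻ (replicate m (suc k) ++_) q =
  All.++⁺ (All.replicate⁺ m ℕ.≤-refl) (All.map ℕ.m≤n⇒m≤1+n (partitionsUpTo-bounded k _ p′∈))

-- One more than the largest admissible multiplicity of the part d.
limit : ℕ → ℕ
limit d with 4 ∣? d
... | yes _ = 1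
... | no _ = 9

limit-∣ : ∀ {d} → 4 ∣ d → limit d ≡ 1
limit-∣ {d} 4∣d with 4 ∣? d
... | yes _ = refl
... | no 4∤d = ⊥-elim (4∤d 4∣d)

limit-∤ : ∀ {d} → ¬ (4 ∣ d) → limit d ≡ 9
limit-∤ {d} 4∤d with 4 ∣? d
... | yes 4∣d = ⊥-elim (4∤d 4∣d)
... | no _ = refl

limit-positive : ∀ d → ∃ λ j → limit d ≡ suc j
limit-positive d with 4 ∣? d
... | yes _ = 0 , refl
... | no _ = 8 , refl

multiplicity : ℕ → List ℕ → ℕ
multiplicity x = count (x ℕ.≟_)

multiplicity-replicate : ∀ d m p → All (ℕ._< d) p → multiplicity d (replicate m d ++ p) ≡ m
multiplicity-replicate d m p p<d = begin
  multiplicity d (replicate m d ++ p)                      ≡⟨ count-++ (d ℕ.≟_) (replicate m d) p ⟩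
  multiplicity d (replicate m d) ℕ.+ multiplicity d p
    ≡⟨ cong₂ ℕ._+_ (trans (cong length (filter-all (d ℕ.≟_) (All.replicate⁺ m refl))) (length-replicate m))
                   (count-none (d ℕ.≟_) p (λ x∈ eq → ℕ.<-irrefl (sym eq) (All.lookup p<d x∈))) ⟩
  m ℕ.+ 0                                                  ≡⟨ ℕ.+-identityʳ m ⟩
  m                                                        ∎
  where open ≡-Reasoning

multiplicity-other : ∀ {x} d m p → x ≢ d → multiplicity x (replicate m d ++ p) ≡ multiplicity x p
multiplicity-other {x} d m p x≢d = trans (count-++ (x ℕ.≟_) (replicate m d) p)
  (cong (ℕ._+ multiplicity x p) (cong length (filter-none (x ℕ.≟_) (All.replicate⁺ m x≢d))))

-- Since d exceeds every part of `p`, the new copies leave all other multiplicities alone, and the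
-- only new requirement concerns d itself.
IsRD49-replicate : ∀ d m p → All (ℕ._< d) p → IsRD49 (replicate m d ++ p) ⇔ (m ℕ.< limit d × IsRD49 p)
IsRD49-replicate d m p p<d = mk⇔ to from
  where
  below : (xs : List ℕ) → (∀ {x} → x ∈ xs → x ∈ p) → All (λ x → multiplicity x (replicate m d ++ p) ≡ multiplicity x p) xs
  below xs ⊆p = All.tabulate λ x∈ → multiplicity-other d m p λ { refl → ℕ.<-irrefl refl (All.lookup p<d (⊆p x∈)) }

  few : ∀ m → (m ≢ 0 → ¬ (4 ∣ d)) → (m ≢ 0 → m ℕ.≤ 8) → m ℕ.< limit d
  few m ∤d ≤8 with 4 ∣? d
  few zero ∤d ≤8 | yes _ = s≤s z≤n
  few (suc m) ∤d ≤8 | yes 4∣d = ⊥-elim (∤d (λ ()) 4∣d)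
  few zero ∤d ≤8 | no _ = s≤s z≤n
  few (suc m) ∤d ≤8 | no _ = s≤s (≤8 (λ ()))

  to : IsRD49 (replicate m d ++ p) → m ℕ.< limit d × IsRD49 p
  to (regular , distinct) =
    few m (λ m≢0 → All.lookup regular (∈-++⁺ˡ (d∈ m m≢0)))
          (λ m≢0 → subst (ℕ._≤ 8) (multiplicity-replicate d m p p<d) (All.lookup distinct (∈-++⁺ˡ (d∈ m m≢0)))) ,
    All.++⁻ʳ (replicate m d) regular ,
    All.zipWith (λ (eq , ≤8) → subst (ℕ._≤ 8) eq ≤8) (below p (λ x∈ → x∈) , All.++⁻ʳ (replicate m d) distinct)
    where
    d∈ : ∀ m → m ≢ 0 → d ∈ replicate m d
    d∈ zero m≢0 = ⊥-elim (m≢0 refl)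
    d∈ (suc m) _ = here refl

  from : m ℕ.< limit d × IsRD49 p → IsRD49 (replicate m d ++ p)
  from (m<limit , regular , distinct) =
    All.++⁺ (∤-replicate m m<limit) regular ,
    All.++⁺ (All.replicate⁺ m (subst (ℕ._≤ 8) (sym (multiplicity-replicate d m p p<d)) ≤8))
            (All.zipWith (λ (eq , ≤8) → subst (ℕ._≤ 8) (sym eq) ≤8) (below p (λ x∈ → x∈) , distinct))
    where
    limit≤9 : limit d ℕ.≤ 9
    limit≤9 with 4 ∣? d
    ... | yes _ = s≤s z≤n
    ... | no _ = ℕ.≤-refl
    ≤8 : m ℕ.≤ 8
    ≤8 = ℕ.s≤s⁻¹ (ℕ.≤-trans m<limit limit≤9)
    ∤-replicate : ∀ m → m ℕ.< limit d → All (λ x → ¬ (4 ∣ x)) (replicate m d)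
    ∤-replicate m m<limit with 4 ∣? d
    ∤-replicate zero m<limit | yes _ = []
    ∤-replicate (suc m) (s≤s ()) | yes _
    ∤-replicate m m<limit | no 4∤d = All.replicate⁺ m 4∤d

rdUpTo : ℕ → ℕ → ℕ
rdUpTo k n = count isRD49? (partitionsUpTo k n)

module _ (a : ℕ → ℕ) (d : ℕ) where

  -- The summand for multiplicity i, cut off at i = j. The recursion on j is that of `geometric`;
  -- truncated subtraction is harmless because only i ≤ n / d is ever summed.
  terms : ℕ → ℕ → ℕ → ℕ
  terms zero n i = 0
  terms (suc j) n zero = a n
  terms (suc j) n (suc i) = terms j (n ℕ.∸ d) i

  terms-< : ∀ {j} n {i} → i ℕ.< j → terms j n i ≡ a (n ℕ.∸ i ℕ.* d)
  terms-< {suc j} n {zero} _ = refl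
  terms-< {suc j} n {suc i} (s≤s i<j) = trans (terms-< (n ℕ.∸ d) i<j) (cong a (ℕ.∸-+-assoc n d (i ℕ.* d)))

  terms-≥ : ∀ {j} n {i} → j ℕ.≤ i → terms j n i ≡ 0
  terms-≥ {zero} n _ = refl
  terms-≥ {suc j} n {suc i} (s≤s j≤i) = terms-≥ {j} (n ℕ.∸ d) j≤i

rdUpTo-suc : ∀ k n → rdUpTo (suc k) n
           ≡ sum (map (terms (rdUpTo k) (suc k) (limit (suc k)) n) (upTo (suc (n ℕ./ suc k))))
rdUpTo-suc k n = trans (count-concatMap isRD49? with-multiplicity (upTo (suc (n ℕ./ suc k))))
                       (cong sum (map-cong each (upTo (suc (n ℕ./ suc k)))))
  where
  d : ℕ
  d = suc k
  rest : ℕ → List (List ℕ)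
  rest m = partitionsUpTo k (n ℕ.∸ m ℕ.* d)
  with-multiplicity : ℕ → List (List ℕ)
  with-multiplicity m = map (replicate m d ++_) (rest m)
  smaller : ∀ m {p} → p ∈ rest m → All (ℕ._< d) p
  smaller m p∈ = All.map s≤s (partitionsUpTo-bounded k _ p∈)
  each : ∀ m → count isRD49? (with-multiplicity m) ≡ terms (rdUpTo k) d (limit d) n m
  each m with m ℕ.<? limit d
  ... | yes m<limit = trans
    (count-map isRD49? isRD49? (replicate m d ++_) (rest m) λ {p} p∈ → mk⇔
      (λ x → proj₂ (Equivalence.to (IsRD49-replicate d m p (smaller m p∈)) x))
      (λ x → Equivalence.from (IsRD49-replicate d m p (smaller m p∈)) (m<limit , x)))
    (sym (terms-< (rdUpTo k) d n m<limit))
  ... | no m≮limit = trans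
    (count-none isRD49? (with-multiplicity m) none)
    (sym (terms-≥ (rdUpTo k) d n (ℕ.≮⇒≥ m≮limit)))
    where
    none : ∀ {p} → p ∈ with-multiplicity m → ¬ IsRD49 p
    none q∈ q with p , p∈ , refl ← ∈-map⁻ (replicate m d ++_) q∈ =
      m≮limit (proj₁ (Equivalence.to (IsRD49-replicate d m p (smaller m p∈)) q))

sign : ℕ → ℤ
sign zero = 1ℤ
sign (suc n) = ℤ.- sign n

sign-+ : ∀ a b → sign (a ℕ.+ b) ≡ sign a ℤ.* sign b
sign-+ zero b = sym (ℤ.*-identityˡ (sign b))
sign-+ (suc a) b = trans (cong ℤ.-_ (sign-+ a b)) (ℤ.neg-distribˡ-* (sign a) (sign b))

sign-square : ∀ a → sign a ℤ.* sign a ≡ 1ℤ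
sign-square zero = refl
sign-square (suc a) = trans (lemma (sign a)) (sign-square a)
  where
  lemma : ∀ x → (ℤ.- x) ℤ.* (ℤ.- x) ≡ x ℤ.* x
  lemma = solve-∀

-- As 9 is odd, (-q)^(9d) = (-q⁹)^d. Therefore the numerator of the product for R(-q) is its
-- denominator with q replaced by q⁹.
sign-9* : ∀ d → sign (9 ℕ.* d) ≡ sign d
sign-9* d = begin
  sign (d ℕ.+ (8 ℕ.* d))                     ≡⟨ sign-+ d (8 ℕ.* d) ⟩
  sign d ℤ.* sign (8 ℕ.* d)                  ≡⟨ cong (λ e → sign d ℤ.* sign e) (ℕ.*-distribʳ-+ d 4 4) ⟩
  sign d ℤ.* sign (4 ℕ.* d ℕ.+ 4 ℕ.* d)      ≡⟨ cong (ℤ._*_ (sign d)) (trans (sign-+ (4 ℕ.* d) (4 ℕ.* d)) (sign-square (4 ℕ.* d))) ⟩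
  sign d ℤ.* 1ℤ                              ≡⟨ ℤ.*-identityʳ (sign d) ⟩
  sign d                                     ∎
  where open ≡-Reasoning

-- a(−q)
alternate : Series → Series
alternate a n = sign n ℤ.* a n

opaque
  unfolding _⊕_

  alternate-⊕ : ∀ a b → alternate (a ⊕ b) ≗ alternate a ⊕ alternate b
  alternate-⊕ a b n = ℤ.*-distribˡ-+ (sign n) (a n) (b n)

alternate-tail : ∀ a n → alternate a (suc n) ≡ ℤ.- 1ℤ ℤ.* alternate (tail a) n
alternate-tail a n = lemma (sign n) (a (suc n))
  where
  lemma : ∀ x y → (ℤ.- x) ℤ.* y ≡ ℤ.- 1ℤ ℤ.* (x ℤ.* y)
  lemma = solve-∀

alternate-⊗ : ∀ a b → alternate (a ⊗ b) ≗ alternate a ⊗ alternate b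
alternate-⊗ a b zero = lemma (a 0) (b 0)
  where
  lemma : ∀ x y → 1ℤ ℤ.* (x ℤ.* y) ≡ (1ℤ ℤ.* x) ℤ.* (1ℤ ℤ.* y)
  lemma = solve-∀
alternate-⊗ a b (suc n) = begin
  ℤ.- sign n ℤ.* (a 0 ℤ.* b (suc n) ℤ.+ (tail a ⊗ b) n)
    ≡⟨ lemma (sign n) (a 0) (b (suc n)) ((tail a ⊗ b) n) ⟩
  1ℤ ℤ.* a 0 ℤ.* (ℤ.- sign n ℤ.* b (suc n)) ℤ.+ ℤ.- 1ℤ ℤ.* alternate (tail a ⊗ b) n
    ≡⟨ cong (λ z → 1ℤ ℤ.* a 0 ℤ.* (ℤ.- sign n ℤ.* b (suc n)) ℤ.+ ℤ.- 1ℤ ℤ.* z) (alternate-⊗ (tail a) b n) ⟩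
  1ℤ ℤ.* a 0 ℤ.* (ℤ.- sign n ℤ.* b (suc n)) ℤ.+ ℤ.- 1ℤ ℤ.* (alternate (tail a) ⊗ alternate b) n
    ≡⟨ cong (ℤ._+_ (1ℤ ℤ.* a 0 ℤ.* (ℤ.- sign n ℤ.* b (suc n))))
         (trans (sym (scale-⊗ (ℤ.- 1ℤ) (alternate (tail a)) (alternate b) n))
                (⊗-cong≗ (λ i → sym (alternate-tail a i)) (λ _ → refl) n)) ⟩
  (alternate a ⊗ alternate b) (suc n) ∎
  where
  open ≡-Reasoning
  lemma : ∀ s x y z → ℤ.- s ℤ.* (x ℤ.* y ℤ.+ z) ≡ 1ℤ ℤ.* x ℤ.* (ℤ.- s ℤ.* y) ℤ.+ ℤ.- 1ℤ ℤ.* (s ℤ.* z)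
  lemma = solve-∀

alternate-κ : ∀ z → alternate (κ z) ≗ κ z
alternate-κ z zero = ℤ.*-identityˡ z
alternate-κ z (suc n) = ℤ.*-zeroʳ (sign (suc n))

-- The d-th power of -q^s.
power : ℕ → ℕ → Series
power s d = κ (sign d) ⊗ mono (s ℕ.* d)

alternate-mono : ∀ d → alternate (mono d) ≗ κ (sign d) ⊗ mono d
alternate-mono d n = trans (go d n) (sym (κ-⊗ (sign d) (mono d) n))
  where
  lemma : ∀ x y → (ℤ.- x) ℤ.* y ≡ ℤ.- 1ℤ ℤ.* (x ℤ.* y)
  lemma = solve-∀
  go : ∀ d n → sign n ℤ.* mono d n ≡ sign d ℤ.* mono d n
  go zero zero = refl
  go zero (suc n) = trans (ℤ.*-zeroʳ (sign (suc n))) (sym (ℤ.*-zeroʳ 1ℤ))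
  go (suc d) zero = sym (ℤ.*-zeroʳ (sign (suc d)))
  go (suc d) (suc n) = trans (lemma (sign n) (mono d n))
    (trans (cong (ℤ._*_ (ℤ.- 1ℤ)) (go d n)) (sym (lemma (sign d) (mono d n))))

geometric : Series → ℕ → Series
geometric y zero = κ 0ℤ
geometric y (suc j) = κ 1ℤ ⊕ y ⊗ geometric y j

rd : ℕ → Series
rd k n = + rdUpTo k n

-- the generating function of RD49 at −q
RD : Series
RD = alternate (λ n → + RD49 n)

-- The factors 1 - (-q^s)^d for d in the i-th block of four, the multiple of 4 left out. Their
-- infinite product is φ(q^s)/ψ(q^s).
gaussFactors : ℕ → ℕ → Series
gaussFactors s i = (κ 1ℤ ⊕ ⊝ power s (1 ℕ.+ i ℕ.* 4)) ⊗ (κ 1ℤ ⊕ ⊝ power s (2 ℕ.+ i ℕ.* 4))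
                 ⊗ (κ 1ℤ ⊕ ⊝ power s (3 ℕ.+ i ℕ.* 4))

module PartitionProduct (m : ℕ) where
  open SeriesMod m
  open Sums m
  open Relation.Binary.Reasoning.Setoid setoid

  -- Multiplicity 0 contributes `a n`, and the other multiplicities amount to a shift by d. The list
  -- of multiplicities stops at n / d, just where the monomial q^d no longer reaches the coefficient
  -- at `n`.
  sum-terms : ∀ a d-1 j n → let d = suc d-1 in
    + sum (map (terms a d j n) (upTo (suc (n ℕ./ d)))) ≡ (geometric (mono d) j ⊗ (λ i → + a i)) n [mod m ]
  sum-terms a d-1 zero n = mod-reflexive (trans (cong +_ (zeros (upTo (suc (n ℕ./ suc d-1)))))
    (sym (trans (⊗-zeroˡ _ n) (κ0 n))))
    where
    zeros : ∀ xs → sum (map (λ _ → 0) xs) ≡ 0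
    zeros [] = refl
    zeros (_ ∷ xs) = zeros xs
  sum-terms a d-1 (suc j) n = mod-trans (mod-+ (mod-reflexive {x = + a n} refl) later)
    (mod-sym (mod-trans (expand at n) (mod-reflexive (⊕-at _ _ n))))
    where
    d = suc d-1
    A : Series
    A i = + a i
    g : Series
    g = geometric (mono d) j
    expand : geometric (mono d) (suc j) ⊗ A ≈ A ⊕ mono d ⊗ (g ⊗ A)
    expand = solve 3 (λ y g a → (con 1ℤ :+ y :* g) :* a := a :+ y :* (g :* a)) ≈-refl (mono d) g A
    shifted : ∀ X → map (terms a d (suc j) n) (applyUpTo suc X) ≡ map (terms a d j (n ℕ.∸ d)) (upTo X)
    shifted X = trans (map-applyUpTo suc (terms a d (suc j) n) X) (sym (map-upTo (terms a d j (n ℕ.∸ d)) X))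
    later : + sum (map (terms a d (suc j) n) (applyUpTo suc (n ℕ./ d))) ≡ (mono d ⊗ (g ⊗ A)) n [mod m ]
    later with ℕ.<-≤-connex n d
    ... | inj₁ n<d rewrite m<n⇒m/n≡0 n<d = mod-reflexive (sym (mono-⊗-< d (g ⊗ A) n n<d))
    ... | inj₂ d≤n with k , refl ← ℕ.m≤n⇒∃[o]m+o≡n d≤n =
      mod-trans (mod-reflexive (trans (cong (λ xs → + sum xs) (shifted ((d ℕ.+ k) ℕ./ d)))
                  (cong₂ (λ r X → + sum (map (terms a d j r) (upTo X))) (ℕ.m+n∸m≡n d k)
                    (trans (m/n≡1+[m∸n]/n d≤n) (cong (λ r → suc (r ℕ./ d)) (ℕ.m+n∸m≡n d k))))))
      (mod-trans (sum-terms a d-1 j k) (mod-reflexive (sym (mono-⊗-≥ d (g ⊗ A) k))))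

  rd-suc : ∀ k → rd (suc k) ≈ geometric (mono (suc k)) (limit (suc k)) ⊗ rd k
  rd-suc k = coeffwise λ n →
    mod-trans (mod-reflexive (cong +_ (rdUpTo-suc k n))) (sum-terms (rdUpTo k) k (limit (suc k)) n)

  rd-zero : rd 0 ≈ κ 1ℤ
  rd-zero = ≗⇒≈ λ { zero → refl ; (suc n) → refl }

  -- A part larger than `n` cannot occur in a partition of a number up to `n`: as `limit` is
  -- positive, its factor is 1 plus a multiple of a monomial of degree above `n`.
  rd-stable : ∀ d n → rd (d ℕ.+ n) ≈[ suc n ] rd n
  rd-stable zero n = ≈[]-refl
  rd-stable (suc d) n with j , eq ← limit-positive (suc d ℕ.+ n) =
    ≈[]-trans (≈⇒≈[] (≈-trans (rd-suc (d ℕ.+ n)) (≈-trans (⊗-cong (≗⇒≈ (λ i → cong (λ l → geometric y l i) eq)) ≈-refl)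
      (solve 3 (λ y g a → (con 1ℤ :+ y :* g) :* a := a :+ y :* (g :* a)) ≈-refl y (geometric y j) (rd (d ℕ.+ n))))))
    (≈[]-trans (⊕-cong[] (rd-stable d n) (weaken[] (s≤s (ℕ.m≤n+m n d)) (mono-⊗≈0[] (suc d ℕ.+ n) _)))
      (≈⇒≈[] (solve 1 (λ a → a :+ con 0ℤ := a) ≈-refl (rd n))))
    where
    y : Series
    y = mono (suc d ℕ.+ n)

  alternate-≈ : ∀ {a b} → a ≈ b → alternate a ≈ alternate b
  alternate-≈ p = coeffwise λ n → mod-* (mod-reflexive {x = sign n} refl) (p at n)

  RD-rd : ∀ K → RD ≈[ suc K ] alternate (rd K)
  RD-rd K = coeffwise[] λ n n≤K → mod-* (mod-reflexive {x = sign n} refl)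
    (mod-sym (subst (λ k → rd k n ≡ rd n n [mod m ]) (ℕ.m∸n+n≡m (ℕ.s≤s⁻¹ n≤K))
      ((rd-stable (K ℕ.∸ n) n at[] n) ℕ.≤-refl)))

  power-1 : ∀ d → alternate (mono d) ≈ power 1 d
  power-1 d = ≈-trans (≗⇒≈ (alternate-mono d)) (⊗-cong ≈-refl (mono-≡ (sym (ℕ.*-identityˡ d))))

  alternate-geometric : ∀ d j → alternate (geometric (mono d) j) ≈ geometric (power 1 d) j
  alternate-geometric d zero = ≗⇒≈ (alternate-κ 0ℤ)
  alternate-geometric d (suc j) = ≈-trans (≗⇒≈ (alternate-⊕ (κ 1ℤ) (mono d ⊗ geometric (mono d) j)))
    (⊕-cong (≗⇒≈ (alternate-κ 1ℤ)) (≈-trans (≗⇒≈ (alternate-⊗ (mono d) (geometric (mono d) j)))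
      (⊗-cong (power-1 d) (alternate-geometric d j))))

  alternate-rd-suc : ∀ k → alternate (rd (suc k)) ≈ geometric (power 1 (suc k)) (limit (suc k)) ⊗ alternate (rd k)
  alternate-rd-suc k = ≈-trans (alternate-≈ (rd-suc k))
    (≈-trans (≗⇒≈ (alternate-⊗ (geometric (mono (suc k)) (limit (suc k))) (rd k)))
             (⊗-cong (alternate-geometric (suc k) (limit (suc k))) ≈-refl))

  power-+ : ∀ d e → power 1 (d ℕ.+ e) ≈ power 1 d ⊗ power 1 e
  power-+ d e = begin
    κ (sign (d ℕ.+ e)) ⊗ mono (1 ℕ.* (d ℕ.+ e))
      ≈⟨ ⊗-cong (≗⇒≈ (λ n → trans (cong (λ z → κ z n) (sign-+ d e)) (κ-* (sign d) (sign e) n)))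
                (≈-trans (mono-≡ (ℕ.*-distribˡ-+ 1 d e)) (≗⇒≈ (mono-+ (1 ℕ.* d) (1 ℕ.* e)))) ⟩
    κ (sign d) ⊗ κ (sign e) ⊗ (mono (1 ℕ.* d) ⊗ mono (1 ℕ.* e))
      ≈⟨ solve 4 (λ a b c d → a :* b :* (c :* d) := a :* c :* (b :* d)) ≈-refl
           (κ (sign d)) (κ (sign e)) (mono (1 ℕ.* d)) (mono (1 ℕ.* e)) ⟩
    power 1 d ⊗ power 1 e ∎

  geometric-closed : ∀ d j → (κ 1ℤ ⊕ ⊝ power 1 d) ⊗ geometric (power 1 d) j ≈ κ 1ℤ ⊕ ⊝ power 1 (j ℕ.* d)
  geometric-closed d zero = begin
    (κ 1ℤ ⊕ ⊝ power 1 d) ⊗ κ 0ℤ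
      ≈⟨ solve 1 (λ x → (con 1ℤ :+ :- x) :* con 0ℤ := con 1ℤ :+ :- (con 1ℤ :* con 1ℤ)) ≈-refl (power 1 d) ⟩
    κ 1ℤ ⊕ ⊝ power 1 0 ∎
  geometric-closed d (suc j) = begin
    (κ 1ℤ ⊕ ⊝ x) ⊗ (κ 1ℤ ⊕ x ⊗ geometric x j)
      ≈⟨ solve 2 (λ x g → (con 1ℤ :+ :- x) :* (con 1ℤ :+ x :* g) := con 1ℤ :+ :- x :+ x :* ((con 1ℤ :+ :- x) :* g))
           ≈-refl x (geometric x j) ⟩
    κ 1ℤ ⊕ ⊝ x ⊕ x ⊗ ((κ 1ℤ ⊕ ⊝ x) ⊗ geometric x j)
      ≈⟨ ⊕-cong ≈-refl (⊗-cong ≈-refl (geometric-closed d j)) ⟩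
    κ 1ℤ ⊕ ⊝ x ⊕ x ⊗ (κ 1ℤ ⊕ ⊝ power 1 (j ℕ.* d))
      ≈⟨ solve 2 (λ x y → con 1ℤ :+ :- x :+ x :* (con 1ℤ :+ :- y) := con 1ℤ :+ :- (x :* y)) ≈-refl x (power 1 (j ℕ.* d)) ⟩
    κ 1ℤ ⊕ ⊝ (x ⊗ power 1 (j ℕ.* d))
      ≈⟨ ⊕-cong ≈-refl (⊝-cong (≈-sym (power-+ d (j ℕ.* d)))) ⟩
    κ 1ℤ ⊕ ⊝ power 1 (suc j ℕ.* d) ∎
    where
    x : Series
    x = power 1 d

  power-9 : ∀ d → power 1 (9 ℕ.* d) ≈ power 9 d
  power-9 d = ⊗-cong (≗⇒≈ λ n → cong (λ z → κ z n) (sign-9* d)) (mono-≡ (ℕ.*-identityˡ (9 ℕ.* d)))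

  step-∤ : ∀ k → ¬ (4 ∣ suc k) →
           alternate (rd (suc k)) ⊗ (κ 1ℤ ⊕ ⊝ power 1 (suc k)) ≈ alternate (rd k) ⊗ (κ 1ℤ ⊕ ⊝ power 9 (suc k))
  step-∤ k 4∤ = begin
    alternate (rd (suc k)) ⊗ (κ 1ℤ ⊕ ⊝ x)
      ≈⟨ ⊗-cong (alternate-rd-suc k) ≈-refl ⟩
    geometric x (limit (suc k)) ⊗ alternate (rd k) ⊗ (κ 1ℤ ⊕ ⊝ x)
      ≈⟨ solve 3 (λ g a u → g :* a :* u := a :* (u :* g)) ≈-refl (geometric x (limit (suc k))) (alternate (rd k)) (κ 1ℤ ⊕ ⊝ x) ⟩
    alternate (rd k) ⊗ ((κ 1ℤ ⊕ ⊝ x) ⊗ geometric x (limit (suc k)))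
      ≈⟨ ⊗-cong ≈-refl (geometric-closed (suc k) (limit (suc k))) ⟩
    alternate (rd k) ⊗ (κ 1ℤ ⊕ ⊝ power 1 (limit (suc k) ℕ.* suc k))
      ≈⟨ ⊗-cong ≈-refl (⊕-cong ≈-refl (⊝-cong (≈-trans
           (≗⇒≈ λ n → cong (λ l → power 1 (l ℕ.* suc k) n) (limit-∤ 4∤)) (power-9 (suc k))))) ⟩
    alternate (rd k) ⊗ (κ 1ℤ ⊕ ⊝ power 9 (suc k)) ∎
    where
    x : Series
    x = power 1 (suc k)

  step-∣ : ∀ k → 4 ∣ suc k → alternate (rd (suc k)) ≈ alternate (rd k)
  step-∣ k 4∣ = begin
    alternate (rd (suc k)) ≈⟨ alternate-rd-suc k ⟩
    geometric x (limit (suc k)) ⊗ alternate (rd k)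
      ≈⟨ ⊗-cong (≗⇒≈ λ n → cong (λ l → geometric x l n) (limit-∣ 4∣)) ≈-refl ⟩
    (κ 1ℤ ⊕ x ⊗ κ 0ℤ) ⊗ alternate (rd k)
      ≈⟨ solve 2 (λ x a → (con 1ℤ :+ x :* con 0ℤ) :* a := a) ≈-refl x (alternate (rd k)) ⟩
    alternate (rd k) ∎
    where
    x : Series
    x = power 1 (suc k)

  rd-product : ∀ n → alternate (rd (n ℕ.* 4)) ⊗ ∏ (gaussFactors 1) n ≈ ∏ (gaussFactors 9) n
  rd-product zero = begin
    alternate (rd 0) ⊗ κ 1ℤ ≈⟨ ⊗-cong (≈-trans (alternate-≈ rd-zero) (≗⇒≈ (alternate-κ 1ℤ))) ≈-refl ⟩
    κ 1ℤ ⊗ κ 1ℤ             ≈⟨ solve 0 (con 1ℤ :* con 1ℤ := con 1ℤ) ≈-refl ⟩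
    κ 1ℤ                    ∎
  rd-product (suc n) = begin
    R 4 ⊗ (D ⊗ (u 1 ⊗ u 2 ⊗ u 3))
      ≈⟨ ⊗-cong (step-∣ (3 ℕ.+ N) (∣m∣n⇒∣m+n ∣-refl (n∣m*n n))) ≈-refl ⟩
    R 3 ⊗ (D ⊗ (u 1 ⊗ u 2 ⊗ u 3))
      ≈⟨ solve 5 (λ r d x y z → r :* (d :* (x :* y :* z)) := r :* z :* (d :* x :* y)) ≈-refl (R 3) D (u 1) (u 2) (u 3) ⟩
    R 3 ⊗ u 3 ⊗ (D ⊗ u 1 ⊗ u 2)
      ≈⟨ ⊗-cong (step-∤ (2 ℕ.+ N) (∤ (from-no (4 ∣? 3)))) ≈-refl ⟩
    R 2 ⊗ v 3 ⊗ (D ⊗ u 1 ⊗ u 2)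
      ≈⟨ solve 5 (λ r d x y z → r :* z :* (d :* x :* y) := r :* y :* (d :* x :* z)) ≈-refl (R 2) D (u 1) (u 2) (v 3) ⟩
    R 2 ⊗ u 2 ⊗ (D ⊗ u 1 ⊗ v 3)
      ≈⟨ ⊗-cong (step-∤ (1 ℕ.+ N) (∤ (from-no (4 ∣? 2)))) ≈-refl ⟩
    R 1 ⊗ v 2 ⊗ (D ⊗ u 1 ⊗ v 3)
      ≈⟨ solve 5 (λ r d x y z → r :* y :* (d :* x :* z) := r :* x :* (d :* y :* z)) ≈-refl (R 1) D (u 1) (v 2) (v 3) ⟩
    R 1 ⊗ u 1 ⊗ (D ⊗ v 2 ⊗ v 3)
      ≈⟨ ⊗-cong (step-∤ N (∤ (from-no (4 ∣? 1)))) ≈-refl ⟩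
    R 0 ⊗ v 1 ⊗ (D ⊗ v 2 ⊗ v 3)
      ≈⟨ solve 5 (λ r d x y z → r :* x :* (d :* y :* z) := r :* d :* (x :* y :* z)) ≈-refl (R 0) D (v 1) (v 2) (v 3) ⟩
    R 0 ⊗ D ⊗ (v 1 ⊗ v 2 ⊗ v 3)
      ≈⟨ ⊗-cong (rd-product n) ≈-refl ⟩
    ∏ (gaussFactors 9) (suc n) ∎
    where
    N : ℕ
    N = n ℕ.* 4
    R u v : ℕ → Series
    R i = alternate (rd (i ℕ.+ N))
    u i = κ 1ℤ ⊕ ⊝ power 1 (i ℕ.+ N)
    v i = κ 1ℤ ⊕ ⊝ power 9 (i ℕ.+ N)
    D : Series
    D = ∏ (gaussFactors 1) n
    ∤ : ∀ {r} → ¬ (4 ∣ r) → ¬ (4 ∣ r ℕ.+ N)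
    ∤ {r} 4∤r 4∣ = 4∤r (∣m+n∣m⇒∣n (subst (4 ∣_) (ℕ.+-comm r N) 4∣) (n∣m*n n))

  RD-product : ∀ n → RD ⊗ ∏ (gaussFactors 1) n ≈[ suc (n ℕ.* 4) ] ∏ (gaussFactors 9) n
  RD-product n = ≈[]-trans (⊗-cong[] (RD-rd (n ℕ.* 4)) ≈[]-refl) (≈⇒≈[] (rd-product n))

-- The Jacobi triple product

i≤∣i∣ : ∀ i → i ℤ.≤ + ℤ.∣ i ∣
i≤∣i∣ (+ n) = ℤ.≤-refl
i≤∣i∣ -[1+ n ] = ℤ.-≤+

mono-diagonal : ∀ d → mono d d ≡ 1ℤ
mono-diagonal zero = refl
mono-diagonal (suc d) = mono-diagonal d

mono-off-diagonal : ∀ d n → d ≢ n → mono d n ≡ 0ℤ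
mono-off-diagonal zero zero d≢n = ⊥-elim (d≢n refl)
mono-off-diagonal zero (suc n) d≢n = refl
mono-off-diagonal (suc d) zero d≢n = refl
mono-off-diagonal (suc d) (suc n) d≢n = mono-off-diagonal d n (d≢n ∘ cong suc)

opaque
  unfolding _⊕_

  antidiagonal-mono : ∀ (e : ℕ → ℕ) M c →
    antidiagonal (λ h _ → mono (e h)) M c ≡ + length (filter (λ i → e i ℕ.≟ c) (upTo (suc M)))
  antidiagonal-mono e M c = go e M
    where
    single : ∀ (e : ℕ → ℕ) h xs → mono (e h) c ℤ.+ + length (filter (λ i → e i ℕ.≟ c) xs)
           ≡ + length (filter (λ i → e i ℕ.≟ c) (h ∷ xs))
    single e h xs with e h ℕ.≟ c
    ... | yes eq = trans (cong (ℤ._+ + length (filter (λ i → e i ℕ.≟ c) xs)) (trans (cong (mono (e h)) (sym eq)) (mono-diagonal (e h))))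
                         (cong (λ ys → + length ys) (sym (filter-accept (λ i → e i ℕ.≟ c) {h} {xs} eq)))
    ... | no neq = trans (cong (ℤ._+ + length (filter (λ i → e i ℕ.≟ c) xs)) (mono-off-diagonal (e h) c neq))
                  (trans (ℤ.+-identityˡ _) (cong (λ ys → + length ys) (sym (filter-reject (λ i → e i ℕ.≟ c) {h} {xs} neq))))
    filter-map : ∀ (e : ℕ → ℕ) xs → length (filter (λ i → e i ℕ.≟ c) (map suc xs))
               ≡ length (filter (λ i → e (suc i) ℕ.≟ c) xs)
    filter-map e xs = count-map (λ i → e i ℕ.≟ c) (λ i → e (suc i) ℕ.≟ c) suc xs (λ _ → mk⇔ (λ p → p) (λ p → p))
    go : ∀ (e : ℕ → ℕ) M → antidiagonal (λ h _ → mono (e h)) M c ≡ + length (filter (λ i → e i ℕ.≟ c) (upTo (suc M)))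
    go e zero = trans (sym (ℤ.+-identityʳ _)) (single e 0 [])
    go e (suc M) = trans (cong (ℤ._+_ (mono (e 0) c)) (trans (go (e ∘ suc) M)
        (cong +_ (trans (sym (filter-map e (upTo (suc M)))) (cong (λ xs → length (filter (λ i → e i ℕ.≟ c) xs)) (map-upTo suc (suc M)))))))
      (single e 0 (applyUpTo suc (suc M)))

-- The finite form is Π_{i<n} (1 + q^(a+wi)) (1 + q^(b+wi)) = Σ_k [2n, n+k] q^(s k) with w = a + b; multiplying by
-- the Euler factors turns the Gaussian binomials into 1 up to high order.
module TripleProduct (m a b v : ℕ) (w≡ : a ℕ.+ b ≡ suc v) (s : ℤ → ℤ) (bound : ∀ k → + ℤ.∣ k ∣ ℤ.≤ s k)
  (s-zero : s 0ℤ ≡ 0ℤ) (s-suc : ∀ k → s (k ℤ.+ 1ℤ) ≡ s k ℤ.+ + a ℤ.+ (+ a ℤ.+ + b) ℤ.* k) where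

  open SeriesMod m
  open Sums m
  open Gaussian m v

  -- The exponent is a k(k+1)/2 + b k(k-1)/2, pinned down by `s-zero` and `s-suc` without dividing
  -- by 2. The absolute value merely changes the type, since `bound` forces nonnegativity.
  e : ℤ → ℕ
  e k = ℤ.∣ s k ∣

  +e : ∀ k → + e k ≡ s k
  +e k = ℤ.0≤i⇒+∣i∣≡i (ℤ.≤-trans (ℤ.+≤+ z≤n) (bound k))

  e-bound : ∀ k → ℤ.∣ k ∣ ℕ.≤ e k
  e-bound k = ℤ.drop‿+≤+ (subst (ℤ._≤_ (+ ℤ.∣ k ∣)) (sym (+e k)) (bound k))

  +w : + w ≡ + a ℤ.+ + b
  +w = cong +_ (sym w≡)

  -- The hypothesis `multiply` of `gaussSum-stepʳ`, from s(-j-1) - s(-j) = b + w j. Likewise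
  -- `raiseˡ` uses s(k+1) - s(k) = a + w k at k = h - n.
  raiseʳ : ∀ M h j → h ℕ.+ j ≡ M → mono (e (ℤ.- + j)) ⊗ mono (b ℕ.+ w ℕ.* M) ≈ mono (e (ℤ.- + suc j)) ⊗ Q^ h
  raiseʳ _ h j refl = mono-⊗-mono {e (ℤ.- + j)} {b ℕ.+ w ℕ.* (h ℕ.+ j)} {e (ℤ.- + suc j)} {w ℕ.* h} (ℤ.+-injective (begin
    + e (ℤ.- + j) ℤ.+ (+ b ℤ.+ + (w ℕ.* (h ℕ.+ j)))
      ≡⟨ cong₂ (λ x y → x ℤ.+ (+ b ℤ.+ y)) (+e (ℤ.- + j)) (trans (ℤ.pos-* w (h ℕ.+ j)) (cong (ℤ._* (+ h ℤ.+ + j)) +w)) ⟩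
    s (ℤ.- + j) ℤ.+ (+ b ℤ.+ (+ a ℤ.+ + b) ℤ.* (+ h ℤ.+ + j))
      ≡⟨ cong (λ k → s k ℤ.+ (+ b ℤ.+ (+ a ℤ.+ + b) ℤ.* (+ h ℤ.+ + j))) (index (+ j)) ⟩
    s (ℤ.- (1ℤ ℤ.+ + j) ℤ.+ 1ℤ) ℤ.+ (+ b ℤ.+ (+ a ℤ.+ + b) ℤ.* (+ h ℤ.+ + j))
      ≡⟨ cong (ℤ._+ (+ b ℤ.+ (+ a ℤ.+ + b) ℤ.* (+ h ℤ.+ + j))) (s-suc (ℤ.- (1ℤ ℤ.+ + j))) ⟩
    s (ℤ.- + suc j) ℤ.+ + a ℤ.+ (+ a ℤ.+ + b) ℤ.* (ℤ.- (1ℤ ℤ.+ + j)) ℤ.+ (+ b ℤ.+ (+ a ℤ.+ + b) ℤ.* (+ h ℤ.+ + j))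
      ≡⟨ lemma (s (ℤ.- + suc j)) (+ a) (+ b) (+ h) (+ j) ⟩
    s (ℤ.- + suc j) ℤ.+ (+ a ℤ.+ + b) ℤ.* + h
      ≡⟨ cong₂ ℤ._+_ (+e (ℤ.- + suc j)) (trans (ℤ.pos-* w h) (cong (ℤ._* + h) +w)) ⟨
    + e (ℤ.- + suc j) ℤ.+ + (w ℕ.* h) ∎))
    where
    open ≡-Reasoning
    index : ∀ j → ℤ.- j ≡ ℤ.- (1ℤ ℤ.+ j) ℤ.+ 1ℤ
    index = solve-∀
    lemma : ∀ s a b h j → s ℤ.+ a ℤ.+ (a ℤ.+ b) ℤ.* (ℤ.- (1ℤ ℤ.+ j)) ℤ.+ (b ℤ.+ (a ℤ.+ b) ℤ.* (h ℤ.+ j)) ≡ s ℤ.+ (a ℤ.+ b) ℤ.* h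
    lemma = solve-∀

  raiseˡ : ∀ n d h j → h ℕ.+ j ≡ d ℕ.+ n →
           mono (e (+ h ℤ.- + n)) ⊗ mono (a ℕ.+ w ℕ.* d) ≈ mono (e (+ suc h ℤ.- + n)) ⊗ Q^ j
  raiseˡ n d h j eq = mono-⊗-mono {e (+ h ℤ.- + n)} {a ℕ.+ w ℕ.* d} {e (+ suc h ℤ.- + n)} {w ℕ.* j} (ℤ.+-injective (begin
    + e (+ h ℤ.- + n) ℤ.+ (+ a ℤ.+ + (w ℕ.* d))
      ≡⟨ cong₂ (λ x y → x ℤ.+ (+ a ℤ.+ y)) (+e (+ h ℤ.- + n)) (trans (ℤ.pos-* w d) (cong₂ ℤ._*_ +w d≡)) ⟩
    s (+ h ℤ.- + n) ℤ.+ (+ a ℤ.+ (+ a ℤ.+ + b) ℤ.* (+ h ℤ.- + n ℤ.+ + j))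
      ≡⟨ lemma (s (+ h ℤ.- + n)) (+ a) (+ b) (+ h ℤ.- + n) (+ j) ⟩
    s (+ h ℤ.- + n) ℤ.+ + a ℤ.+ (+ a ℤ.+ + b) ℤ.* (+ h ℤ.- + n) ℤ.+ (+ a ℤ.+ + b) ℤ.* + j
      ≡⟨ cong (ℤ._+ (+ a ℤ.+ + b) ℤ.* + j) (s-suc (+ h ℤ.- + n)) ⟨
    s (+ h ℤ.- + n ℤ.+ 1ℤ) ℤ.+ (+ a ℤ.+ + b) ℤ.* + j
      ≡⟨ cong (λ k → s k ℤ.+ (+ a ℤ.+ + b) ℤ.* + j) (index (+ h) (+ n)) ⟩
    s (+ suc h ℤ.- + n) ℤ.+ (+ a ℤ.+ + b) ℤ.* + j
      ≡⟨ cong₂ ℤ._+_ (+e (+ suc h ℤ.- + n)) (trans (ℤ.pos-* w j) (cong (ℤ._* + j) +w)) ⟨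
    + e (+ suc h ℤ.- + n) ℤ.+ + (w ℕ.* j) ∎))
    where
    open ≡-Reasoning
    index : ∀ h n → h ℤ.- n ℤ.+ 1ℤ ≡ 1ℤ ℤ.+ h ℤ.- n
    index = solve-∀
    lemma : ∀ s a b k j → s ℤ.+ (a ℤ.+ (a ℤ.+ b) ℤ.* (k ℤ.+ j)) ≡ s ℤ.+ a ℤ.+ (a ℤ.+ b) ℤ.* k ℤ.+ (a ℤ.+ b) ℤ.* j
    lemma = solve-∀
    cancel : ∀ d n → d ≡ d ℤ.+ n ℤ.- n
    cancel = solve-∀
    rearrange : ∀ h j n → h ℤ.+ j ℤ.- n ≡ h ℤ.- n ℤ.+ j
    rearrange = solve-∀
    d≡ : + d ≡ + h ℤ.- + n ℤ.+ + j
    d≡ = trans (cancel (+ d) (+ n)) (trans (cong (λ z → + z ℤ.- + n) (sym eq)) (rearrange (+ h) (+ j) (+ n)))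

  factor : ℕ → ℕ → Series
  factor c i = κ 1ℤ ⊕ mono (c ℕ.+ w ℕ.* i)

  half-product : ∀ n → ∏ (factor b) n ≈ gaussSum (λ h j → mono (e (ℤ.- + j))) n
  half-product zero = begin
    κ 1ℤ              ≈⟨ solve 0 (con 1ℤ := con 1ℤ :* con 1ℤ) ≈-refl ⟩
    κ 1ℤ ⊗ mono 0     ≈⟨ ⊗-cong ≈-refl (mono-≡ (cong ℤ.∣_∣ (sym s-zero))) ⟩
    κ 1ℤ ⊗ mono (e 0ℤ) ∎
    where open Relation.Binary.Reasoning.Setoid setoid
  half-product (suc n) = ≈-trans (⊗-cong (half-product n) ≈-refl)
    (gaussSum-stepʳ n (mono (b ℕ.+ w ℕ.* n)) {λ h j → mono (e (ℤ.- + j))} {λ h j → mono (e (ℤ.- + j))} (λ _ _ _ → ≈-refl) (raiseʳ n))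

  -- The b-factors alone produce the exponents s(k) with -n ≤ k ≤ 0; each a-factor then extends the
  -- range by one on the positive side, whence k = h - n.
  full-product : ∀ n d → ∏ (factor b) n ⊗ ∏ (factor a) d ≈ gaussSum (λ h j → mono (e (+ h ℤ.- + n))) (d ℕ.+ n)
  full-product n zero = begin
    ∏ (factor b) n ⊗ κ 1ℤ
      ≈⟨ solve 1 (λ x → x :* con 1ℤ := x) ≈-refl (∏ (factor b) n) ⟩
    ∏ (factor b) n
      ≈⟨ half-product n ⟩
    gaussSum (λ h j → mono (e (ℤ.- + j))) n
      ≈⟨ antidiagonal-cong n (λ h j eq → ⊗-cong (≈-refl {gauss h j}) (mono-≡ (cong e
           (trans (index (+ h) (+ j)) (cong (λ z → + h ℤ.- + z) eq))))) ⟩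
    gaussSum (λ h j → mono (e (+ h ℤ.- + n))) n ∎
    where
    open Relation.Binary.Reasoning.Setoid setoid
    index : ∀ h j → ℤ.- j ≡ h ℤ.- (h ℤ.+ j)
    index = solve-∀
  full-product n (suc d) = begin
    ∏ (factor b) n ⊗ (∏ (factor a) d ⊗ factor a d)
      ≈⟨ solve 3 (λ x y z → x :* (y :* z) := x :* y :* z) ≈-refl (∏ (factor b) n) (∏ (factor a) d) (factor a d) ⟩
    ∏ (factor b) n ⊗ ∏ (factor a) d ⊗ factor a d
      ≈⟨ ⊗-cong (full-product n d) ≈-refl ⟩
    gaussSum (λ h j → mono (e (+ h ℤ.- + n))) (d ℕ.+ n) ⊗ factor a d
      ≈⟨ gaussSum-stepˡ (d ℕ.+ n) (mono (a ℕ.+ w ℕ.* d)) {λ h j → mono (e (+ h ℤ.- + n))} {λ h j → mono (e (+ h ℤ.- + n))} (λ _ _ _ → ≈-refl) (raiseˡ n d) ⟩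
    gaussSum (λ h j → mono (e (+ h ℤ.- + n))) (suc d ℕ.+ n) ∎
    where open Relation.Binary.Reasoning.Setoid setoid

  theta : Series
  theta = gf (integers s bound)

  private
    C : Class ℤ
    C = integers s bound

    ∣-∣-bound : ∀ h n → n ℕ.≤ ℤ.∣ + h ℤ.- + n ∣ ℕ.+ h
    ∣-∣-bound h n = ℤ.drop‿+≤+ (ℤ.≤-trans (ℤ.≤-reflexive (index (+ h) (+ n)))
        (ℤ.+-monoˡ-≤ (+ h) {ℤ.- (+ h ℤ.- + n)} {+ ℤ.∣ + h ℤ.- + n ∣}
          (ℤ.≤-trans (i≤∣i∣ (ℤ.- (+ h ℤ.- + n))) (ℤ.≤-reflexive (cong +_ (ℤ.∣-i∣≡∣i∣ (+ h ℤ.- + n)))))))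
      where
      index : ∀ h n → n ≡ ℤ.- (h ℤ.- n) ℤ.+ h
      index = solve-∀

  -- With k = h - n, the Euler factors turn the binomial into 1 below order min(h, j) = n - ∣k∣, and
  -- the monomial q^(s k) adds at least ∣k∣ to that precision.
  limit-term : ∀ n h j → h ℕ.+ j ≡ n ℕ.+ n →
    ∏ eulerFactor n ⊗ (gauss h j ⊗ mono (e (+ h ℤ.- + n))) ≈[ n ] mono (e (+ h ℤ.- + n))
  limit-term n h j eq =
    ≈[]-trans (≈⇒≈[] (solve 3 (λ x g y → x :* (g :* y) := y :* (x :* g)) ≈-refl
      (∏ eulerFactor n) (gauss h j) (mono (e (+ h ℤ.- + n)))))
    (≈[]-trans core (≈⇒≈[] (solve 1 (λ x → x :* con 1ℤ := x) ≈-refl (mono (e (+ h ℤ.- + n))))))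
    where
    core : mono (e (+ h ℤ.- + n)) ⊗ (∏ eulerFactor n ⊗ gauss h j) ≈[ n ] mono (e (+ h ℤ.- + n)) ⊗ κ 1ℤ
    core with ℕ.≤-total h n
    ... | inj₁ h≤n = weaken[] (ℕ.≤-trans (∣-∣-bound h n) (ℕ.+-monoˡ-≤ h (e-bound (+ h ℤ.- + n))))
        (mono-⊗[] (e (+ h ℤ.- + n)) (euler-gauss-≤ h≤n ℕ.≤-refl
          (ℕ.+-cancelˡ-≤ h h j (ℕ.≤-trans (ℕ.+-mono-≤ h≤n h≤n) (ℕ.≤-reflexive (sym eq))))))
    ... | inj₂ n≤h = weaken[] (ℕ.≤-trans (ℕ.≤-trans (∣-∣-bound j n)
          (ℕ.≤-reflexive (cong (ℕ._+ j) (trans (cong ℤ.∣_∣ mirror) (ℤ.∣-i∣≡∣i∣ (+ h ℤ.- + n))))))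
          (ℕ.+-monoˡ-≤ j (e-bound (+ h ℤ.- + n))))
        (mono-⊗[] (e (+ h ℤ.- + n)) (euler-gauss-≤ j≤n (ℕ.≤-trans j≤n n≤h) ℕ.≤-refl))
      where
      j≤n : j ℕ.≤ n
      j≤n = ℕ.+-cancelˡ-≤ n j n (ℕ.≤-trans (ℕ.+-monoˡ-≤ j n≤h) (ℕ.≤-reflexive eq))
      cancel : ∀ h j n → j ℤ.- n ≡ ℤ.- (h ℤ.- n) ℤ.+ (h ℤ.+ j ℤ.- (n ℤ.+ n))
      cancel = solve-∀
      zeroʳ : ∀ x y → x ℤ.+ (y ℤ.- y) ≡ x
      zeroʳ = solve-∀
      mirror : + j ℤ.- + n ≡ ℤ.- (+ h ℤ.- + n)
      mirror = trans (cancel (+ h) (+ j) (+ n)) (trans (cong (λ z → ℤ.- (+ h ℤ.- + n) ℤ.+ (+ z ℤ.- (+ n ℤ.+ + n))) eq)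
               (zeroʳ (ℤ.- (+ h ℤ.- + n)) (+ n ℤ.+ + n)))

  -- By `bound`, every k with s k < n already lies between -n and n, so the finite sum misses
  -- nothing below order n.
  theta-truncation : ∀ n → antidiagonal (λ h j → mono (e (+ h ℤ.- + n))) (n ℕ.+ n) ≈[ n ] theta
  theta-truncation n = coeffwise[] λ c c<n → mod-reflexive
    (trans (antidiagonal-mono (λ h → e (+ h ℤ.- + n)) (n ℕ.+ n) c)
      (cong +_ (trans (sym (length-map centre (hits c))) (unique-length
        (Unique.map⁺ centre-injective (Unique.filter⁺ (λ h → e (centre h) ℕ.≟ c) (Unique.upTo⁺ (suc (n ℕ.+ n)))))
        (unique C c)
        (λ z∈ → into c (∈-map⁻ centre z∈))
        (λ {z} z∈ → onto c c<n z (sound C z∈))))))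
    where
    centre : ℕ → ℤ
    centre h = + h ℤ.- + n
    hits : ℕ → List ℕ
    hits c = filter (λ h → e (centre h) ℕ.≟ c) (upTo (suc (n ℕ.+ n)))
    cancel : ∀ x y → x ≡ x ℤ.- y ℤ.+ y
    cancel = solve-∀
    cancel′ : ∀ x y → x ≡ x ℤ.+ y ℤ.- y
    cancel′ = solve-∀
    centre-injective : ∀ {x y} → centre x ≡ centre y → x ≡ y
    centre-injective {x} {y} eq = ℤ.+-injective (trans (cancel (+ x) (+ n))
      (trans (cong (ℤ._+ + n) eq) (sym (cancel (+ y) (+ n)))))
    into : ∀ c {z} → (∃ λ h → h ∈ hits c × z ≡ centre h) → z ∈ fibre C c
    into c (h , h∈ , refl) = complete C
      (trans (sym (+e (centre h))) (cong +_ (proj₂ (∈-filter⁻ (λ h → e (centre h) ℕ.≟ c) {xs = upTo (suc (n ℕ.+ n))} h∈))))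
    onto : ∀ c → c ℕ.< n → ∀ z → s z ≡ + c → z ∈ map centre (hits c)
    onto c c<n z eq = subst (_∈ map centre (hits c)) h≡
      (∈-map⁺ centre (∈-filter⁺ (λ h → e (centre h) ℕ.≟ c) (∈-upTo⁺ (s≤s h≤))
        (ℤ.+-injective (trans (+e (centre h)) (trans (cong s h≡) eq)))))
      where
      ∣z∣≤n : ℤ.∣ z ∣ ℕ.≤ n
      ∣z∣≤n = ℕ.≤-trans (ℤ.drop‿+≤+ (subst (ℤ._≤_ (+ ℤ.∣ z ∣)) eq (bound z))) (ℕ.<⇒≤ c<n)
      h : ℕ
      h = ℤ.∣ z ℤ.+ + n ∣
      h≤ : h ℕ.≤ n ℕ.+ n
      h≤ = ℕ.≤-trans (ℤ.∣i+j∣≤∣i∣+∣j∣ z (+ n)) (ℕ.+-monoˡ-≤ n ∣z∣≤n)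
      neg : ∀ z → ℤ.- (ℤ.- z) ≡ z
      neg = solve-∀
      0≤ : 0ℤ ℤ.≤ z ℤ.+ + n
      0≤ = subst (ℤ._≤ z ℤ.+ + n) (ℤ.+-inverseʳ z) (ℤ.+-monoʳ-≤ z (ℤ.≤-trans (i≤∣i∣ (ℤ.- z))
             (ℤ.≤-trans (ℤ.≤-reflexive (cong +_ (ℤ.∣-i∣≡∣i∣ z))) (ℤ.+≤+ ∣z∣≤n))))
      h≡ : centre h ≡ z
      h≡ = trans (cong (ℤ._- + n) (ℤ.0≤i⇒+∣i∣≡i 0≤)) (sym (cancel′ z (+ n)))

  triple-product : ∀ n → ∏ eulerFactor n ⊗ (∏ (factor b) n ⊗ ∏ (factor a) n) ≈[ n ] theta
  triple-product n =
    ≈[]-trans (≈⇒≈[] (≈-trans (⊗-cong ≈-refl (full-product n n))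
      (⊗-antidiagonal (n ℕ.+ n) (∏ eulerFactor n) (λ h j → gauss h j ⊗ mono (e (+ h ℤ.- + n))))))
    (≈[]-trans (antidiagonal-cong[] (n ℕ.+ n) (limit-term n)) (theta-truncation n))

-- The leading coefficient is written as 1 + b + d so that, for either sign of k, the excess over
-- ∣k∣ is a polynomial in ∣k∣ - 1 with natural coefficients.
quadratic-bound : ∀ (b c d : ℕ) k →
  + ℤ.∣ k ∣ ℤ.≤ (1ℤ ℤ.+ + b ℤ.+ + d) ℤ.* (k ℤ.* k) ℤ.+ + b ℤ.* k ℤ.+ + c
quadratic-bound b c d (+ zero) = subst (ℤ._≤_ 0ℤ) (lemma (+ b) (+ c) (+ d)) (ℤ.+≤+ z≤n)
  where
  lemma : ∀ b c d → c ≡ (1ℤ ℤ.+ b ℤ.+ d) ℤ.* (0ℤ ℤ.* 0ℤ) ℤ.+ b ℤ.* 0ℤ ℤ.+ c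
  lemma = solve-∀
quadratic-bound b c d (+ suc n) =
  subst (ℤ._≤_ (+ suc n)) eq (ℤ.i≤i+j (+ suc n) (+ (suc n ℕ.* n ℕ.+ (b ℕ.+ d) ℕ.* (suc n ℕ.* suc n) ℕ.+ b ℕ.* suc n ℕ.+ c)))
  where
  lemma : ∀ b c d n → (1ℤ ℤ.+ n) ℤ.+ ((1ℤ ℤ.+ n) ℤ.* n ℤ.+ (b ℤ.+ d) ℤ.* ((1ℤ ℤ.+ n) ℤ.* (1ℤ ℤ.+ n)) ℤ.+ b ℤ.* (1ℤ ℤ.+ n) ℤ.+ c)
        ≡ (1ℤ ℤ.+ b ℤ.+ d) ℤ.* ((1ℤ ℤ.+ n) ℤ.* (1ℤ ℤ.+ n)) ℤ.+ b ℤ.* (1ℤ ℤ.+ n) ℤ.+ c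
  lemma = solve-∀
  eq : + suc n ℤ.+ + (suc n ℕ.* n ℕ.+ (b ℕ.+ d) ℕ.* (suc n ℕ.* suc n) ℕ.+ b ℕ.* suc n ℕ.+ c)
     ≡ (1ℤ ℤ.+ + b ℤ.+ + d) ℤ.* (+ suc n ℤ.* + suc n) ℤ.+ + b ℤ.* + suc n ℤ.+ + c
  eq = trans (cong (ℤ._+_ (+ suc n)) (cong (ℤ._+ + c) (cong₂ ℤ._+_ (cong₂ ℤ._+_ (ℤ.pos-* (suc n) n)
         (trans (ℤ.pos-* (b ℕ.+ d) (suc n ℕ.* suc n)) (cong (ℤ._*_ (+ (b ℕ.+ d))) (ℤ.pos-* (suc n) (suc n)))))
         (ℤ.pos-* b (suc n)))))
       (lemma (+ b) (+ c) (+ d) (+ n))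
quadratic-bound b c d -[1+ n ] =
  subst (ℤ._≤_ (+ suc n)) eq (ℤ.i≤i+j (+ suc n) (+ (suc n ℕ.* n ℕ.+ d ℕ.* (suc n ℕ.* suc n) ℕ.+ b ℕ.* (suc n ℕ.* n) ℕ.+ c)))
  where
  lemma : ∀ b c d n → (1ℤ ℤ.+ n) ℤ.+ ((1ℤ ℤ.+ n) ℤ.* n ℤ.+ d ℤ.* ((1ℤ ℤ.+ n) ℤ.* (1ℤ ℤ.+ n)) ℤ.+ b ℤ.* ((1ℤ ℤ.+ n) ℤ.* n) ℤ.+ c)
        ≡ (1ℤ ℤ.+ b ℤ.+ d) ℤ.* (ℤ.- (1ℤ ℤ.+ n) ℤ.* ℤ.- (1ℤ ℤ.+ n)) ℤ.+ b ℤ.* ℤ.- (1ℤ ℤ.+ n) ℤ.+ c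
  lemma = solve-∀
  eq : + suc n ℤ.+ + (suc n ℕ.* n ℕ.+ d ℕ.* (suc n ℕ.* suc n) ℕ.+ b ℕ.* (suc n ℕ.* n) ℕ.+ c)
     ≡ (1ℤ ℤ.+ + b ℤ.+ + d) ℤ.* (-[1+ n ] ℤ.* -[1+ n ]) ℤ.+ + b ℤ.* -[1+ n ] ℤ.+ + c
  eq = trans (cong (ℤ._+_ (+ suc n)) (cong (ℤ._+ + c) (cong₂ ℤ._+_ (cong₂ ℤ._+_ (ℤ.pos-* (suc n) n)
         (trans (ℤ.pos-* d (suc n ℕ.* suc n)) (cong (ℤ._*_ (+ d)) (ℤ.pos-* (suc n) (suc n)))))
         (trans (ℤ.pos-* b (suc n ℕ.* n)) (cong (ℤ._*_ (+ b)) (ℤ.pos-* (suc n) n))))))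
       (lemma (+ b) (+ c) (+ d) (+ n))

-- Gauss's product formulas for φ and ψ

squareSize triangleSize : ℕ → ℤ → ℤ
squareSize s k = + suc s ℤ.* (k ℤ.* k)
triangleSize s k = + suc s ℤ.* (+ 2 ℤ.* (k ℤ.* k) ℤ.+ k)

square-bound : ∀ s k → + ℤ.∣ k ∣ ℤ.≤ squareSize s k
square-bound s k = subst (ℤ._≤_ (+ ℤ.∣ k ∣)) (lemma (+ s) k) (quadratic-bound 0 0 s k)
  where
  lemma : ∀ s k → (1ℤ ℤ.+ 0ℤ ℤ.+ s) ℤ.* (k ℤ.* k) ℤ.+ 0ℤ ℤ.* k ℤ.+ 0ℤ ≡ (1ℤ ℤ.+ s) ℤ.* (k ℤ.* k)
  lemma = solve-∀

triangle-bound : ∀ s k → + ℤ.∣ k ∣ ℤ.≤ triangleSize s k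
triangle-bound s k = subst (ℤ._≤_ (+ ℤ.∣ k ∣)) (lemma (+ s) k) (quadratic-bound (suc s) 0 s k)
  where
  lemma : ∀ s k → (1ℤ ℤ.+ (1ℤ ℤ.+ s) ℤ.+ s) ℤ.* (k ℤ.* k) ℤ.+ (1ℤ ℤ.+ s) ℤ.* k ℤ.+ 0ℤ ≡ (1ℤ ℤ.+ s) ℤ.* (+ 2 ℤ.* (k ℤ.* k) ℤ.+ k)
  lemma = solve-∀

-- Ramanujan's φ(q^(1+s)) and ψ(q^(1+s))
squares triangles : ℕ → Class ℤ
squares s = integers (squareSize s) (square-bound s)
triangles s = integers (triangleSize s) (triangle-bound s)

module GaussRatio (m s : ℕ) where
  open SeriesMod m
  open Sums m

  private
    S : ℕ
    S = suc s

    square-suc : ∀ k → squareSize s (k ℤ.+ 1ℤ) ≡ squareSize s k ℤ.+ + S ℤ.+ (+ S ℤ.+ + S) ℤ.* k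
    square-suc k = lemma (+ S) k
      where
      lemma : ∀ S k → S ℤ.* ((k ℤ.+ 1ℤ) ℤ.* (k ℤ.+ 1ℤ)) ≡ S ℤ.* (k ℤ.* k) ℤ.+ S ℤ.+ (S ℤ.+ S) ℤ.* k
      lemma = solve-∀

    triangle-suc : ∀ k → triangleSize s (k ℤ.+ 1ℤ) ≡ triangleSize s k ℤ.+ + (3 ℕ.* S) ℤ.+ (+ (3 ℕ.* S) ℤ.+ + S) ℤ.* k
    triangle-suc k = trans (lemma (+ S) k)
      (cong (λ t → triangleSize s k ℤ.+ t ℤ.+ (t ℤ.+ + S) ℤ.* k) (sym (ℤ.pos-* 3 S)))
      where
      lemma : ∀ S k → S ℤ.* (+ 2 ℤ.* ((k ℤ.+ 1ℤ) ℤ.* (k ℤ.+ 1ℤ)) ℤ.+ (k ℤ.+ 1ℤ))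
            ≡ S ℤ.* (+ 2 ℤ.* (k ℤ.* k) ℤ.+ k) ℤ.+ + 3 ℤ.* S ℤ.+ (+ 3 ℤ.* S ℤ.+ S) ℤ.* k
      lemma = solve-∀

    -- φ is the case a = b = S, and ψ the case a = 3S, b = S. The argument `v` is spelled so that a
    -- + b reduces to `suc v`.
    module Φ = TripleProduct m S S (s ℕ.+ S) refl (squareSize s) (square-bound s) (ℤ.*-zeroʳ (+ S)) square-suc
    module Ψ = TripleProduct m (3 ℕ.* S) S (s ℕ.+ (S ℕ.+ (S ℕ.+ 0)) ℕ.+ S) refl
      (triangleSize s) (triangle-bound s) (ℤ.*-zeroʳ (+ S)) triangle-suc
    module EΦ = Gaussian m (s ℕ.+ S)
    module EΨ = Gaussian m (s ℕ.+ (S ℕ.+ (S ℕ.+ 0)) ℕ.+ S)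

    Φ-product Ψ-product : ℕ → Series
    Φ-product n = ∏ EΦ.eulerFactor n ⊗ (∏ (Φ.factor S) n ⊗ ∏ (Φ.factor S) n)
    Ψ-product n = ∏ EΨ.eulerFactor n ⊗ (∏ (Ψ.factor S) n ⊗ ∏ (Ψ.factor (3 ℕ.* S)) n)

    sign-4* : ∀ n → sign (n ℕ.* 4) ≡ 1ℤ
    sign-4* zero = refl
    sign-4* (suc n) = trans (lemma (sign (n ℕ.* 4))) (sign-4* n)
      where
      lemma : ∀ x → ℤ.- (ℤ.- (ℤ.- (ℤ.- x))) ≡ x
      lemma = solve-∀

    odd-power : ∀ d → sign d ≡ ℤ.- 1ℤ → κ 1ℤ ⊕ ⊝ power S d ≈ κ 1ℤ ⊕ mono (S ℕ.* d)
    odd-power d eq = ≈-trans (⊕-cong ≈-refl (⊝-cong (⊗-cong (≗⇒≈ λ n → cong (λ z → κ z n) eq) (≈-refl {mono (S ℕ.* d)}))))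
      (solve 1 (λ x → con 1ℤ :+ :- (con (ℤ.- 1ℤ) :* x) := con 1ℤ :+ x) ≈-refl (mono (S ℕ.* d)))

    even-power : ∀ d → sign d ≡ 1ℤ → κ 1ℤ ⊕ ⊝ power S d ≈ κ 1ℤ ⊕ ⊝ mono (S ℕ.* d)
    even-power d eq = ≈-trans (⊕-cong ≈-refl (⊝-cong (⊗-cong (≗⇒≈ λ n → cong (λ z → κ z n) eq) (≈-refl {mono (S ℕ.* d)}))))
      (solve 1 (λ x → con 1ℤ :+ :- (con 1ℤ :* x) := con 1ℤ :+ :- x) ≈-refl (mono (S ℕ.* d)))

    plus : ∀ {d e} → d ≡ e → κ 1ℤ ⊕ mono d ≈ κ 1ℤ ⊕ mono e
    plus refl = ≈-refl

    minus : ∀ {d e} → d ≡ e → κ 1ℤ ⊕ ⊝ mono d ≈ κ 1ℤ ⊕ ⊝ mono e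
    minus refl = ≈-refl

    -- The modulus of φ is 2S and that of ψ is 4S, so two factors of φ face one of ψ. With A, B, C,
    -- D for the exponents 1 to 4 modulo 4, φ contributes B D (A C)², ψ contributes D A C, and the
    -- ratio is A B C.
    product-ratio : ∀ n → Φ-product (n ℕ.* 2) ≈ Ψ-product n ⊗ ∏ (gaussFactors S) n
    product-ratio zero = solve 0 (con 1ℤ :* (con 1ℤ :* con 1ℤ) := con 1ℤ :* (con 1ℤ :* con 1ℤ) :* con 1ℤ) ≈-refl
    product-ratio (suc n) = begin
      (x ⊗ EΦ.eulerFactor (n ℕ.* 2) ⊗ EΦ.eulerFactor (suc (n ℕ.* 2)))
        ⊗ ((y ⊗ Φ.factor S (n ℕ.* 2) ⊗ Φ.factor S (suc (n ℕ.* 2))) ⊗ (y ⊗ Φ.factor S (n ℕ.* 2) ⊗ Φ.factor S (suc (n ℕ.* 2))))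
        ≈⟨ ⊗-cong (⊗-cong (⊗-cong ≈-refl (minus (e₁ s n))) (minus (e₂ s n)))
             (⊗-cong (⊗-cong (⊗-cong ≈-refl (plus (e₃ s n))) (plus (e₄ s n)))
                     (⊗-cong (⊗-cong ≈-refl (plus (e₃ s n))) (plus (e₄ s n)))) ⟩
      (x ⊗ B ⊗ D) ⊗ ((y ⊗ A ⊗ C) ⊗ (y ⊗ A ⊗ C))
        ≈⟨ solve 6 (λ x y a b c d → (x :* b :* d) :* ((y :* a :* c) :* (y :* a :* c)) := x :* (y :* y) :* (d :* a :* c :* (a :* b :* c)))
             ≈-refl x y A B C D ⟩
      x ⊗ (y ⊗ y) ⊗ (D ⊗ A ⊗ C ⊗ (A ⊗ B ⊗ C))
        ≈⟨ ⊗-cong (product-ratio n) ≈-refl ⟩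
      z ⊗ (t ⊗ u) ⊗ g ⊗ (D ⊗ A ⊗ C ⊗ (A ⊗ B ⊗ C))
        ≈⟨ solve 8 (λ z t u g a b c d → z :* (t :* u) :* g :* (d :* a :* c :* (a :* b :* c))
             := (z :* d) :* ((t :* a) :* (u :* c)) :* (g :* (a :* b :* c))) ≈-refl z t u g A B C D ⟩
      (z ⊗ D) ⊗ ((t ⊗ A) ⊗ (u ⊗ C)) ⊗ (g ⊗ (A ⊗ B ⊗ C))
        ≈⟨ ⊗-cong (⊗-cong (⊗-cong ≈-refl (minus (e₅ s n)))
                    (⊗-cong (⊗-cong ≈-refl (plus (e₆ s n))) (⊗-cong ≈-refl (plus (e₇ s n)))))
             (⊗-cong ≈-refl (⊗-cong (⊗-cong (≈-sym (odd-power (1 ℕ.+ n ℕ.* 4) (cong ℤ.-_ (sign-4* n))))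
                                            (≈-sym (even-power (2 ℕ.+ n ℕ.* 4) (cong (ℤ.-_ ∘ ℤ.-_) (sign-4* n)))))
                                    (≈-sym (odd-power (3 ℕ.+ n ℕ.* 4) (cong (ℤ.-_ ∘ ℤ.-_ ∘ ℤ.-_) (sign-4* n)))))) ⟩
      Ψ-product (suc n) ⊗ ∏ (gaussFactors S) (suc n) ∎
      where
      open Relation.Binary.Reasoning.Setoid setoid
      x y z t u g A B C D : Series
      x = ∏ EΦ.eulerFactor (n ℕ.* 2)
      y = ∏ (Φ.factor S) (n ℕ.* 2)
      z = ∏ EΨ.eulerFactor n
      t = ∏ (Ψ.factor S) n
      u = ∏ (Ψ.factor (3 ℕ.* S)) n
      g = ∏ (gaussFactors S) n
      A = κ 1ℤ ⊕ mono (S ℕ.* (1 ℕ.+ n ℕ.* 4))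
      B = κ 1ℤ ⊕ ⊝ mono (S ℕ.* (2 ℕ.+ n ℕ.* 4))
      C = κ 1ℤ ⊕ mono (S ℕ.* (3 ℕ.+ n ℕ.* 4))
      D = κ 1ℤ ⊕ ⊝ mono (S ℕ.* (4 ℕ.+ n ℕ.* 4))
      e₁ : ∀ s n → suc (s ℕ.+ suc s) ℕ.* suc (n ℕ.* 2) ≡ suc s ℕ.* (2 ℕ.+ n ℕ.* 4)
      e₁ = ℕSolver.solve-∀
      e₂ : ∀ s n → suc (s ℕ.+ suc s) ℕ.* suc (suc (n ℕ.* 2)) ≡ suc s ℕ.* (4 ℕ.+ n ℕ.* 4)
      e₂ = ℕSolver.solve-∀
      e₃ : ∀ s n → suc s ℕ.+ suc (s ℕ.+ suc s) ℕ.* (n ℕ.* 2) ≡ suc s ℕ.* (1 ℕ.+ n ℕ.* 4)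
      e₃ = ℕSolver.solve-∀
      e₄ : ∀ s n → suc s ℕ.+ suc (s ℕ.+ suc s) ℕ.* suc (n ℕ.* 2) ≡ suc s ℕ.* (3 ℕ.+ n ℕ.* 4)
      e₄ = ℕSolver.solve-∀
      e₅ : ∀ s n → suc s ℕ.* (4 ℕ.+ n ℕ.* 4) ≡ suc (s ℕ.+ (suc s ℕ.+ (suc s ℕ.+ 0)) ℕ.+ suc s) ℕ.* suc n
      e₅ = ℕSolver.solve-∀
      e₆ : ∀ s n → suc s ℕ.* (1 ℕ.+ n ℕ.* 4) ≡ suc s ℕ.+ suc (s ℕ.+ (suc s ℕ.+ (suc s ℕ.+ 0)) ℕ.+ suc s) ℕ.* n
      e₆ = ℕSolver.solve-∀
      e₇ : ∀ s n → suc s ℕ.* (3 ℕ.+ n ℕ.* 4) ≡ 3 ℕ.* suc s ℕ.+ suc (s ℕ.+ (suc s ℕ.+ (suc s ℕ.+ 0)) ℕ.+ suc s) ℕ.* n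
      e₇ = ℕSolver.solve-∀

  gauss-ratio : ∀ n → gf (squares s) ≈[ n ] gf (triangles s) ⊗ ∏ (gaussFactors S) n
  gauss-ratio n =
    ≈[]-trans (weaken[] (ℕ.m≤m*n n 2) (≈[]-sym (Φ.triple-product (n ℕ.* 2))))
    (≈[]-trans (≈⇒≈[] (product-ratio n)) (⊗-cong[] (Ψ.triple-product n) ≈[]-refl))

-- RD(−q) φ(q) ψ(q⁹) = ψ(q) φ(q⁹)
module RDTheta (m : ℕ) where
  open SeriesMod m
  open Sums m
  open PartitionProduct m

  RD-theta : RD ⊗ (gf (squares 0) ⊗ gf (triangles 8)) ≈ gf (triangles 0) ⊗ gf (squares 8)
  -- The products exist only as truncations, so the coefficient at `n` is read off at precision n +
  -- 1.
  RD-theta = coeffwise λ n → (at-precision (suc n) at[] n) ℕ.≤-refl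
    where
    ψ₁ ψ₉ : Series
    ψ₁ = gf (triangles 0)
    ψ₉ = gf (triangles 8)
    at-precision : ∀ n → RD ⊗ (gf (squares 0) ⊗ ψ₉) ≈[ n ] ψ₁ ⊗ gf (squares 8)
    at-precision n =
      ≈[]-trans (⊗-cong[] ≈[]-refl (⊗-cong[] (GaussRatio.gauss-ratio m 0 n) ≈[]-refl))
      (≈[]-trans (≈⇒≈[] (solve 4 (λ r x g y → r :* (x :* g :* y) := (r :* g) :* (x :* y)) ≈-refl
                     RD ψ₁ (∏ (gaussFactors 1) n) ψ₉))
      (≈[]-trans (⊗-cong[] (weaken[] (ℕ.m≤n⇒m≤1+n (ℕ.m≤m*n n 4)) (RD-product n)) ≈[]-refl)
      (≈[]-trans (≈⇒≈[] (solve 3 (λ g x y → g :* (x :* y) := x :* (y :* g)) ≈-refl (∏ (gaussFactors 9) n) ψ₁ ψ₉))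
        (⊗-cong[] ≈[]-refl (≈[]-sym (GaussRatio.gauss-ratio m 8 n))))))

-- Lattice identities between theta functions

multiple≢1 : ∀ d → ¬ (d ∣ 1) → ∀ z → + d ℤ.* z ≢ 1ℤ
multiple≢1 d d∤1 z eq = d∤1 (ℕ.divides ℤ.∣ z ∣ (trans (sym (cong ℤ.∣_∣ eq)) (trans (ℤ.abs-* (+ d) z) (ℕ.*-comm d ℤ.∣ z ∣))))

2z≢1 : ∀ z → + 2 ℤ.* z ≢ 1ℤ
2z≢1 = multiple≢1 2 (from-no (2 ∣? 1))

3z≢1 : ∀ z → + 3 ℤ.* z ≢ 1ℤ
3z≢1 = multiple≢1 3 (from-no (3 ∣? 1))

bijection : ∀ {X Y : Set} (f : X → Y) → Injective _≡_ _≡_ f → StrictlySurjective _≡_ f → X ↔ Y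
bijection f inj surj = ⤖⇒↔ (mk⤖ (inj , strictlySurjective⇒surjective surj))

private
  difference : ∀ {x y z} c → z ≡ x ℤ.- y ℤ.+ c → x ≡ y → z ≡ c
  difference {x} c eq refl = trans eq (trans (cong (ℤ._+ c) (ℤ.+-inverseʳ x)) (ℤ.+-identityˡ c))

-- Odd numbers are written -2k - 1 because b² + b is invariant under b ↦ -1 - b, so both halves get
-- the same size. In `thirds` the signs make the squares in the two nonzero classes agree.
halves : ℤ ⊎ ℤ → ℤ
halves (inj₁ k) = + 2 ℤ.* k
halves (inj₂ k) = ℤ.- (+ 2 ℤ.* k) ℤ.- 1ℤ

halves-↔ : (ℤ ⊎ ℤ) ↔ ℤ
halves-↔ = bijection halves injective surjective
  where
  l₁ : ∀ x y → + 2 ℤ.* (x ℤ.+ y ℤ.+ 1ℤ) ≡ + 2 ℤ.* x ℤ.- (ℤ.- (+ 2 ℤ.* y) ℤ.- 1ℤ) ℤ.+ 1ℤ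
  l₁ = solve-∀
  l₂ : ∀ x → + 2 ℤ.* x ≡ ℤ.- (ℤ.- (+ 2 ℤ.* x) ℤ.- 1ℤ) ℤ.- 1ℤ
  l₂ = solve-∀
  injective : Injective _≡_ _≡_ halves
  injective {inj₁ x} {inj₁ y} eq = cong inj₁ (ℤ.*-cancelˡ-≡ (+ 2) x y eq)
  injective {inj₁ x} {inj₂ y} eq = ⊥-elim (2z≢1 _ (difference 1ℤ (l₁ x y) eq))
  injective {inj₂ x} {inj₁ y} eq = ⊥-elim (2z≢1 _ (difference 1ℤ (l₁ y x) (sym eq)))
  injective {inj₂ x} {inj₂ y} eq = cong inj₂ (ℤ.*-cancelˡ-≡ (+ 2) x y
    (trans (l₂ x) (trans (cong (λ z → ℤ.- z ℤ.- 1ℤ) eq) (sym (l₂ y)))))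
  surjective : StrictlySurjective _≡_ halves
  surjective k with k %ℕ 2 | k /ℕ 2 | a≡a%ℕn+[a/ℕn]*n k 2 | n%ℕd<d k 2
  ... | 0 | q | eq | _ = inj₁ q , trans (lemma q) (sym eq)
    where
    lemma : ∀ q → + 2 ℤ.* q ≡ 0ℤ ℤ.+ q ℤ.* + 2
    lemma = solve-∀
  ... | 1 | q | eq | _ = inj₂ (ℤ.- q ℤ.- 1ℤ) , trans (lemma q) (sym eq)
    where
    lemma : ∀ q → ℤ.- (+ 2 ℤ.* (ℤ.- q ℤ.- 1ℤ)) ℤ.- 1ℤ ≡ 1ℤ ℤ.+ q ℤ.* + 2
    lemma = solve-∀
  ... | suc (suc _) | _ | _ | s≤s (s≤s ())

thirds : ℤ ⊎ (ℤ ⊎ ℤ) → ℤ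
thirds (inj₁ k) = + 3 ℤ.* k
thirds (inj₂ (inj₁ k)) = + 3 ℤ.* k ℤ.+ 1ℤ
thirds (inj₂ (inj₂ k)) = ℤ.- (+ 3 ℤ.* k) ℤ.- 1ℤ

thirds-↔ : (ℤ ⊎ (ℤ ⊎ ℤ)) ↔ ℤ
thirds-↔ = bijection thirds injective surjective
  where
  l₀₁ : ∀ x y → + 3 ℤ.* (x ℤ.- y) ≡ + 3 ℤ.* x ℤ.- (+ 3 ℤ.* y ℤ.+ 1ℤ) ℤ.+ 1ℤ
  l₀₁ = solve-∀
  l₀₂ : ∀ x y → + 3 ℤ.* (ℤ.- x ℤ.- y) ≡ (ℤ.- (+ 3 ℤ.* y) ℤ.- 1ℤ) ℤ.- + 3 ℤ.* x ℤ.+ 1ℤ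
  l₀₂ = solve-∀
  l₁₂ : ∀ x y → + 3 ℤ.* (x ℤ.+ y ℤ.+ 1ℤ) ≡ (+ 3 ℤ.* x ℤ.+ 1ℤ) ℤ.- (ℤ.- (+ 3 ℤ.* y) ℤ.- 1ℤ) ℤ.+ 1ℤ
  l₁₂ = solve-∀
  l₁ : ∀ x → + 3 ℤ.* x ≡ + 3 ℤ.* x ℤ.+ 1ℤ ℤ.- 1ℤ
  l₁ = solve-∀
  l₂ : ∀ x → + 3 ℤ.* x ≡ ℤ.- (ℤ.- (+ 3 ℤ.* x) ℤ.- 1ℤ) ℤ.- 1ℤ
  l₂ = solve-∀
  injective : Injective _≡_ _≡_ thirds
  injective {inj₁ x} {inj₁ y} eq = cong inj₁ (ℤ.*-cancelˡ-≡ (+ 3) x y eq)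
  injective {inj₁ x} {inj₂ (inj₁ y)} eq = ⊥-elim (3z≢1 _ (difference 1ℤ (l₀₁ x y) eq))
  injective {inj₁ x} {inj₂ (inj₂ y)} eq = ⊥-elim (3z≢1 _ (difference 1ℤ (l₀₂ x y) (sym eq)))
  injective {inj₂ (inj₁ x)} {inj₁ y} eq = ⊥-elim (3z≢1 _ (difference 1ℤ (l₀₁ y x) (sym eq)))
  injective {inj₂ (inj₁ x)} {inj₂ (inj₁ y)} eq = cong (inj₂ ∘ inj₁) (ℤ.*-cancelˡ-≡ (+ 3) x y
    (trans (l₁ x) (trans (cong (λ z → z ℤ.- 1ℤ) eq) (sym (l₁ y)))))
  injective {inj₂ (inj₁ x)} {inj₂ (inj₂ y)} eq = ⊥-elim (3z≢1 _ (difference 1ℤ (l₁₂ x y) eq))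
  injective {inj₂ (inj₂ x)} {inj₁ y} eq = ⊥-elim (3z≢1 _ (difference 1ℤ (l₀₂ y x) eq))
  injective {inj₂ (inj₂ x)} {inj₂ (inj₁ y)} eq = ⊥-elim (3z≢1 _ (difference 1ℤ (l₁₂ y x) (sym eq)))
  injective {inj₂ (inj₂ x)} {inj₂ (inj₂ y)} eq = cong (inj₂ ∘ inj₂) (ℤ.*-cancelˡ-≡ (+ 3) x y
    (trans (l₂ x) (trans (cong (λ z → ℤ.- z ℤ.- 1ℤ) eq) (sym (l₂ y)))))
  surjective : StrictlySurjective _≡_ thirds
  surjective k with k %ℕ 3 | k /ℕ 3 | a≡a%ℕn+[a/ℕn]*n k 3 | n%ℕd<d k 3
  ... | 0 | q | eq | _ = inj₁ q , trans (lemma q) (sym eq)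
    where
    lemma : ∀ q → + 3 ℤ.* q ≡ 0ℤ ℤ.+ q ℤ.* + 3
    lemma = solve-∀
  ... | 1 | q | eq | _ = inj₂ (inj₁ q) , trans (lemma q) (sym eq)
    where
    lemma : ∀ q → + 3 ℤ.* q ℤ.+ 1ℤ ≡ 1ℤ ℤ.+ q ℤ.* + 3
    lemma = solve-∀
  ... | 2 | q | eq | _ = inj₂ (inj₂ (ℤ.- q ℤ.- 1ℤ)) , trans (lemma q) (sym eq)
    where
    lemma : ∀ q → ℤ.- (+ 3 ℤ.* (ℤ.- q ℤ.- 1ℤ)) ℤ.- 1ℤ ≡ + 2 ℤ.+ q ℤ.* + 3
    lemma = solve-∀
  ... | suc (suc (suc _)) | _ | _ | s≤s (s≤s (s≤s ()))

ℤ² : Set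
ℤ² = ℤ × ℤ

halves²-↔ : (ℤ² ⊎ ℤ²) ↔ ℤ²
halves²-↔ = ↔-trans (↔-sym ×-distribʳ-⊎) (halves-↔ ×-↔ ↔-refl)

thirds²-↔ : (ℤ² ⊎ (ℤ² ⊎ ℤ²)) ↔ ℤ²
thirds²-↔ = ↔-trans (↔-trans (↔-refl ⊎-↔ ↔-sym ×-distribʳ-⊎) (↔-sym ×-distribʳ-⊎)) (thirds-↔ ×-↔ ↔-refl)

omegaSize : ℤ → ℤ
omegaSize k = + 3 ℤ.* (k ℤ.* k) ℤ.+ + 2 ℤ.* k

-- The series Ω of the 3-dissection φ(q) = φ(q⁹) + 2 q Ω(q³)
omega : Class ℤ
omega = integers omegaSize λ k → subst (ℤ._≤_ (+ ℤ.∣ k ∣)) (lemma k) (quadratic-bound 2 0 0 k)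
  where
  lemma : ∀ k → (1ℤ ℤ.+ + 2 ℤ.+ 0ℤ) ℤ.* (k ℤ.* k) ℤ.+ + 2 ℤ.* k ℤ.+ 0ℤ ≡ + 3 ℤ.* (k ℤ.* k) ℤ.+ + 2 ℤ.* k
  lemma = solve-∀

-- The two halves of the series P of the 3-dissection ψ(q) = P(q³) + q ψ(q⁹)
pSize₁ pSize₂ : ℤ → ℤ
pSize₁ k = + 6 ℤ.* (k ℤ.* k) ℤ.+ k
pSize₂ k = + 6 ℤ.* (k ℤ.* k) ℤ.+ + 5 ℤ.* k ℤ.+ 1ℤ

P₁ P₂ : Class ℤ
P₁ = integers pSize₁ λ k → subst (ℤ._≤_ (+ ℤ.∣ k ∣)) (lemma k) (quadratic-bound 1 0 4 k)
  where
  lemma : ∀ k → (1ℤ ℤ.+ 1ℤ ℤ.+ + 4) ℤ.* (k ℤ.* k) ℤ.+ 1ℤ ℤ.* k ℤ.+ 0ℤ ≡ + 6 ℤ.* (k ℤ.* k) ℤ.+ k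
  lemma = solve-∀
P₂ = integers pSize₂ λ k → quadratic-bound 5 1 0 k

φ-dissection : gf (squares 0) ≗ gf (cubedᶜ (squares 2) ⊎ᶜ shiftᶜ (cubedᶜ omega) ⊎ᶜ shiftᶜ (cubedᶜ omega))
φ-dissection n = sym (gf-↔ (cubedᶜ (squares 2) ⊎ᶜ shiftᶜ (cubedᶜ omega) ⊎ᶜ shiftᶜ (cubedᶜ omega)) (squares 0) thirds-↔
  (λ { (inj₁ k) → l₀ k ; (inj₂ (inj₁ k)) → l₁ k ; (inj₂ (inj₂ k)) → l₂ k }) n)
  where
  l₀ : ∀ k → 1ℤ ℤ.* ((+ 3 ℤ.* k) ℤ.* (+ 3 ℤ.* k)) ≡ + 3 ℤ.* (+ 3 ℤ.* (k ℤ.* k))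
  l₀ = solve-∀
  l₁ : ∀ k → 1ℤ ℤ.* ((+ 3 ℤ.* k ℤ.+ 1ℤ) ℤ.* (+ 3 ℤ.* k ℤ.+ 1ℤ)) ≡ 1ℤ ℤ.+ + 3 ℤ.* (+ 3 ℤ.* (k ℤ.* k) ℤ.+ + 2 ℤ.* k)
  l₁ = solve-∀
  l₂ : ∀ k → 1ℤ ℤ.* ((ℤ.- (+ 3 ℤ.* k) ℤ.- 1ℤ) ℤ.* (ℤ.- (+ 3 ℤ.* k) ℤ.- 1ℤ)) ≡ 1ℤ ℤ.+ + 3 ℤ.* (+ 3 ℤ.* (k ℤ.* k) ℤ.+ + 2 ℤ.* k)
  l₂ = solve-∀

ψ-dissection : gf (triangles 0) ≗ gf (cubedᶜ P₁ ⊎ᶜ cubedᶜ P₂ ⊎ᶜ shiftᶜ (cubedᶜ (triangles 2)))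
ψ-dissection n = sym (gf-↔ (cubedᶜ P₁ ⊎ᶜ cubedᶜ P₂ ⊎ᶜ shiftᶜ (cubedᶜ (triangles 2))) (triangles 0) thirds-↔
  (λ { (inj₁ k) → l₀ k ; (inj₂ (inj₁ k)) → l₁ k ; (inj₂ (inj₂ k)) → l₂ k }) n)
  where
  l₀ : ∀ k → 1ℤ ℤ.* (+ 2 ℤ.* ((+ 3 ℤ.* k) ℤ.* (+ 3 ℤ.* k)) ℤ.+ + 3 ℤ.* k) ≡ + 3 ℤ.* (+ 6 ℤ.* (k ℤ.* k) ℤ.+ k)
  l₀ = solve-∀
  l₁ : ∀ k → 1ℤ ℤ.* (+ 2 ℤ.* ((+ 3 ℤ.* k ℤ.+ 1ℤ) ℤ.* (+ 3 ℤ.* k ℤ.+ 1ℤ)) ℤ.+ (+ 3 ℤ.* k ℤ.+ 1ℤ))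
     ≡ + 3 ℤ.* (+ 6 ℤ.* (k ℤ.* k) ℤ.+ + 5 ℤ.* k ℤ.+ 1ℤ)
  l₁ = solve-∀
  l₂ : ∀ k → 1ℤ ℤ.* (+ 2 ℤ.* ((ℤ.- (+ 3 ℤ.* k) ℤ.- 1ℤ) ℤ.* (ℤ.- (+ 3 ℤ.* k) ℤ.- 1ℤ)) ℤ.+ (ℤ.- (+ 3 ℤ.* k) ℤ.- 1ℤ))
     ≡ 1ℤ ℤ.+ + 3 ℤ.* (+ 3 ℤ.* (+ 2 ℤ.* (k ℤ.* k) ℤ.+ k))
  l₂ = solve-∀

squares-cubed : ∀ s → gf (squares (2 ℕ.+ 3 ℕ.* s)) ≗ cubed (gf (squares s))
squares-cubed s n = trans (gf-↔ (squares (2 ℕ.+ 3 ℕ.* s)) (cubedᶜ (squares s)) ↔-refl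
  (λ k → trans (lemma (+ s) k) (cong (λ t → (+ 3 ℤ.+ t) ℤ.* (k ℤ.* k)) (sym (ℤ.pos-* 3 s)))) n) (gf-cubed (squares s) n)
  where
  lemma : ∀ s k → + 3 ℤ.* ((1ℤ ℤ.+ s) ℤ.* (k ℤ.* k)) ≡ (+ 3 ℤ.+ + 3 ℤ.* s) ℤ.* (k ℤ.* k)
  lemma = solve-∀

triangles-cubed : ∀ s → gf (triangles (2 ℕ.+ 3 ℕ.* s)) ≗ cubed (gf (triangles s))
triangles-cubed s n = trans (gf-↔ (triangles (2 ℕ.+ 3 ℕ.* s)) (cubedᶜ (triangles s)) ↔-refl
  (λ k → trans (lemma (+ s) (+ 2 ℤ.* (k ℤ.* k) ℤ.+ k)) (cong (λ t → (+ 3 ℤ.+ t) ℤ.* (+ 2 ℤ.* (k ℤ.* k) ℤ.+ k)) (sym (ℤ.pos-* 3 s)))) n)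
  (gf-cubed (triangles s) n)
  where
  lemma : ∀ s k → + 3 ℤ.* ((1ℤ ℤ.+ s) ℤ.* k) ≡ (+ 3 ℤ.+ + 3 ℤ.* s) ℤ.* k
  lemma = solve-∀

-- 2 ψ(q) ψ(q²) = ψ(q³) φ(q³) + P Ω: sort X² + 2Y² = 8n + 3 (X, Y odd) by whether 3 divides
-- X − Y and divide X + Y√−2 by a prime above 3.
ψψ₂ : gf (triangles 0 ×ᶜ (triangles 1 ⊎ᶜ triangles 1))
    ≗ gf ((triangles 2 ×ᶜ squares 2) ⊎ᶜ (P₂ ×ᶜ omega) ⊎ᶜ (P₁ ×ᶜ omega))
ψψ₂ = cospan (triangles 0 ×ᶜ (triangles 1 ⊎ᶜ triangles 1)) ((triangles 2 ×ᶜ squares 2) ⊎ᶜ (P₂ ×ᶜ omega) ⊎ᶜ (P₁ ×ᶜ omega))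
  -- As 2 ψ(q²) is the sum of q^(b² + b) over all integers b, the left side is one sum over (x, b).
  -- The right side sorts these pairs by x + b modulo 3.
  (↔-refl ×-↔ halves-↔) (↔-trans (u₀ ⊎-↔ (u₁ ⊎-↔ u₂)) (↔-trans thirds²-↔ shear))
  (λ (x , b) → 1ℤ ℤ.* (+ 2 ℤ.* (x ℤ.* x) ℤ.+ x) ℤ.+ (b ℤ.* b ℤ.+ b))
  (λ { (x , inj₁ k) → l₀ x k ; (x , inj₂ k) → l₁ x k })
  (λ { (inj₁ (d , x)) → m₀ d x ; (inj₂ (inj₁ (k , l))) → m₁ k l ; (inj₂ (inj₂ (k , l))) → m₂ k l })
  where
  shear : ℤ² ↔ ℤ²
  shear = mk↔ₛ′ (λ (c , b) → c ℤ.- b , b) (λ (x , b) → x ℤ.+ b , b)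
    (λ (x , b) → cong (_, b) (i x b)) (λ (c , b) → cong (_, b) (j c b))
    where
    i : ∀ x b → x ℤ.+ b ℤ.- b ≡ x
    i = solve-∀
    j : ∀ c b → c ℤ.- b ℤ.+ b ≡ c
    j = solve-∀
  -- Unimodular affine substitutions that split the size, on each residue class, into two forms of
  -- one variable.
  u₀ u₁ u₂ : ℤ² ↔ ℤ²
  u₀ = mk↔ₛ′ (λ (d , x) → d , x ℤ.+ + 2 ℤ.* d) (λ (d , b) → d , b ℤ.- + 2 ℤ.* d)
    (λ (d , b) → cong (d ,_) (i d b)) (λ (d , x) → cong (d ,_) (j d x))
    where
    i : ∀ d b → b ℤ.- + 2 ℤ.* d ℤ.+ + 2 ℤ.* d ≡ b
    i = solve-∀
    j : ∀ d x → x ℤ.+ + 2 ℤ.* d ℤ.- + 2 ℤ.* d ≡ x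
    j = solve-∀
  u₁ = mk↔ₛ′ (λ (k , l) → ℤ.- k ℤ.- 1ℤ , l ℤ.- + 2 ℤ.* k ℤ.- 1ℤ)
             (λ (d , b) → ℤ.- d ℤ.- 1ℤ , b ℤ.- + 2 ℤ.* d ℤ.- 1ℤ)
    (λ (d , b) → cong₂ _,_ (i d) (j d b)) (λ (k , l) → cong₂ _,_ (i k) (j k l))
    where
    i : ∀ k → ℤ.- (ℤ.- k ℤ.- 1ℤ) ℤ.- 1ℤ ≡ k
    i = solve-∀
    j : ∀ k l → l ℤ.- + 2 ℤ.* k ℤ.- 1ℤ ℤ.- + 2 ℤ.* (ℤ.- k ℤ.- 1ℤ) ℤ.- 1ℤ ≡ l
    j = solve-∀
  u₂ = mk↔ₛ′ (λ (k , l) → k , ℤ.- l ℤ.- + 2 ℤ.* k ℤ.- 1ℤ) (λ (k , l) → k , ℤ.- l ℤ.- + 2 ℤ.* k ℤ.- 1ℤ)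
    (λ (k , l) → cong (k ,_) (i k l)) (λ (k , l) → cong (k ,_) (i k l))
    where
    i : ∀ k l → ℤ.- (ℤ.- l ℤ.- + 2 ℤ.* k ℤ.- 1ℤ) ℤ.- + 2 ℤ.* k ℤ.- 1ℤ ≡ l
    i = solve-∀
  l₀ : ∀ x k → 1ℤ ℤ.* (+ 2 ℤ.* (x ℤ.* x) ℤ.+ x) ℤ.+ ((+ 2 ℤ.* k) ℤ.* (+ 2 ℤ.* k) ℤ.+ + 2 ℤ.* k)
     ≡ 1ℤ ℤ.* (+ 2 ℤ.* (x ℤ.* x) ℤ.+ x) ℤ.+ + 2 ℤ.* (+ 2 ℤ.* (k ℤ.* k) ℤ.+ k)
  l₀ = solve-∀
  l₁ : ∀ x k → 1ℤ ℤ.* (+ 2 ℤ.* (x ℤ.* x) ℤ.+ x)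
         ℤ.+ ((ℤ.- (+ 2 ℤ.* k) ℤ.- 1ℤ) ℤ.* (ℤ.- (+ 2 ℤ.* k) ℤ.- 1ℤ) ℤ.+ (ℤ.- (+ 2 ℤ.* k) ℤ.- 1ℤ))
     ≡ 1ℤ ℤ.* (+ 2 ℤ.* (x ℤ.* x) ℤ.+ x) ℤ.+ + 2 ℤ.* (+ 2 ℤ.* (k ℤ.* k) ℤ.+ k)
  l₁ = solve-∀
  m₀ : ∀ d x → let b = x ℤ.+ + 2 ℤ.* d ; y = + 3 ℤ.* d ℤ.- b in
       1ℤ ℤ.* (+ 2 ℤ.* (y ℤ.* y) ℤ.+ y) ℤ.+ (b ℤ.* b ℤ.+ b)
     ≡ + 3 ℤ.* (+ 2 ℤ.* (d ℤ.* d) ℤ.+ d) ℤ.+ + 3 ℤ.* (x ℤ.* x)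
  m₀ = solve-∀
  m₁ : ∀ k l → let b = l ℤ.- + 2 ℤ.* k ℤ.- 1ℤ ; y = + 3 ℤ.* (ℤ.- k ℤ.- 1ℤ) ℤ.+ 1ℤ ℤ.- b in
       1ℤ ℤ.* (+ 2 ℤ.* (y ℤ.* y) ℤ.+ y) ℤ.+ (b ℤ.* b ℤ.+ b)
     ≡ + 6 ℤ.* (k ℤ.* k) ℤ.+ + 5 ℤ.* k ℤ.+ 1ℤ ℤ.+ (+ 3 ℤ.* (l ℤ.* l) ℤ.+ + 2 ℤ.* l)
  m₁ = solve-∀
  m₂ : ∀ k l → let b = ℤ.- l ℤ.- + 2 ℤ.* k ℤ.- 1ℤ ; y = ℤ.- (+ 3 ℤ.* k) ℤ.- 1ℤ ℤ.- b in
       1ℤ ℤ.* (+ 2 ℤ.* (y ℤ.* y) ℤ.+ y) ℤ.+ (b ℤ.* b ℤ.+ b)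
     ≡ + 6 ℤ.* (k ℤ.* k) ℤ.+ k ℤ.+ (+ 3 ℤ.* (l ℤ.* l) ℤ.+ + 2 ℤ.* l)
  m₂ = solve-∀

-- φ(q) ψ(q²) = ψ(q)²
φψ₂ : gf (squares 0 ×ᶜ triangles 1) ≗ gf (triangles 0 ×ᶜ triangles 0)
φψ₂ = span (squares 0 ×ᶜ triangles 1) (triangles 0 ×ᶜ triangles 0)
  -- For u = x - n and v = x + n the size of a pair of triangles is u² + v² + v, with u and v of
  -- equal parity. Both v = 2k and v = -2k - 1 give v² + v = 2(2k² + k).
  halves²-↔ (↔-trans (v₁ ⊎-↔ v₂) (↔-trans halves²-↔ shear))
  (λ { (inj₁ (d , k)) → l₁ d k ; (inj₂ (d , k)) → l₂ d k })
  where
  shear : ℤ² ↔ ℤ²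
  shear = mk↔ₛ′ (λ (x , n) → n ℤ.+ x , n) (λ (x , n) → x ℤ.- n , n)
    (λ (x , n) → cong (_, n) (i x n)) (λ (x , n) → cong (_, n) (j x n))
    where
    i : ∀ x n → n ℤ.+ (x ℤ.- n) ≡ x
    i = solve-∀
    j : ∀ x n → n ℤ.+ x ℤ.- n ≡ x
    j = solve-∀
  v₁ v₂ : ℤ² ↔ ℤ²
  v₁ = mk↔ₛ′ (λ (d , k) → d , k ℤ.- d) (λ (d , n) → d , n ℤ.+ d)
    (λ (d , n) → cong (d ,_) (i d n)) (λ (d , k) → cong (d ,_) (j d k))
    where
    i : ∀ d n → n ℤ.+ d ℤ.- d ≡ n
    i = solve-∀
    j : ∀ d k → k ℤ.- d ℤ.+ d ≡ k
    j = solve-∀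
  v₂ = mk↔ₛ′ (λ (d , k) → d , d ℤ.- k) (λ (d , n) → d , d ℤ.- n)
    (λ (d , n) → cong (d ,_) (i d n)) (λ (d , k) → cong (d ,_) (i d k))
    where
    i : ∀ d n → d ℤ.- (d ℤ.- n) ≡ n
    i = solve-∀
  l₁ : ∀ d k → let n = k ℤ.- d ; x = n ℤ.+ + 2 ℤ.* d in
       1ℤ ℤ.* (+ 2 ℤ.* (x ℤ.* x) ℤ.+ x) ℤ.+ 1ℤ ℤ.* (+ 2 ℤ.* (n ℤ.* n) ℤ.+ n)
     ≡ 1ℤ ℤ.* ((+ 2 ℤ.* d) ℤ.* (+ 2 ℤ.* d)) ℤ.+ + 2 ℤ.* (+ 2 ℤ.* (k ℤ.* k) ℤ.+ k)
  l₁ = solve-∀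
  l₂ : ∀ d k → let n = d ℤ.- k ; x = n ℤ.+ (ℤ.- (+ 2 ℤ.* d) ℤ.- 1ℤ) in
       1ℤ ℤ.* (+ 2 ℤ.* (x ℤ.* x) ℤ.+ x) ℤ.+ 1ℤ ℤ.* (+ 2 ℤ.* (n ℤ.* n) ℤ.+ n)
     ≡ 1ℤ ℤ.* ((ℤ.- (+ 2 ℤ.* d) ℤ.- 1ℤ) ℤ.* (ℤ.- (+ 2 ℤ.* d) ℤ.- 1ℤ)) ℤ.+ + 2 ℤ.* (+ 2 ℤ.* (k ℤ.* k) ℤ.+ k)
  l₂ = solve-∀

-- An odd exponent x² + 3m² + 2m has x and m of opposite parity; there it is 1 + 4(m² − md + d² + d),
-- a form with a rotation of order 3 that has no lattice fixed point.
φΩ-odd : ∀ j → ∃ λ t → gf (squares 0 ×ᶜ omega) (1 ℕ.+ 2 ℕ.* j) ≡ + 3 ℤ.* t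
φΩ-odd j = gf E₀ n , (begin
  gf C n
    ≡⟨ gf-pullback C by-parity n ⟩
  gf (pullback C by-parity) n
    ≡⟨ gf-left-right (pullback C by-parity) n ⟩
  gf (leftᶜ (pullback C by-parity)) n ℤ.+ gf E n
    ≡⟨ cong₂ ℤ._+_ (empty-fibre (leftᶜ (pullback C by-parity)) n even) (gf-pullback E by-residue n) ⟩
  0ℤ ℤ.+ gf E′ n
    ≡⟨ trans (ℤ.+-identityˡ (gf E′ n)) (gf-left-right E′ n) ⟩
  gf E₀ n ℤ.+ gf (rightᶜ E′) n
    ≡⟨ cong (ℤ._+_ (gf E₀ n)) (trans (gf-left-right (rightᶜ E′) n)
         (cong₂ ℤ._+_ (gf-↔ E₁ E₀ ρ₁ (λ (e , d) → r₁ e d) n) (gf-↔ E₂ E₀ ρ₂ (λ (e , d) → r₂ e d) n))) ⟩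
  gf E₀ n ℤ.+ (gf E₀ n ℤ.+ gf E₀ n)
    ≡⟨ thrice (gf E₀ n) ⟩
  + 3 ℤ.* gf E₀ n ∎)
  where
  open ≡-Reasoning
  n : ℕ
  n = 1 ℕ.+ 2 ℕ.* j
  C : Class ℤ²
  C = squares 0 ×ᶜ omega
  thrice : ∀ x → x ℤ.+ (x ℤ.+ x) ≡ + 3 ℤ.* x
  thrice = solve-∀
  shear : ℤ² ↔ ℤ²
  shear = mk↔ₛ′ (λ (c , m) → c ℤ.+ m , m) (λ (x , m) → x ℤ.- m , m)
    (λ (x , m) → cong (_, m) (p x m)) (λ (c , m) → cong (_, m) (q c m))
    where
    p : ∀ x m → x ℤ.- m ℤ.+ m ≡ x
    p = solve-∀
    q : ∀ c m → c ℤ.+ m ℤ.- m ≡ c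
    q = solve-∀
  by-parity : (ℤ² ⊎ ℤ²) ↔ ℤ²
  by-parity = ↔-trans halves²-↔ shear
  even : ∀ z → size (leftᶜ (pullback C by-parity)) z ≢ + n
  even (d , m) eq = 2z≢1 (+ 2 ℤ.* (m ℤ.* m) ℤ.+ + 2 ℤ.* (m ℤ.* d) ℤ.+ + 2 ℤ.* (d ℤ.* d) ℤ.+ m ℤ.- + j)
    (trans (lemma d m (+ j)) (trans (cong (ℤ._- + 2 ℤ.* + j) eq)
      (trans (cong (λ t → 1ℤ ℤ.+ t ℤ.- + 2 ℤ.* + j) (ℤ.pos-* 2 j)) (cancel (+ 2 ℤ.* + j)))))
    where
    lemma : ∀ d m j → + 2 ℤ.* (+ 2 ℤ.* (m ℤ.* m) ℤ.+ + 2 ℤ.* (m ℤ.* d) ℤ.+ + 2 ℤ.* (d ℤ.* d) ℤ.+ m ℤ.- j)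
          ≡ 1ℤ ℤ.* ((+ 2 ℤ.* d ℤ.+ m) ℤ.* (+ 2 ℤ.* d ℤ.+ m)) ℤ.+ (+ 3 ℤ.* (m ℤ.* m) ℤ.+ + 2 ℤ.* m) ℤ.- + 2 ℤ.* j
    lemma = solve-∀
    cancel : ∀ t → 1ℤ ℤ.+ t ℤ.- t ≡ 1ℤ
    cancel = solve-∀
  E : Class ℤ²
  E = rightᶜ (pullback C by-parity)
  shear′ : ℤ² ↔ ℤ²
  shear′ = mk↔ₛ′ (λ (c , d) → d , c ℤ.- d) (λ (d , m) → m ℤ.+ d , d)
    (λ (d , m) → cong (d ,_) (p d m)) (λ (c , d) → cong (_, d) (q c d))
    where
    p : ∀ d m → m ℤ.+ d ℤ.- d ≡ m
    p = solve-∀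
    q : ∀ c d → c ℤ.- d ℤ.+ d ≡ c
    q = solve-∀
  by-residue : (ℤ² ⊎ (ℤ² ⊎ ℤ²)) ↔ ℤ²
  by-residue = ↔-trans thirds²-↔ shear′
  E′ : Class (ℤ² ⊎ (ℤ² ⊎ ℤ²))
  E′ = pullback E by-residue
  E₀ E₁ E₂ : Class ℤ²
  E₀ = leftᶜ E′
  E₁ = leftᶜ (rightᶜ E′)
  E₂ = rightᶜ (rightᶜ E′)
  -- In the coordinates (d, m) these are (-m - 1, -d - 1) and (m - d - 1, -d - 1). Both preserve m²
  -- - md + d² + d and carry the classes m + d ≡ 1 and m + d ≡ 2 modulo 3 to the class 0, so the
  -- three classes are equinumerous.
  ρ₁ ρ₂ : ℤ² ↔ ℤ²
  ρ₁ = mk↔ₛ′ (λ (e , d) → ℤ.- e ℤ.- 1ℤ , d ℤ.- + 3 ℤ.* e ℤ.- + 2) (λ (e , d) → ℤ.- e ℤ.- 1ℤ , d ℤ.- + 3 ℤ.* e ℤ.- 1ℤ)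
    (λ (e , d) → cong₂ _,_ (p e) (q e d)) (λ (e , d) → cong₂ _,_ (p e) (r e d))
    where
    p : ∀ e → ℤ.- (ℤ.- e ℤ.- 1ℤ) ℤ.- 1ℤ ≡ e
    p = solve-∀
    q : ∀ e d → d ℤ.- + 3 ℤ.* e ℤ.- 1ℤ ℤ.- + 3 ℤ.* (ℤ.- e ℤ.- 1ℤ) ℤ.- + 2 ≡ d
    q = solve-∀
    r : ∀ e d → d ℤ.- + 3 ℤ.* e ℤ.- + 2 ℤ.- + 3 ℤ.* (ℤ.- e ℤ.- 1ℤ) ℤ.- 1ℤ ≡ d
    r = solve-∀
  ρ₂ = mk↔ₛ′ (λ (e , d) → ℤ.- e ℤ.- d ℤ.- 1ℤ , ℤ.- (+ 3 ℤ.* e) ℤ.- + 2 ℤ.* d ℤ.- + 2)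
             (λ (e , d) → + 2 ℤ.* e ℤ.- d , d ℤ.- + 3 ℤ.* e ℤ.- 1ℤ)
    (λ (e , d) → cong₂ _,_ (p e d) (q e d)) (λ (e , d) → cong₂ _,_ (r e d) (t e d))
    where
    p : ∀ e d → ℤ.- (+ 2 ℤ.* e ℤ.- d) ℤ.- (d ℤ.- + 3 ℤ.* e ℤ.- 1ℤ) ℤ.- 1ℤ ≡ e
    p = solve-∀
    q : ∀ e d → ℤ.- (+ 3 ℤ.* (+ 2 ℤ.* e ℤ.- d)) ℤ.- + 2 ℤ.* (d ℤ.- + 3 ℤ.* e ℤ.- 1ℤ) ℤ.- + 2 ≡ d
    q = solve-∀
    r : ∀ e d → + 2 ℤ.* (ℤ.- e ℤ.- d ℤ.- 1ℤ) ℤ.- (ℤ.- (+ 3 ℤ.* e) ℤ.- + 2 ℤ.* d ℤ.- + 2) ≡ e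
    r = solve-∀
    t : ∀ e d → ℤ.- (+ 3 ℤ.* e) ℤ.- + 2 ℤ.* d ℤ.- + 2 ℤ.- + 3 ℤ.* (ℤ.- e ℤ.- d ℤ.- 1ℤ) ℤ.- 1ℤ ≡ d
    t = solve-∀
  -- both sides are the size of E at (d , m), resp. (d′ , m′)
  r₁ : ∀ e d →
    let e′ = ℤ.- e ℤ.- 1ℤ ; d′ = d ℤ.- + 3 ℤ.* e ℤ.- + 2
        m′ = + 3 ℤ.* e′ ℤ.- d′ ; x′ = ℤ.- (+ 2 ℤ.* d′) ℤ.- 1ℤ ℤ.+ m′
        m = + 3 ℤ.* e ℤ.+ 1ℤ ℤ.- d ; x = ℤ.- (+ 2 ℤ.* d) ℤ.- 1ℤ ℤ.+ m in
    1ℤ ℤ.* (x′ ℤ.* x′) ℤ.+ (+ 3 ℤ.* (m′ ℤ.* m′) ℤ.+ + 2 ℤ.* m′)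
      ≡ 1ℤ ℤ.* (x ℤ.* x) ℤ.+ (+ 3 ℤ.* (m ℤ.* m) ℤ.+ + 2 ℤ.* m)
  r₁ = solve-∀
  r₂ : ∀ e d →
    let e′ = ℤ.- e ℤ.- d ℤ.- 1ℤ ; d′ = ℤ.- (+ 3 ℤ.* e) ℤ.- + 2 ℤ.* d ℤ.- + 2
        m′ = + 3 ℤ.* e′ ℤ.- d′ ; x′ = ℤ.- (+ 2 ℤ.* d′) ℤ.- 1ℤ ℤ.+ m′
        m = ℤ.- (+ 3 ℤ.* e) ℤ.- 1ℤ ℤ.- d ; x = ℤ.- (+ 2 ℤ.* d) ℤ.- 1ℤ ℤ.+ m in
    1ℤ ℤ.* (x′ ℤ.* x′) ℤ.+ (+ 3 ℤ.* (m′ ℤ.* m′) ℤ.+ + 2 ℤ.* m′)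
      ≡ 1ℤ ℤ.* (x ℤ.* x) ℤ.+ (+ 3 ℤ.* (m ℤ.* m) ℤ.+ + 2 ℤ.* m)
  r₂ = solve-∀

-- A local obstruction, decidable by search. It occurs for (8, 7), (16, 9) and (32, 29): three times
-- the form plus 1 is (3r + 1)² + (3s)², which would be 6 modulo 8, 12 modulo 16 or 24 modulo 32.
Avoids : ℕ → ℕ → Set
Avoids M c = ∀ {r} → r ℕ.< M → ∀ {s} → s ℕ.< M →
  ¬ (M ∣ ℤ.∣ + (3 ℕ.* (r ℕ.* r) ℕ.+ 2 ℕ.* r ℕ.+ 3 ℕ.* (s ℕ.* s)) ℤ.- + c ∣)

Ωφ₃-vanishes : ∀ M c .{{_ : ℕ.NonZero M}} → Avoids M c → ∀ n → gf (omega ×ᶜ squares 2) (M ℕ.* n ℕ.+ c) ≡ 0ℤ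
Ωφ₃-vanishes M c avoids n = empty-fibre (omega ×ᶜ squares 2) (M ℕ.* n ℕ.+ c) λ (k , l) eq →
  avoids (n%ℕd<d k M) (n%ℕd<d l M) (divides k l eq)
  where
  divides : ∀ k l → size (omega ×ᶜ squares 2) (k , l) ≡ + (M ℕ.* n ℕ.+ c) →
    M ∣ ℤ.∣ + (3 ℕ.* (k %ℕ M ℕ.* (k %ℕ M)) ℕ.+ 2 ℕ.* (k %ℕ M) ℕ.+ 3 ℕ.* (l %ℕ M ℕ.* (l %ℕ M))) ℤ.- + c ∣
  divides k l eq with k %ℕ M | k /ℕ M | a≡a%ℕn+[a/ℕn]*n k M | l %ℕ M | l /ℕ M | a≡a%ℕn+[a/ℕn]*n l M
  ... | r | t | refl | s | u | refl = ℕ.divides ℤ.∣ z ∣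
    (trans (cong ℤ.∣_∣ (trans pos (trans (lemma (+ r) t (+ s) u (+ M) (+ n) (+ c)) (trans (cong (λ x → x ℤ.- (+ M ℤ.* + n ℤ.+ + c) ℤ.+ z ℤ.* + M) eq′)
      (cancel (+ M ℤ.* + n ℤ.+ + c) (z ℤ.* + M)))))) (ℤ.abs-* z (+ M)))
    where
    z : ℤ
    z = + n ℤ.- (+ 3 ℤ.* (+ 2 ℤ.* + r ℤ.* t ℤ.+ t ℤ.* t ℤ.* + M) ℤ.+ + 2 ℤ.* t ℤ.+ + 3 ℤ.* (+ 2 ℤ.* + s ℤ.* u ℤ.+ u ℤ.* u ℤ.* + M))
    pos : + (3 ℕ.* (r ℕ.* r) ℕ.+ 2 ℕ.* r ℕ.+ 3 ℕ.* (s ℕ.* s)) ℤ.- + c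
        ≡ + 3 ℤ.* (+ r ℤ.* + r) ℤ.+ + 2 ℤ.* + r ℤ.+ + 3 ℤ.* (+ s ℤ.* + s) ℤ.- + c
    pos = cong (ℤ._- + c) (cong₂ ℤ._+_ (cong₂ ℤ._+_
      (trans (ℤ.pos-* 3 (r ℕ.* r)) (cong (ℤ._*_ (+ 3)) (ℤ.pos-* r r))) (ℤ.pos-* 2 r))
      (trans (ℤ.pos-* 3 (s ℕ.* s)) (cong (ℤ._*_ (+ 3)) (ℤ.pos-* s s))))
    eq′ : omegaSize (+ r ℤ.+ t ℤ.* + M) ℤ.+ squareSize 2 (+ s ℤ.+ u ℤ.* + M) ≡ + M ℤ.* + n ℤ.+ + c
    eq′ = trans eq (cong (ℤ._+ + c) (ℤ.pos-* M n))
    lemma : ∀ r t s u M n c →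
      + 3 ℤ.* (r ℤ.* r) ℤ.+ + 2 ℤ.* r ℤ.+ + 3 ℤ.* (s ℤ.* s) ℤ.- c
      ≡ + 3 ℤ.* ((r ℤ.+ t ℤ.* M) ℤ.* (r ℤ.+ t ℤ.* M)) ℤ.+ + 2 ℤ.* (r ℤ.+ t ℤ.* M) ℤ.+ + 3 ℤ.* ((s ℤ.+ u ℤ.* M) ℤ.* (s ℤ.+ u ℤ.* M))
        ℤ.- (M ℤ.* n ℤ.+ c)
        ℤ.+ (n ℤ.- (+ 3 ℤ.* (+ 2 ℤ.* r ℤ.* t ℤ.+ t ℤ.* t ℤ.* M) ℤ.+ + 2 ℤ.* t ℤ.+ + 3 ℤ.* (+ 2 ℤ.* s ℤ.* u ℤ.+ u ℤ.* u ℤ.* M))) ℤ.* M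
    lemma = solve-∀
    cancel : ∀ x y → x ℤ.- x ℤ.+ y ≡ y
    cancel = solve-∀

avoids? : ∀ M c → Dec (Avoids M c)
avoids? M c = ℕ.allUpTo? (λ r → ℕ.allUpTo? (λ s →
  ¬? (M ∣? ℤ.∣ + (3 ℕ.* (r ℕ.* r) ℕ.+ 2 ℕ.* r ℕ.+ 3 ℕ.* (s ℕ.* s)) ℤ.- + c ∣)) M) M

-- The progression 3n + 2

section : ℕ → Series → Series
section r a n = a (n ℕ.* 3 ℕ.+ r)

section-shift : ∀ r a → section (suc r) (shift a) ≗ section r a
section-shift r a n = cong (shift a) (ℕ.+-suc (n ℕ.* 3) r)

section₀-shift : ∀ a → section 0 (shift a) ≗ shift (section 2 a)
section₀-shift a zero = refl
section₀-shift a (suc n) = cong a (trans (ℕ.+-comm 2 (n ℕ.* 3 ℕ.+ 0)) (cong (ℕ._+ 2) (ℕ.+-identityʳ (n ℕ.* 3))))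

cubed-⊗-3+ : ∀ b a k → (cubed b ⊗ a) (3 ℕ.+ k) ≡ b 0 ℤ.* a (3 ℕ.+ k) ℤ.+ (cubed (tail b) ⊗ a) k
cubed-⊗-3+ b a k = cong (ℤ._+_ (b 0 ℤ.* a (3 ℕ.+ k)))
  (trans (ℤ.+-identityˡ _) (ℤ.+-identityˡ _))

-- Series in q³ act as scalars on the sections, so an identity with such coefficients can be read
-- section by section.
section-⊗ : ∀ {r} → r ℕ.< 3 → ∀ b a → section r (cubed b ⊗ a) ≗ b ⊗ section r a
section-⊗ {0} _ b a zero = refl
section-⊗ {1} _ b a zero = ℤ.+-identityʳ _
section-⊗ {2} _ b a zero = ℤ.+-identityʳ _
section-⊗ {suc (suc (suc r))} (s≤s (s≤s (s≤s ()))) b a zero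
section-⊗ {r} r<3 b a (suc n) = trans (cubed-⊗-3+ b a (n ℕ.* 3 ℕ.+ r))
  (cong (ℤ._+_ (b 0 ℤ.* a (suc n ℕ.* 3 ℕ.+ r))) (section-⊗ r<3 (tail b) a n))

section₀-cubed : ∀ a → section 0 (cubed a) ≗ a
section₀-cubed a zero = refl
section₀-cubed a (suc n) = section₀-cubed (tail a) n

section₁-cubed : ∀ a → section 1 (cubed a) ≗ κ 0ℤ
section₁-cubed a n = trans (go a n) (sym (κ0 n))
  where
  go : ∀ a n → section 1 (cubed a) n ≡ 0ℤ
  go a zero = refl
  go a (suc n) = go (tail a) n

section₂-cubed : ∀ a → section 2 (cubed a) ≗ κ 0ℤ
section₂-cubed a n = trans (go a n) (sym (κ0 n))
  where
  go : ∀ a n → section 2 (cubed a) n ≡ 0ℤ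
  go a zero = refl
  go a (suc n) = go (tail a) n

φ φ₃ ψ ψ₂ ψ₃ Ω P : Series
φ = gf (squares 0)
φ₃ = gf (squares 2)
ψ = gf (triangles 0)
ψ₂ = gf (triangles 1)
ψ₃ = gf (triangles 2)
Ω = gf omega
P = gf P₁ ⊕ gf P₂

gf-⊎³ : ∀ {X Y Z : Set} (C : Class X) (D : Class Y) (E : Class Z) {x y z} →
        gf C ≗ x → gf D ≗ y → gf E ≗ z → gf (C ⊎ᶜ D ⊎ᶜ E) ≗ x ⊕ (y ⊕ z)
gf-⊎³ C D E {x} {y} {z} p q r n = begin
  gf (C ⊎ᶜ D ⊎ᶜ E) n             ≡⟨ gf-⊎ C (D ⊎ᶜ E) n ⟩
  gf C n ℤ.+ gf (D ⊎ᶜ E) n       ≡⟨ cong₂ ℤ._+_ (p n) (trans (gf-⊎ D E n) (cong₂ ℤ._+_ (q n) (r n))) ⟩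
  x n ℤ.+ (y n ℤ.+ z n)          ≡⟨ cong (ℤ._+_ (x n)) (⊕-at y z n) ⟨
  x n ℤ.+ (y ⊕ z) n              ≡⟨ ⊕-at x (y ⊕ z) n ⟨
  (x ⊕ (y ⊕ z)) n                ∎
  where open ≡-Reasoning

gf-shift-cubed : ∀ {X : Set} (C : Class X) → gf (shiftᶜ (cubedᶜ C)) ≗ shift (cubed (gf C))
gf-shift-cubed C n = trans (gf-shift (cubedᶜ C) n) (shift-cong (gf-cubed C) n)

-- The points k and -k contribute equally and only the origin is unpaired. Squaring gives φ₃² ≡ 1
-- modulo 4.
φ₃-odd-part : ∃ λ t → φ₃ ≗ κ 1ℤ ⊕ (t ⊕ t)
φ₃-odd-part = gf pos , λ n → begin
  φ₃ n
    ≡⟨ gf-pullback (squares 2) by-sign n ⟩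
  gf C n
    ≡⟨ gf-left-right C n ⟩
  gf (leftᶜ C) n ℤ.+ gf (rightᶜ C) n
    ≡⟨ cong₂ ℤ._+_ (origin n) (trans (gf-left-right (rightᶜ C) n)
         (cong (ℤ._+_ (gf pos n)) (gf-↔ (rightᶜ (rightᶜ C)) pos ↔-refl (λ _ → refl) n))) ⟩
  κ 1ℤ n ℤ.+ (gf pos n ℤ.+ gf pos n)
    ≡⟨ cong (ℤ._+_ (κ 1ℤ n)) (⊕-at (gf pos) (gf pos) n) ⟨
  κ 1ℤ n ℤ.+ (gf pos ⊕ gf pos) n
    ≡⟨ ⊕-at (κ 1ℤ) (gf pos ⊕ gf pos) n ⟨
  (κ 1ℤ ⊕ (gf pos ⊕ gf pos)) n ∎
  where
  open ≡-Reasoning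
  by-sign : (⊤ ⊎ (ℕ ⊎ ℕ)) ↔ ℤ
  by-sign = mk↔ₛ′ [ (λ _ → + 0) , [ (λ n → + suc n) , -[1+_] ] ]
    (λ { (+ zero) → inj₁ tt ; (+ suc n) → inj₂ (inj₁ n) ; -[1+ n ] → inj₂ (inj₂ n) })
    (λ { (+ zero) → refl ; (+ suc n) → refl ; -[1+ n ] → refl })
    (λ { (inj₁ tt) → refl ; (inj₂ (inj₁ n)) → refl ; (inj₂ (inj₂ n)) → refl })
  C : Class (⊤ ⊎ (ℕ ⊎ ℕ))
  C = pullback (squares 2) by-sign
  pos : Class ℕ
  pos = leftᶜ (rightᶜ C)
  origin : gf (leftᶜ C) ≗ κ 1ℤ
  origin zero = refl
  origin (suc n) = empty-fibre (leftᶜ C) (suc n) λ _ ()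

module Dissection (m : ℕ) where
  open SeriesMod m
  open Sums m

  φ≈ : φ ≈ cubed φ₃ ⊕ (shift (cubed Ω) ⊕ shift (cubed Ω))
  φ≈ = ≗⇒≈ λ n → trans (φ-dissection n)
    (gf-⊎³ (cubedᶜ (squares 2)) (shiftᶜ (cubedᶜ omega)) (shiftᶜ (cubedᶜ omega))
      (gf-cubed (squares 2)) (gf-shift-cubed omega) (gf-shift-cubed omega) n)

  ψ≈ : ψ ≈ cubed (gf P₁) ⊕ (cubed (gf P₂) ⊕ shift (cubed ψ₃))
  ψ≈ = ≗⇒≈ λ n → trans (ψ-dissection n)
    (gf-⊎³ (cubedᶜ P₁) (cubedᶜ P₂) (shiftᶜ (cubedᶜ (triangles 2)))
      (gf-cubed P₁) (gf-cubed P₂) (gf-shift-cubed (triangles 2)) n)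

  shift≈ : ∀ a → shift a ≈ mono 1 ⊗ a
  shift≈ a = ≗⇒≈ λ n → sym (trans (mono-⊗-suc 0 a n) (shift-cong (⊗-identityˡ a) n))

  shift-≈ : ∀ {a b} → a ≈ b → shift a ≈ shift b
  shift-≈ {a} {b} p = ≈-trans (shift≈ a) (≈-trans (⊗-cong (≈-refl {mono 1}) p) (≈-sym (shift≈ b)))

  section-≈ : ∀ r {a b} → a ≈ b → section r a ≈ section r b
  section-≈ r p = coeffwise λ n → p at (n ℕ.* 3 ℕ.+ r)

  section-⊕ : ∀ r a b → section r (a ⊕ b) ≈ section r a ⊕ section r b
  section-⊕ r a b = ≗⇒≈ λ n → trans (⊕-at a b (n ℕ.* 3 ℕ.+ r)) (sym (⊕-at (section r a) (section r b) n))

  -- The theta identity for R(-q) with φ dissected and φ(q⁹), ψ(q⁹) written as series in q³: now all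
  -- coefficients of R(-q) are series in q³, up to one explicit shift.
  expansion : cubed ψ₃ ⊗ (cubed φ₃ ⊗ RD ⊕ (shift (cubed Ω ⊗ RD) ⊕ shift (cubed Ω ⊗ RD))) ≈ cubed φ₃ ⊗ ψ
  expansion = begin
    cubed ψ₃ ⊗ (cubed φ₃ ⊗ RD ⊕ (shift (cubed Ω ⊗ RD) ⊕ shift (cubed Ω ⊗ RD)))
      ≈⟨ ⊗-cong ≈-refl (⊕-cong ≈-refl (⊕-cong back back)) ⟩
    cubed ψ₃ ⊗ (cubed φ₃ ⊗ RD ⊕ (shift (cubed Ω) ⊗ RD ⊕ shift (cubed Ω) ⊗ RD))
      ≈⟨ solve 4 (λ s f o r → s :* (f :* r :+ (o :* r :+ o :* r)) := r :* ((f :+ (o :+ o)) :* s)) ≈-refl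
           (cubed ψ₃) (cubed φ₃) (shift (cubed Ω)) RD ⟩
    RD ⊗ ((cubed φ₃ ⊕ (shift (cubed Ω) ⊕ shift (cubed Ω))) ⊗ cubed ψ₃)
      ≈⟨ ⊗-cong ≈-refl (⊗-cong (≈-sym φ≈) (≗⇒≈ λ n → sym (triangles-cubed 2 n))) ⟩
    RD ⊗ (φ ⊗ gf (triangles 8))
      ≈⟨ RDTheta.RD-theta m ⟩
    ψ ⊗ gf (squares 8)
      ≈⟨ solve 2 (λ x y → x :* y := y :* x) ≈-refl ψ (gf (squares 8)) ⟩
    gf (squares 8) ⊗ ψ
      ≈⟨ ⊗-cong (≗⇒≈ (squares-cubed 2)) ≈-refl ⟩
    cubed φ₃ ⊗ ψ ∎
    where
    open Relation.Binary.Reasoning.Setoid setoid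
    back : shift (cubed Ω ⊗ RD) ≈ shift (cubed Ω) ⊗ RD
    back = ≗⇒≈ λ n → sym (shift-⊗ (cubed Ω) RD n)

  f₀ f₁ f₂ : Series
  f₀ = section 0 RD
  f₁ = section 1 RD
  f₂ = section 2 RD

  section-expansion : ∀ {r} → r ℕ.< 3 → ∀ {x y} → section r (shift (cubed Ω ⊗ RD)) ≈ x → section r ψ ≈ y →
                      ψ₃ ⊗ (φ₃ ⊗ section r RD ⊕ (x ⊕ x)) ≈ φ₃ ⊗ y
  section-expansion {r} r<3 {x} {y} x≈ y≈ = begin
    ψ₃ ⊗ (φ₃ ⊗ section r RD ⊕ (x ⊕ x))
      ≈⟨ ⊗-cong ≈-refl (⊕-cong (≗⇒≈ (section-⊗ r<3 φ₃ RD)) (⊕-cong x≈ x≈)) ⟨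
    ψ₃ ⊗ (section r (cubed φ₃ ⊗ RD) ⊕ (section r S ⊕ section r S))
      ≈⟨ ⊗-cong ≈-refl (≈-trans (section-⊕ r _ _) (⊕-cong ≈-refl (section-⊕ r S S))) ⟨
    ψ₃ ⊗ section r (cubed φ₃ ⊗ RD ⊕ (S ⊕ S))
      ≈⟨ ≗⇒≈ (section-⊗ r<3 ψ₃ (cubed φ₃ ⊗ RD ⊕ (S ⊕ S))) ⟨
    section r (cubed ψ₃ ⊗ (cubed φ₃ ⊗ RD ⊕ (S ⊕ S)))
      ≈⟨ section-≈ r expansion ⟩
    section r (cubed φ₃ ⊗ ψ)
      ≈⟨ ≗⇒≈ (section-⊗ r<3 φ₃ ψ) ⟩
    φ₃ ⊗ section r ψ
      ≈⟨ ⊗-cong ≈-refl y≈ ⟩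
    φ₃ ⊗ y ∎
    where
    open Relation.Binary.Reasoning.Setoid setoid
    S : Series
    S = shift (cubed Ω ⊗ RD)

  section-ψ : ∀ r {x y z} → section r (cubed (gf P₁)) ≈ x → section r (cubed (gf P₂)) ≈ y →
              section r (shift (cubed ψ₃)) ≈ z → section r ψ ≈ x ⊕ (y ⊕ z)
  section-ψ r p q s = ≈-trans (section-≈ r ψ≈) (≈-trans (section-⊕ r _ _)
    (⊕-cong p (≈-trans (section-⊕ r _ _) (⊕-cong q s))))

  shift-0 : shift (κ 0ℤ) ≈ κ 0ℤ
  shift-0 = ≗⇒≈ λ { zero → refl ; (suc n) → κ0 n }

  -- The three equations are a linear system for the sections of R(-q); the right-hand sides carry
  -- the sections P, ψ₃ and 0 of ψ. The factor `mono 1` appears only here, where the shift wraps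
  -- around from section 2 to section 0.
  equation₀ : ψ₃ ⊗ (φ₃ ⊗ f₀ ⊕ (mono 1 ⊗ (Ω ⊗ f₂) ⊕ mono 1 ⊗ (Ω ⊗ f₂))) ≈ φ₃ ⊗ P
  equation₀ = ≈-trans (section-expansion (s≤s z≤n)
      (≈-trans (≗⇒≈ (section₀-shift (cubed Ω ⊗ RD))) (≈-trans (shift-≈ (≗⇒≈ (section-⊗ (s≤s (s≤s (s≤s z≤n))) Ω RD))) (shift≈ _)))
      (section-ψ 0 (≗⇒≈ (section₀-cubed (gf P₁))) (≗⇒≈ (section₀-cubed (gf P₂)))
        (≈-trans (≗⇒≈ (section₀-shift (cubed ψ₃))) (≈-trans (shift-≈ (≗⇒≈ (section₂-cubed ψ₃))) shift-0))))
    (solve 3 (λ f x y → f :* (x :+ (y :+ con 0ℤ)) := f :* (x :+ y)) ≈-refl φ₃ (gf P₁) (gf P₂))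

  equation₁ : ψ₃ ⊗ (φ₃ ⊗ f₁ ⊕ (Ω ⊗ f₀ ⊕ Ω ⊗ f₀)) ≈ φ₃ ⊗ ψ₃
  equation₁ = ≈-trans (section-expansion (s≤s (s≤s z≤n))
      (≈-trans (≗⇒≈ (section-shift 0 (cubed Ω ⊗ RD))) (≗⇒≈ (section-⊗ (s≤s z≤n) Ω RD)))
      (section-ψ 1 (≗⇒≈ (section₁-cubed (gf P₁))) (≗⇒≈ (section₁-cubed (gf P₂)))
        (≈-trans (≗⇒≈ (section-shift 0 (cubed ψ₃))) (≗⇒≈ (section₀-cubed ψ₃)))))
    (solve 2 (λ f x → f :* (con 0ℤ :+ (con 0ℤ :+ x)) := f :* x) ≈-refl φ₃ ψ₃)

  equation₂ : ψ₃ ⊗ (φ₃ ⊗ f₂ ⊕ (Ω ⊗ f₁ ⊕ Ω ⊗ f₁)) ≈ κ 0ℤ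
  equation₂ = ≈-trans (section-expansion (s≤s (s≤s (s≤s z≤n)))
      (≈-trans (≗⇒≈ (section-shift 1 (cubed Ω ⊗ RD))) (≗⇒≈ (section-⊗ (s≤s (s≤s z≤n)) Ω RD)))
      (section-ψ 2 (≗⇒≈ (section₂-cubed (gf P₁))) (≗⇒≈ (section₂-cubed (gf P₂)))
        (≈-trans (≗⇒≈ (section-shift 1 (cubed ψ₃))) (≗⇒≈ (section₁-cubed ψ₃)))))
    (solve 1 (λ f → f :* (con 0ℤ :+ (con 0ℤ :+ con 0ℤ)) := con 0ℤ) ≈-refl φ₃)

  ψψ₂≈ : ψ ⊗ (ψ₂ ⊕ ψ₂) ≈ ψ₃ ⊗ φ₃ ⊕ P ⊗ Ω
  ψψ₂≈ = begin
    ψ ⊗ (ψ₂ ⊕ ψ₂)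
      ≈⟨ ⊗-cong ≈-refl (≗⇒≈ λ n → trans (⊕-at ψ₂ ψ₂ n) (sym (gf-⊎ (triangles 1) (triangles 1) n))) ⟩
    ψ ⊗ gf (triangles 1 ⊎ᶜ triangles 1)
      ≈⟨ ≗⇒≈ (λ n → trans (sym (gf-× (triangles 0) (triangles 1 ⊎ᶜ triangles 1) n)) (ψψ₂ n)) ⟩
    gf ((triangles 2 ×ᶜ squares 2) ⊎ᶜ (P₂ ×ᶜ omega) ⊎ᶜ (P₁ ×ᶜ omega))
      ≈⟨ ≗⇒≈ (gf-⊎³ (triangles 2 ×ᶜ squares 2) (P₂ ×ᶜ omega) (P₁ ×ᶜ omega)
           (gf-× (triangles 2) (squares 2)) (gf-× P₂ omega) (gf-× P₁ omega)) ⟩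
    ψ₃ ⊗ φ₃ ⊕ (gf P₂ ⊗ Ω ⊕ gf P₁ ⊗ Ω)
      ≈⟨ solve 4 (λ x y z w → x :+ (z :* w :+ y :* w) := x :+ (y :+ z) :* w) ≈-refl (ψ₃ ⊗ φ₃) (gf P₁) (gf P₂) Ω ⟩
    ψ₃ ⊗ φ₃ ⊕ P ⊗ Ω ∎
    where open Relation.Binary.Reasoning.Setoid setoid

  -- The combination φ₃² · equation₂ − 2 Ω φ₃ · equation₁ + 4 Ω² · equation₀ eliminates f₀ and f₁.
  f₂-equation : ψ₃ ⊗ f₂ ⊗ (φ₃ ⊗ (φ₃ ⊗ φ₃) ⊕ κ (+ 8) ⊗ (mono 1 ⊗ (Ω ⊗ (Ω ⊗ Ω))))
              ≈ κ (+ 2) ⊗ Ω ⊗ φ₃ ⊗ (κ (+ 4) ⊗ (ψ ⊗ ψ₂) ⊕ ⊝ (κ (+ 3) ⊗ φ₃ ⊗ ψ₃))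
  f₂-equation = begin
    ψ₃ ⊗ f₂ ⊗ (φ₃ ⊗ (φ₃ ⊗ φ₃) ⊕ κ (+ 8) ⊗ (mono 1 ⊗ (Ω ⊗ (Ω ⊗ Ω))))
      ≈⟨ solve 7 (λ s f o q a b c →
           s :* c :* (f :* (f :* f) :+ con (+ 8) :* (q :* (o :* (o :* o))))
             := f :* f :* (s :* (f :* c :+ (o :* b :+ o :* b)))
             :+ :- (con (+ 2) :* o :* f :* (s :* (f :* b :+ (o :* a :+ o :* a))))
             :+ con (+ 4) :* o :* o :* (s :* (f :* a :+ (q :* (o :* c) :+ q :* (o :* c)))))
           ≈-refl ψ₃ φ₃ Ω (mono 1) f₀ f₁ f₂ ⟩
    φ₃ ⊗ φ₃ ⊗ (ψ₃ ⊗ (φ₃ ⊗ f₂ ⊕ (Ω ⊗ f₁ ⊕ Ω ⊗ f₁)))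
      ⊕ ⊝ (κ (+ 2) ⊗ Ω ⊗ φ₃ ⊗ (ψ₃ ⊗ (φ₃ ⊗ f₁ ⊕ (Ω ⊗ f₀ ⊕ Ω ⊗ f₀))))
      ⊕ κ (+ 4) ⊗ Ω ⊗ Ω ⊗ (ψ₃ ⊗ (φ₃ ⊗ f₀ ⊕ (mono 1 ⊗ (Ω ⊗ f₂) ⊕ mono 1 ⊗ (Ω ⊗ f₂))))
      ≈⟨ ⊕-cong (⊕-cong (⊗-cong (≈-refl {φ₃ ⊗ φ₃}) equation₂)
                        (⊝-cong (⊗-cong (≈-refl {κ (+ 2) ⊗ Ω ⊗ φ₃}) equation₁)))
                (⊗-cong (≈-refl {κ (+ 4) ⊗ Ω ⊗ Ω}) equation₀) ⟩
    φ₃ ⊗ φ₃ ⊗ κ 0ℤ ⊕ ⊝ (κ (+ 2) ⊗ Ω ⊗ φ₃ ⊗ (φ₃ ⊗ ψ₃)) ⊕ κ (+ 4) ⊗ Ω ⊗ Ω ⊗ (φ₃ ⊗ P)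
      ≈⟨ solve 4 (λ s f o p →
           f :* f :* con 0ℤ :+ :- (con (+ 2) :* o :* f :* (f :* s)) :+ con (+ 4) :* o :* o :* (f :* p)
             := con (+ 2) :* o :* f :* (con (+ 2) :* (s :* f :+ p :* o) :+ :- (con (+ 3) :* f :* s)))
           ≈-refl ψ₃ φ₃ Ω P ⟩
    κ (+ 2) ⊗ Ω ⊗ φ₃ ⊗ (κ (+ 2) ⊗ (ψ₃ ⊗ φ₃ ⊕ P ⊗ Ω) ⊕ ⊝ (κ (+ 3) ⊗ φ₃ ⊗ ψ₃))
      -- P survives only in the product P Ω, which the lattice identity expresses by theta series.
      ≈⟨ ⊗-cong ≈-refl (⊕-cong (⊗-cong ≈-refl (≈-sym ψψ₂≈)) ≈-refl) ⟩
    κ (+ 2) ⊗ Ω ⊗ φ₃ ⊗ (κ (+ 2) ⊗ (ψ ⊗ (ψ₂ ⊕ ψ₂)) ⊕ ⊝ (κ (+ 3) ⊗ φ₃ ⊗ ψ₃))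
      ≈⟨ solve 5 (λ s f o x y →
           con (+ 2) :* o :* f :* (con (+ 2) :* (x :* (y :+ y)) :+ :- (con (+ 3) :* f :* s))
             := con (+ 2) :* o :* f :* (con (+ 4) :* (x :* y) :+ :- (con (+ 3) :* f :* s)))
           ≈-refl ψ₃ φ₃ Ω ψ ψ₂ ⟩
    κ (+ 2) ⊗ Ω ⊗ φ₃ ⊗ (κ (+ 4) ⊗ (ψ ⊗ ψ₂) ⊕ ⊝ (κ (+ 3) ⊗ φ₃ ⊗ ψ₃)) ∎
    where open Relation.Binary.Reasoning.Setoid setoid

  -- Constant term 1 makes `u` a non-zero-divisor for every modulus: the constant term of `a`
  -- vanishes, hence u times `tail a` vanishes too, and the argument repeats.
  cancel : ∀ u a → u 0 ≡ 1ℤ → u ⊗ a ≈ κ 0ℤ → a ≈ κ 0ℤ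
  cancel u a u₀≡1 ua≈0 = coeffwise λ n → mod-trans (go n a (λ i → mod-trans (ua≈0 at i) (mod-reflexive (κ0 i)))) (mod-reflexive (sym (κ0 n)))
    where
    go : ∀ n a → (∀ i → (u ⊗ a) i ≡ 0ℤ [mod m ]) → a n ≡ 0ℤ [mod m ]
    head : ∀ a → (∀ i → (u ⊗ a) i ≡ 0ℤ [mod m ]) → a 0 ≡ 0ℤ [mod m ]
    head a p = mod-trans (mod-reflexive (sym (trans (cong (ℤ._* a 0) u₀≡1) (ℤ.*-identityˡ (a 0))))) (p 0)
    go zero a p = head a p
    go (suc n) a p = go n (tail a) λ i → mod-trans (mod-reflexive (rearrange i))
      (mod-trans (mod-+ (p (suc i)) (mod-neg (mod-* (mod-reflexive {x = u (suc i)} refl) (head a p))))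
                 (mod-reflexive (zeros (u (suc i)))))
      where
      zeros : ∀ x → 0ℤ ℤ.+ ℤ.- (x ℤ.* 0ℤ) ≡ 0ℤ
      zeros = solve-∀
      lemma : ∀ x y → x ≡ x ℤ.+ y ℤ.- y
      lemma = solve-∀
      rearrange : ∀ i → (u ⊗ tail a) i ≡ (u ⊗ a) (suc i) ℤ.+ ℤ.- (u (suc i) ℤ.* a 0)
      rearrange i = trans (lemma _ (u (suc i) ℤ.* a 0)) (cong (ℤ._- (u (suc i) ℤ.* a 0)) (sym (⊗-suc u a i)))

  ≈-from-difference : ∀ {a b} → a ⊕ ⊝ b ≈ κ 0ℤ → a ≈ b
  ≈-from-difference {a} {b} p = ≈-trans (solve 2 (λ x y → x := x :+ :- y :+ y) ≈-refl a b)
    (≈-trans (⊕-cong p ≈-refl) (solve 1 (λ y → con 0ℤ :+ y := y) ≈-refl b))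

  modulus : κ (+ m) ≈ κ 0ℤ
  modulus = coeffwise λ { zero → 1ℤ , lemma (+ m) ; (suc n) → mod-reflexive refl }
    where
    lemma : ∀ x → x ≡ 0ℤ ℤ.+ 1ℤ ℤ.* x
    lemma = solve-∀

-- The congruence modulo 8

module Modulo8 where
  open SeriesMod 8
  open Dissection 8
  open Relation.Binary.Reasoning.Setoid setoid

  -- Modulo 8 the determinant is φ₃³ and the term with 2 · 4 ψ ψ₂ drops out, leaving ψ₃ φ₃³ f₂ ≡ -6
  -- Ω φ₃² ψ₃, from which ψ₃ φ₃² is cancelled.
  f₂φ₃ : φ₃ ⊗ f₂ ⊕ κ (+ 6) ⊗ Ω ≈ κ 0ℤ
  f₂φ₃ = cancel φ₃ _ refl (cancel φ₃ _ refl (cancel ψ₃ _ refl (begin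
    ψ₃ ⊗ (φ₃ ⊗ (φ₃ ⊗ (φ₃ ⊗ f₂ ⊕ κ (+ 6) ⊗ Ω)))
      ≈⟨ solve 7 (λ s f o q c x y → s :* (f :* (f :* (f :* c :+ con (+ 6) :* o)))
           := s :* c :* (f :* (f :* f) :+ con (+ 8) :* (q :* (o :* (o :* o))))
              :+ :- (con (+ 2) :* o :* f :* (con (+ 4) :* (x :* y) :+ :- (con (+ 3) :* f :* s)))
              :+ con (+ 8) :* (o :* f :* x :* y :+ :- (s :* c :* q :* o :* o :* o)))
           ≈-refl ψ₃ φ₃ Ω (mono 1) f₂ ψ ψ₂ ⟩
    L ⊕ ⊝ R ⊕ κ (+ 8) ⊗ T
      ≈⟨ ⊕-cong (⊕-cong f₂-equation ≈-refl) (⊗-cong modulus ≈-refl) ⟩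
    R ⊕ ⊝ R ⊕ κ 0ℤ ⊗ T
      ≈⟨ solve 2 (λ r t → r :+ :- r :+ con 0ℤ :* t := con 0ℤ) ≈-refl R T ⟩
    κ 0ℤ ∎)))
    where
    L R T : Series
    L = ψ₃ ⊗ f₂ ⊗ (φ₃ ⊗ (φ₃ ⊗ φ₃) ⊕ κ (+ 8) ⊗ (mono 1 ⊗ (Ω ⊗ (Ω ⊗ Ω))))
    R = κ (+ 2) ⊗ Ω ⊗ φ₃ ⊗ (κ (+ 4) ⊗ (ψ ⊗ ψ₂) ⊕ ⊝ (κ (+ 3) ⊗ φ₃ ⊗ ψ₃))
    T = Ω ⊗ φ₃ ⊗ ψ ⊗ ψ₂ ⊕ ⊝ (ψ₃ ⊗ f₂ ⊗ mono 1 ⊗ Ω ⊗ Ω ⊗ Ω)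

  -- After multiplication by φ₃ the difference of the two sides is -2 Ω (3 + φ₃²), and 3 + φ₃² is
  -- divisible by 4.
  f₂≈ : f₂ ≈ κ (+ 2) ⊗ (Ω ⊗ φ₃)
  f₂≈ = ≈-from-difference (cancel φ₃ _ refl (begin
    φ₃ ⊗ (f₂ ⊕ ⊝ (κ (+ 2) ⊗ (Ω ⊗ φ₃)))
      ≈⟨ solve 3 (λ f c o → f :* (c :+ :- (con (+ 2) :* (o :* f)))
           := f :* c :+ con (+ 6) :* o :+ :- (con (+ 2) :* o :* (con (+ 3) :+ f :* f))) ≈-refl φ₃ f₂ Ω ⟩
    φ₃ ⊗ f₂ ⊕ κ (+ 6) ⊗ Ω ⊕ ⊝ (κ (+ 2) ⊗ Ω ⊗ (κ (+ 3) ⊕ φ₃ ⊗ φ₃))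
      ≈⟨ ⊕-cong f₂φ₃ (⊝-cong (⊗-cong (≈-refl {κ (+ 2) ⊗ Ω}) (⊕-cong ≈-refl (⊗-cong φ₃≈ φ₃≈)))) ⟩
    κ 0ℤ ⊕ ⊝ (κ (+ 2) ⊗ Ω ⊗ (κ (+ 3) ⊕ (κ 1ℤ ⊕ (t ⊕ t)) ⊗ (κ 1ℤ ⊕ (t ⊕ t))))
      ≈⟨ solve 2 (λ t o → con 0ℤ :+ :- (con (+ 2) :* o :* (con (+ 3) :+ (con 1ℤ :+ (t :+ t)) :* (con 1ℤ :+ (t :+ t))))
           := con (+ 8) :* (:- (o :* (con 1ℤ :+ t :+ t :* t)))) ≈-refl t Ω ⟩
    κ (+ 8) ⊗ ⊝ (Ω ⊗ (κ 1ℤ ⊕ t ⊕ t ⊗ t))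
      ≈⟨ ⊗-cong modulus ≈-refl ⟩
    κ 0ℤ ⊗ ⊝ (Ω ⊗ (κ 1ℤ ⊕ t ⊕ t ⊗ t))
      ≈⟨ solve 1 (λ x → con 0ℤ :* x := con 0ℤ) ≈-refl (⊝ (Ω ⊗ (κ 1ℤ ⊕ t ⊕ t ⊗ t))) ⟩
    κ 0ℤ ∎))
    where
    t : Series
    t = proj₁ φ₃-odd-part
    φ₃≈ : φ₃ ≈ κ 1ℤ ⊕ (t ⊕ t)
    φ₃≈ = ≗⇒≈ (proj₂ φ₃-odd-part)

-- The congruence modulo 3

module Modulo3 where
  open SeriesMod 3
  open Sums 3
  open Dissection 3
  open Relation.Binary.Reasoning.Setoid setoid

  from-residue : ∀ {c} r → c ≡ r [mod 3 ] → r ℤ.* (r ℤ.* r) ≡ r [mod 3 ] → c ℤ.* (c ℤ.* c) ≡ c [mod 3 ]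
  from-residue r c≡r r³≡r = mod-trans (mod-* c≡r (mod-* c≡r c≡r)) (mod-trans r³≡r (mod-sym c≡r))

  fermat : ∀ c → c ℤ.* (c ℤ.* c) ≡ c [mod 3 ]
  fermat c with c %ℕ 3 | c /ℕ 3 | a≡a%ℕn+[a/ℕn]*n c 3 | n%ℕd<d c 3
  ... | 0 | q | eq | _ = from-residue 0ℤ (q , eq) (0ℤ , refl)
  ... | 1 | q | eq | _ = from-residue 1ℤ (q , eq) (0ℤ , refl)
  ... | 2 | q | eq | _ = from-residue (+ 2) (q , eq) (+ 2 , refl)
  ... | suc (suc (suc _)) | _ | _ | s≤s (s≤s (s≤s ()))

  head-tail : ∀ a → a ≈ κ (a 0) ⊕ mono 1 ⊗ tail a
  head-tail a = ≈-trans (≗⇒≈ split) (⊕-cong ≈-refl (shift≈ (tail a)))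
    where
    split : a ≗ κ (a 0) ⊕ shift (tail a)
    split zero = sym (trans (⊕-at (κ (a 0)) (shift (tail a)) 0) (ℤ.+-identityʳ (a 0)))
    split (suc n) = sym (trans (⊕-at (κ (a 0)) (shift (tail a)) (suc n)) (ℤ.+-identityˡ (a (suc n))))

  cube-expand : ∀ a → a ⊗ (a ⊗ a) ≈ κ (a 0 ℤ.* (a 0 ℤ.* a 0)) ⊕ mono 3 ⊗ (tail a ⊗ (tail a ⊗ tail a))
  cube-expand a = begin
    a ⊗ (a ⊗ a)
      ≈⟨ ⊗-cong (head-tail a) (⊗-cong (head-tail a) (head-tail a)) ⟩
    (c ⊕ q ⊗ b) ⊗ ((c ⊕ q ⊗ b) ⊗ (c ⊕ q ⊗ b))
      ≈⟨ solve 3 (λ c q b → (c :+ q :* b) :* ((c :+ q :* b) :* (c :+ q :* b))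
           := c :* (c :* c) :+ con (+ 3) :* (c :* c :* q :* b :+ c :* q :* q :* b :* b) :+ q :* (q :* q) :* (b :* (b :* b)))
           ≈-refl c q b ⟩
    c ⊗ (c ⊗ c) ⊕ κ (+ 3) ⊗ (c ⊗ c ⊗ q ⊗ b ⊕ c ⊗ q ⊗ q ⊗ b ⊗ b) ⊕ q ⊗ (q ⊗ q) ⊗ (b ⊗ (b ⊗ b))
      ≈⟨ ⊕-cong (⊕-cong (≈-sym (≈-trans (≗⇒≈ (κ-* (a 0) (a 0 ℤ.* a 0))) (⊗-cong ≈-refl (≗⇒≈ (κ-* (a 0) (a 0))))))
                         (⊗-cong modulus ≈-refl))
                (⊗-cong (≈-trans (⊗-cong ≈-refl (≗⇒≈ λ n → sym (mono-+ 1 1 n))) (≗⇒≈ λ n → sym (mono-+ 1 2 n))) ≈-refl) ⟩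
    κ (a 0 ℤ.* (a 0 ℤ.* a 0)) ⊕ κ 0ℤ ⊗ (c ⊗ c ⊗ q ⊗ b ⊕ c ⊗ q ⊗ q ⊗ b ⊗ b) ⊕ mono 3 ⊗ (b ⊗ (b ⊗ b))
      ≈⟨ solve 3 (λ x y z → x :+ con 0ℤ :* y :+ z := x :+ z) ≈-refl (κ (a 0 ℤ.* (a 0 ℤ.* a 0)))
           (c ⊗ c ⊗ q ⊗ b ⊕ c ⊗ q ⊗ q ⊗ b ⊗ b) (mono 3 ⊗ (b ⊗ (b ⊗ b))) ⟩
    κ (a 0 ℤ.* (a 0 ℤ.* a 0)) ⊕ mono 3 ⊗ (b ⊗ (b ⊗ b)) ∎
    where
    b c q : Series
    b = tail a
    c = κ (a 0)
    q = mono 1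

  -- Write a = a₀ + q b. Modulo 3 the mixed terms of the cube vanish, leaving a₀ + q³ b³ by Fermat,
  -- and the induction continues with the tail b.
  frobenius : ∀ a → a ⊗ (a ⊗ a) ≈ cubed a
  frobenius a = coeffwise (go a)
    where
    cube : Series → Series
    cube a = a ⊗ (a ⊗ a)
    expand-at : ∀ a n → cube a n ≡ κ (a 0 ℤ.* (a 0 ℤ.* a 0)) n ℤ.+ (mono 3 ⊗ cube (tail a)) n [mod 3 ]
    expand-at a n = mod-trans (cube-expand a at n) (mod-reflexive (⊕-at _ _ n))
    go : ∀ a n → cube a n ≡ cubed a n [mod 3 ]
    go a 0 = fermat (a 0)
    go a 1 = mod-trans (expand-at a 1) (mod-reflexive (trans (ℤ.+-identityˡ _) (mono-⊗-< 3 (cube (tail a)) 1 (s≤s (s≤s z≤n)))))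
    go a 2 = mod-trans (expand-at a 2) (mod-reflexive (trans (ℤ.+-identityˡ _) (mono-⊗-< 3 (cube (tail a)) 2 (s≤s (s≤s (s≤s z≤n))))))
    go a (suc (suc (suc n))) = mod-trans (expand-at a (3 + n))
      (mod-trans (mod-reflexive (trans (ℤ.+-identityˡ _) (mono-⊗-≥ 3 (cube (tail a)) n))) (go (tail a) n))

  φ³≈ : φ ⊗ (φ ⊗ φ) ≈ φ₃
  φ³≈ = ≈-trans (frobenius φ) (≗⇒≈ λ n → sym (squares-cubed 0 n))

  ψ³≈ : ψ ⊗ (ψ ⊗ ψ) ≈ ψ₃
  ψ³≈ = ≈-trans (frobenius ψ) (≗⇒≈ λ n → sym (triangles-cubed 0 n))

  φψ₂≈ : φ ⊗ ψ₂ ≈ ψ ⊗ ψ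
  φψ₂≈ = ≗⇒≈ λ n → trans (sym (gf-× (squares 0) (triangles 1) n)) (trans (φψ₂ n) (gf-× (triangles 0) (triangles 0) n))

  -- As 8 ≡ 2 and cubing is q ↦ q³, the determinant of the linear system is the 3-dissection of φ
  -- read backwards.
  φ-from-cubes : φ₃ ⊗ (φ₃ ⊗ φ₃) ⊕ κ (+ 8) ⊗ (mono 1 ⊗ (Ω ⊗ (Ω ⊗ Ω))) ≈ φ
  φ-from-cubes = begin
    φ₃ ⊗ (φ₃ ⊗ φ₃) ⊕ κ (+ 8) ⊗ (mono 1 ⊗ (Ω ⊗ (Ω ⊗ Ω)))
      ≈⟨ ⊕-cong (frobenius φ₃) (⊗-cong ≈-refl (⊗-cong (≈-refl {mono 1}) (frobenius Ω))) ⟩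
    cubed φ₃ ⊕ κ (+ 8) ⊗ (mono 1 ⊗ cubed Ω)
      ≈⟨ ⊕-cong ≈-refl (⊗-cong ≈-refl (≈-sym (shift≈ (cubed Ω)))) ⟩
    cubed φ₃ ⊕ κ (+ 8) ⊗ shift (cubed Ω)
      ≈⟨ solve 2 (λ x y → x :+ con (+ 8) :* y := x :+ (y :+ y) :+ con (+ 3) :* (y :+ y)) ≈-refl (cubed φ₃) (shift (cubed Ω)) ⟩
    cubed φ₃ ⊕ (shift (cubed Ω) ⊕ shift (cubed Ω)) ⊕ κ (+ 3) ⊗ (shift (cubed Ω) ⊕ shift (cubed Ω))
      ≈⟨ ⊕-cong (≈-sym φ≈) (⊗-cong modulus ≈-refl) ⟩
    φ ⊕ κ 0ℤ ⊗ (shift (cubed Ω) ⊕ shift (cubed Ω))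
      ≈⟨ solve 2 (λ x y → x :+ con 0ℤ :* y := x) ≈-refl φ (shift (cubed Ω) ⊕ shift (cubed Ω)) ⟩
    φ ∎

  -- With the multiple of 3 gone, ψ₃ φ f₂ ≡ 8 Ω φ₃ ψ ψ₂ ≡ 8 Ω φ³ ψ ψ₂ = 8 Ω φ² ψ³ ≡ 8 Ω φ² ψ₃; then
  -- ψ₃ and φ are cancelled.
  f₂≈ : f₂ ≈ κ (+ 8) ⊗ (φ ⊗ Ω)
  f₂≈ = ≈-from-difference (cancel φ _ refl (cancel ψ₃ _ refl (begin
    ψ₃ ⊗ (φ ⊗ (f₂ ⊕ ⊝ (κ (+ 8) ⊗ (φ ⊗ Ω))))
      ≈⟨ solve 4 (λ s f c o → s :* (f :* (c :+ :- (con (+ 8) :* (f :* o))))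
           := s :* c :* f :+ :- (con (+ 8) :* f :* f :* o :* s)) ≈-refl ψ₃ φ f₂ Ω ⟩
    ψ₃ ⊗ f₂ ⊗ φ ⊕ ⊝ (κ (+ 8) ⊗ φ ⊗ φ ⊗ Ω ⊗ ψ₃)
      ≈⟨ ⊕-cong (⊗-cong (≈-refl {ψ₃ ⊗ f₂}) (≈-sym φ-from-cubes)) ≈-refl ⟩
    ψ₃ ⊗ f₂ ⊗ (φ₃ ⊗ (φ₃ ⊗ φ₃) ⊕ κ (+ 8) ⊗ (mono 1 ⊗ (Ω ⊗ (Ω ⊗ Ω)))) ⊕ ⊝ (κ (+ 8) ⊗ φ ⊗ φ ⊗ Ω ⊗ ψ₃)
      ≈⟨ ⊕-cong f₂-equation ≈-refl ⟩
    κ (+ 2) ⊗ Ω ⊗ φ₃ ⊗ (κ (+ 4) ⊗ (ψ ⊗ ψ₂) ⊕ ⊝ (κ (+ 3) ⊗ φ₃ ⊗ ψ₃)) ⊕ ⊝ (κ (+ 8) ⊗ φ ⊗ φ ⊗ Ω ⊗ ψ₃)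
      ≈⟨ solve 6 (λ s f o p x y →
           con (+ 2) :* o :* f :* (con (+ 4) :* (x :* y) :+ :- (con (+ 3) :* f :* s)) :+ :- (con (+ 8) :* p :* p :* o :* s)
             := con (+ 8) :* (o :* (f :* (x :* y)) :+ :- (p :* p :* o :* s)) :+ con (+ 3) :* (:- (con (+ 2) :* o :* f :* f :* s)))
           ≈-refl ψ₃ φ₃ Ω φ ψ ψ₂ ⟩
    κ (+ 8) ⊗ (Ω ⊗ (φ₃ ⊗ (ψ ⊗ ψ₂)) ⊕ ⊝ (φ ⊗ φ ⊗ Ω ⊗ ψ₃)) ⊕ κ (+ 3) ⊗ T
      ≈⟨ ⊕-cong (⊗-cong ≈-refl (⊕-cong (⊗-cong ≈-refl (⊗-cong (≈-sym φ³≈) ≈-refl))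
                                       (⊝-cong (⊗-cong (≈-refl {φ ⊗ φ ⊗ Ω}) (≈-sym ψ³≈)))))
                (⊗-cong modulus ≈-refl) ⟩
    κ (+ 8) ⊗ (Ω ⊗ (φ ⊗ (φ ⊗ φ) ⊗ (ψ ⊗ ψ₂)) ⊕ ⊝ (φ ⊗ φ ⊗ Ω ⊗ (ψ ⊗ (ψ ⊗ ψ)))) ⊕ κ 0ℤ ⊗ T
      ≈⟨ solve 5 (λ o p x y t →
           con (+ 8) :* (o :* (p :* (p :* p) :* (x :* y)) :+ :- (p :* p :* o :* (x :* (x :* x)))) :+ con 0ℤ :* t
             := con (+ 8) :* (p :* p :* o :* x) :* (p :* y :+ :- (x :* x))) ≈-refl Ω φ ψ ψ₂ T ⟩
    κ (+ 8) ⊗ (φ ⊗ φ ⊗ Ω ⊗ ψ) ⊗ (φ ⊗ ψ₂ ⊕ ⊝ (ψ ⊗ ψ))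
      ≈⟨ ⊗-cong (≈-refl {κ (+ 8) ⊗ (φ ⊗ φ ⊗ Ω ⊗ ψ)}) (⊕-cong φψ₂≈ ≈-refl) ⟩
    κ (+ 8) ⊗ (φ ⊗ φ ⊗ Ω ⊗ ψ) ⊗ (ψ ⊗ ψ ⊕ ⊝ (ψ ⊗ ψ))
      ≈⟨ solve 2 (λ x y → x :* (y :+ :- y) := con 0ℤ) ≈-refl (κ (+ 8) ⊗ (φ ⊗ φ ⊗ Ω ⊗ ψ)) (ψ ⊗ ψ) ⟩
    κ 0ℤ ∎)))
    where
    T : Series
    T = ⊝ (κ (+ 2) ⊗ Ω ⊗ φ₃ ⊗ φ₃ ⊗ ψ₃)

-- Combining the two moduli

unsign : ∀ {m} N → RD N ≡ 0ℤ [mod m ] → + RD49 N ≡ 0ℤ [mod m ]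
unsign {m} N p = mod-trans (mod-reflexive (sym (trans (sym (ℤ.*-assoc (sign N) (sign N) (+ RD49 N)))
    (trans (cong (ℤ._* + RD49 N) (sign-square N)) (ℤ.*-identityˡ (+ RD49 N))))))
  (mod-trans (mod-* (mod-reflexive {x = sign N} refl) p) (mod-reflexive (ℤ.*-zeroʳ (sign N))))

-- From 9 - 8 = 1: if x = 8k = 3l, then x = 9x - 8x = 72k - 24l.
divisible-by-24 : ∀ x → + x ≡ 0ℤ [mod 8 ] → + x ≡ 0ℤ [mod 3 ] → 24 ∣ x
divisible-by-24 x (k , p) (l , q) = ℕ.divides ℤ.∣ + 3 ℤ.* k ℤ.- l ∣
  (trans (cong ℤ.∣_∣ (trans (lemma (+ x)) (trans (cong₂ (λ y z → + 9 ℤ.* y ℤ.- + 8 ℤ.* z) p q) (lemma′ k l))))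
    (ℤ.abs-* (+ 3 ℤ.* k ℤ.- l) (+ 24)))
  where
  lemma : ∀ x → x ≡ + 9 ℤ.* x ℤ.- + 8 ℤ.* x
  lemma = solve-∀
  lemma′ : ∀ k l → + 9 ℤ.* (0ℤ ℤ.+ k ℤ.* + 8) ℤ.- + 8 ℤ.* (0ℤ ℤ.+ l ℤ.* + 3) ≡ (+ 3 ℤ.* k ℤ.- l) ℤ.* + 24
  lemma′ = solve-∀

-- The vanishing of the coefficient of Ω φ₃ serves the modulus 8, the oddness of `N` the modulus 3.
RD49-divisible : ∀ {K} N j → K ≡ N * 3 + 2 → N ≡ 1 + 2 * j → gf (omega ×ᶜ squares 2) N ≡ 0ℤ → 24 ∣ RD49 K
RD49-divisible N j refl N-odd vanishes = divisible-by-24 (RD49 (N * 3 + 2))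
  (unsign (N * 3 + 2) (mod-trans (SeriesMod._at_ Modulo8.f₂≈ N) (mod-reflexive (begin
    (κ (+ 2) ⊗ (Ω ⊗ φ₃)) N          ≡⟨ κ-⊗ (+ 2) (Ω ⊗ φ₃) N ⟩
    + 2 ℤ.* (Ω ⊗ φ₃) N              ≡⟨ cong (ℤ._*_ (+ 2)) (trans (sym (gf-× omega (squares 2) N)) vanishes) ⟩
    0ℤ                              ∎))))
  (unsign (N * 3 + 2) (mod-trans (SeriesMod._at_ Modulo3.f₂≈ N) (+ 8 ℤ.* t , (begin
    (κ (+ 8) ⊗ (φ ⊗ Ω)) N           ≡⟨ κ-⊗ (+ 8) (φ ⊗ Ω) N ⟩
    + 8 ℤ.* (φ ⊗ Ω) N               ≡⟨ cong (ℤ._*_ (+ 8)) (trans (sym (gf-× (squares 0) omega N))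
                                        (trans (cong (gf (squares 0 ×ᶜ omega)) N-odd) (proj₂ (φΩ-odd j)))) ⟩
    + 8 ℤ.* (+ 3 ℤ.* t)             ≡⟨ lemma t ⟩
    0ℤ ℤ.+ + 8 ℤ.* t ℤ.* + 3        ∎))))
  where
  open ≡-Reasoning
  t : ℤ
  t = proj₁ (φΩ-odd j)
  lemma : ∀ t → + 8 ℤ.* (+ 3 ℤ.* t) ≡ 0ℤ ℤ.+ + 8 ℤ.* t ℤ.* + 3
  lemma = solve-∀

theorem6p1 : (n : ℕ) →
    (24 ∣ RD49 (24 * n + 23)) × (24 ∣ RD49 (48 * n + 29)) × (24 ∣ RD49 (96 * n + 89))
theorem6p1 n =
  RD49-divisible (8 * n + 7) (4 * n + 3) (index₁ n) (odd₁ n) (Ωφ₃-vanishes 8 7 (from-yes (avoids? 8 7)) n) ,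
  RD49-divisible (16 * n + 9) (8 * n + 4) (index₂ n) (odd₂ n) (Ωφ₃-vanishes 16 9 (from-yes (avoids? 16 9)) n) ,
  RD49-divisible (32 * n + 29) (16 * n + 14) (index₃ n) (odd₃ n) (Ωφ₃-vanishes 32 29 (from-yes (avoids? 32 29)) n)
  where
  index₁ : ∀ n → 24 * n + 23 ≡ (8 * n + 7) * 3 + 2
  index₁ = ℕSolver.solve-∀
  index₂ : ∀ n → 48 * n + 29 ≡ (16 * n + 9) * 3 + 2
  index₂ = ℕSolver.solve-∀
  index₃ : ∀ n → 96 * n + 89 ≡ (32 * n + 29) * 3 + 2
  index₃ = ℕSolver.solve-∀
  odd₁ : ∀ n → 8 * n + 7 ≡ 1 + 2 * (4 * n + 3)
  odd₁ = ℕSolver.solve-∀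
  odd₂ : ∀ n → 16 * n + 9 ≡ 1 + 2 * (8 * n + 4)
  odd₂ = ℕSolver.solve-∀
  odd₃ : ∀ n → 32 * n + 29 ≡ 1 + 2 * (16 * n + 14)
  odd₃ = ℕSolver.solve-∀
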